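{- Let $q \ge 1$ be an odd integer and let $a$ and $b$ be admissible residue classes modulo $q$. Let $r \ge 1$, and let $\mathbf a = [a_1, \dots, a_r]$ be an $r$-tuple of residue classes modulo $q$ such that for some $1 \le j \le r$ we have $a_i = a$ whenever $i \le j$ and $a_i = b$ whenever $i > j$. Then $N(x;q,\mathbf a) \to \infty$ as $x \to \infty$.
   Context: Let $\mathbf E = \{m^2 + l^2 : m,l \text{ nonnegative integers}\}$ be the set of sums of two squares, and let $E_1 < E_2 < E_3 < \cdots$ be its elements listed in increasing order. A residue class $a$ modulo $q$ is called admissible if the congruence $x^2 + y^2 \equiv a \pmod q$ has a solution in integers $x,y$. For a modulus $q$, an integer $r \ge 1$ and an $r$-tuple $\mathbf a = [a_1,\dots,a_r]$ of admissible residue classes modulo $q$, define $N(x;q,\mathbf a) := \#\{E_n \le x : E_{n+i-1} \equiv a_i \pmod q \text{ for all } 1 \le i \le r\}$. -}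

module Defs where

open import Data.Nat using (ℕ; zero; suc; _+_; _*_; _≤_; _<_; _≤?_; NonZero)
open import Data.Nat.DivMod using (_%_)
open import Data.Nat.Properties using (_≟_)
open import Data.Product using (Σ; ∃; _×_; _,_)
open import Data.Bool using (Bool; true; false; if_then_else_; _∧_)
open import Data.List using (List; length; filter; upTo)
open import Data.Fin using (Fin; toℕ)
open import Relation.Nullary using (Dec; yes; no; does)
open import Relation.Nullary.Decidable using (_×-dec_)
open import Relation.Binary.PropositionalEquality using (_≡_)

InE : ℕ → Set
InE k = Σ ℕ λ m → Σ ℕ λ l → m * m + l * l ≡ k

private
  anyUpTo : (ℕ → Bool) → ℕ → Bool
  anyUpTo p zero    = p zero
  anyUpTo p (suc n) = if p (suc n) then true else anyUpTo p n

isE : ℕ → Bool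
isE k = anyUpTo (λ m → anyUpTo (λ l → does (m * m + l * l ≟ k)) k) k

firstEFrom : ℕ → ℕ → ℕ
firstEFrom s zero       = s
firstEFrom s (suc fuel) = if isE s then s else firstEFrom (suc s) fuel

-- Enumeration of 𝐄 in increasing order, 0-INDEXED:
-- E 0 = E_1 = 0, and E (suc n) is the least element of 𝐄 exceeding E n
-- (it lies in (E n, (E n + 1)²], since (E n + 1)² + 0² ∈ 𝐄).
E : ℕ → ℕ
E zero    = 0
E (suc n) = firstEFrom (suc (E n)) (suc (E n) * suc (E n))

Admissible : (q : ℕ) → .{{NonZero q}} → ℕ → Set
Admissible q a = Σ ℕ λ x → Σ ℕ λ y → (x * x + y * y) % q ≡ a % q

-- pattern test at (0-indexed) position n:
-- E (n + i) ≡ 𝐚 i (mod q) for all i < r  (i.e. E_{n+i-1} ≡ a_i with 1-indexing)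
private
  allFin? : (r : ℕ) → (Fin r → Bool) → Bool
  allFin? zero    p = true
  allFin? (suc r) p = p Fin.zero ∧ allFin? r (λ i → p (Fin.suc i))

patternAt? : (q : ℕ) → .{{NonZero q}} → (r : ℕ) → (Fin r → ℕ) → ℕ → Bool
patternAt? q r 𝐚 n = allFin? r (λ i → does (E (n + toℕ i) % q ≟ 𝐚 i % q))

-- N(x; q, 𝐚) = #{ n : E n ≤ x and pattern holds at n }.
-- Since E is strictly increasing with E 0 = 0, E n ≤ x forces n ≤ x,
-- so it suffices to range n over 0 … x.
N : ℕ → (q : ℕ) → .{{NonZero q}} → (r : ℕ) → (Fin r → ℕ) → ℕ
N x q r 𝐚 = length (filter (λ n → E n ≤? x) (filterB (upTo (suc x))))
  where
  filterB : List ℕ → List ℕ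
  filterB List.[] = List.[]
  filterB (n List.∷ ns) = if patternAt? q r 𝐚 n then n List.∷ filterB ns else filterB ns

{-# OPTIONS --safe #-}

-- Choose a product A of powers of primes that divide numbers i² + 1, and κ with A ∣ X² + κ².  If
-- k² ≡ κ² modulo A, then (X² + k²) / A is a sum of two squares, since dividing by a prime
-- p = c² + d² preserves sums of two squares.  The k with k² ≡ κ² are found by changing signs in
-- κ = A′ c + Σ oᵢ, where A = p₀² A′, the modulus A′ is the product of the prime powers Qᵢ and
-- oᵢ is a small multiple of q A′ / Qᵢ; hence they form clusters of many elements, each cluster in
-- a single class modulo q.  If g is not a square, (X² + g) / A is kept out of 𝐄 by a congruence on
-- X: some prime ℓ ≡ 3 (mod 4) not dividing A q divides X² + g exactly once.  So the k of two
-- consecutive clusters produce all elements of 𝐄 in their range: a long run in one class modulo q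
-- followed by a long run in another.  Prescribing the classes a and b is a problem modulo q,
-- solved one prime power at a time.
--
-- For g ≡ 1 (mod 4) the prime ℓ comes from real characters: if χ₄(p) = (p/g) = -1 held for no
-- prime p outside a finite set, then χ₄ ⋆ (·/g) would be nonnegative, and at least 1 on numbers
-- u² + g w², which are more than C √x in number up to x for every C; but its summatory function
-- is O(√x) by the hyperbola method.
module Submission where

-- The window for k is fixed before X, so only finitely many g have to be excluded. X then obeys
-- nothing but congruences, modulo A, q and the squares of the ℓ; it can be taken arbitrarily large,
-- and this is why the pattern recurs.
--
-- The sign at p₀ separates the two clusters. The other signs move k by small multiples of q and
-- supply the members of a cluster.
--
-- Both clusters share X and A, so both residues a and b must be reached as (X² + k²) / A with one
-- X. Hence A is chosen together with the residues: it is m² + 1 times a square, where m comes out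
-- of the problem modulo q. That A may be changed by squares leaves freedom to make its prime powers
-- large, hence the clusters narrow.
--
-- No theorem on primes in progressions is used. The primes added to A divide numbers D² + 1. For g
-- ≡ 2, 3 (mod 4) some y² + g is ≡ 3 (mod 4) and so has a prime factor ≡ 3; g divisible by 4 reduces
-- to g / 4. For g ≡ 1 the number y² + g is never ≡ 3 (mod 4), and this obstacle is what brings in
-- characters.

module Enumeration where

  -- Elements of 𝐄 in increasing order and the counting function.

  open import Defs
  open import Data.Nat
  open import Data.Nat.Properties
  open import Data.Nat.DivMod using (_%_)
  open import Data.Bool using (Bool; true; false; if_then_else_; _∧_; T)
  open import Data.Unit using (tt)
  open import Data.Fin using (Fin; toℕ)
  import Data.Fin as Fin
  open import Data.List using (List; []; _∷_; _++_; [_]; length; filter; upTo; applyUpTo)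
  open import Data.List.Properties using (applyUpTo-∷ʳ)
  open import Data.Product
  open import Data.Sum using (_⊎_; inj₁; inj₂; [_,_]′)
  open import Function using (id)
  open import Relation.Binary.PropositionalEquality hiding ([_])
  open import Relation.Nullary
  open import Relation.Nullary.Decidable using (dec-true)

  -- The helpers of Defs that are not exported get a name here: abstracting the operations that
  -- occur in the unfolded goal leaves a pattern unification problem, whose solution is the helper.
  mutual
    isE-helper : (Bool → Bool → Bool → Bool) → (ℕ → ℕ → Bool) → (ℕ → ℕ → ℕ) → (ℕ → ℕ → ℕ) → ℕ → Bool
    isE-helper = _

    isE-unfold : ∀ u → Σ Bool λ b → isE (suc u) ≡ (if b then true else isE-helper if_then_else_ _≡ᵇ_ _+_ _*_ u)
    isE-unfold u with if_then_else_ {A = Bool} | _≡ᵇ_ | _+_ | _*_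
    ... | _ | _ | _ | _ = _ , refl

  mutual
    pattern-helper : (q : ℕ) .{{_ : NonZero q}} (r : ℕ) → (ℕ → ℕ) → (Fin r → ℕ) → (ℕ → ℕ → Bool) → Bool
    pattern-helper = _

    pattern-unfold : ∀ q .{{_ : NonZero q}} r 𝐚 n → patternAt? q r 𝐚 n ≡ pattern-helper q r (n +_) 𝐚 _≡ᵇ_
    pattern-unfold q r 𝐚 n with (n +_) | _≡ᵇ_
    ... | _ | _ = refl

  mutual
    N-helper : (x q : ℕ) .{{_ : NonZero q}} (r : ℕ) → (Fin r → ℕ) → List ℕ → List ℕ
    N-helper = _

    N-unfold : ∀ x q .{{_ : NonZero q}} r 𝐚 → Σ (List ℕ) λ l →
      N x q r 𝐚 ≡ length (filter (λ n → E n ≤? x) (if patternAt? q r 𝐚 0 then l else N-helper x q r 𝐚 (applyUpTo suc x)))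
    N-unfold x q r 𝐚 with if_then_else_ {A = List ℕ} | applyUpTo suc x
    ... | _ | _ = _ , refl

  -- Projections in place of the operations collapse the inner search of the recovered helper to its
  -- first test, and the quadratic expression to `m`. What remains is the bounded search for an
  -- arbitrary predicate, so both loops of `isE` can be treated alike.
  any≤ : (ℕ → Bool) → ℕ → Bool
  any≤ p = isE-helper (λ b _ _ → b) (λ m _ → p m) (λ m _ → m) (λ m _ → m)

  any≤-sound : ∀ p n → any≤ p n ≡ true → Σ ℕ λ m → p m ≡ true
  any≤-sound p zero    e = 0 , e
  any≤-sound p (suc n) e with p (suc n) in eq
  ... | true  = suc n , eq
  ... | false = any≤-sound p n e

  any≤-complete : ∀ p {m} n → m ≤ n → p m ≡ true → any≤ p n ≡ true
  any≤-complete p zero    z≤n e = e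
  any≤-complete p (suc n) m≤n e with p (suc n) in eq | m≤n⇒m<n∨m≡n m≤n
  ... | true  | _ = refl
  ... | false | inj₁ (s≤s m≤n′) = any≤-complete p n m≤n′ e
  ... | false | inj₂ refl with () ← trans (sym eq) e

  does-≟⁺ : ∀ {m n} → m ≡ n → does (m ≟ n) ≡ true
  does-≟⁺ {m} {n} e = dec-true (m ≟ n) e

  does-≟⁻ : ∀ {m n} → does (m ≟ n) ≡ true → m ≡ n
  does-≟⁻ {m} {n} e = ≡ᵇ⇒≡ m n (subst T (sym e) tt)

  isE-sound : ∀ k → isE k ≡ true → InE k
  isE-sound k e with any≤-sound (λ m → any≤ (λ l → does (m * m + l * l ≟ k)) k) k e
  ... | m , e₁ with any≤-sound (λ l → does (m * m + l * l ≟ k)) k e₁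
  ... | l , e₂ = m , l , does-≟⁻ e₂

  m≤m*m : ∀ m → m ≤ m * m
  m≤m*m zero    = z≤n
  m≤m*m (suc m) = m≤m+n (suc m) _

  isE-complete : ∀ k → InE k → isE k ≡ true
  isE-complete k (m , l , refl) =
    any≤-complete (λ m′ → any≤ (λ l′ → does (m′ * m′ + l′ * l′ ≟ k)) k) k (≤-trans (m≤m*m m) (m≤m+n _ _))
      (any≤-complete (λ l′ → does (m * m + l′ * l′ ≟ k)) k (≤-trans (m≤m*m l) (m≤n+m _ _)) (does-≟⁺ {k} refl))

  record LeastFrom (s r : ℕ) : Set where
    field
      above   : s ≤ r
      member  : InE r
      minimal : ∀ {w} → InE w → s ≤ w → r ≤ w

  -- A member v within reach of the fuel guarantees success: when the fuel is spent, the bounds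
  -- squeeze v to s itself.
  firstEFrom-least : ∀ s fuel {v} → InE v → s ≤ v → v ≤ s + fuel → LeastFrom s (firstEFrom s fuel)
  firstEFrom-least s zero {v} v∈ s≤v v≤ = record
    { above = ≤-refl ; member = subst InE (≤-antisym (≤-trans v≤ (≤-reflexive (+-identityʳ s))) s≤v) v∈ ; minimal = λ _ s≤w → s≤w }
  firstEFrom-least s (suc fuel) {v} v∈ s≤v v≤ with isE s in eq
  ... | true  = record { above = ≤-refl ; member = isE-sound s eq ; minimal = λ _ s≤w → s≤w }
  ... | false = record
    { above = ≤-trans (n≤1+n s) above ; member = member ; minimal = λ w∈ s≤w → minimal w∈ (next w∈ s≤w) }
    where
    next : ∀ {w} → InE w → s ≤ w → suc s ≤ w
    next w∈ s≤w with m≤n⇒m<n∨m≡n s≤w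
    ... | inj₁ s<w = s<w
    ... | inj₂ refl with () ← trans (sym eq) (isE-complete s w∈)
    open LeastFrom (firstEFrom-least (suc s) fuel v∈ (next v∈ s≤v) (≤-trans v≤ (≤-reflexive (+-suc s fuel))))

  E-suc-least : ∀ n → LeastFrom (suc (E n)) (E (suc n))
  E-suc-least n = firstEFrom-least s (s * s) {s * s} (s , 0 , +-identityʳ (s * s)) (m≤m*m s) (m≤n+m (s * s) s)
    where s = suc (E n)

  E-< : ∀ n → E n < E (suc n)
  E-< n = LeastFrom.above (E-suc-least n)

  E-member : ∀ n → InE (E n)
  E-member zero    = 0 , 0 , refl
  E-member (suc n) = LeastFrom.member (E-suc-least n)

  E-next : ∀ n {v} → InE v → E n < v → E (suc n) ≤ v
  E-next n = LeastFrom.minimal (E-suc-least n)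

  n≤En : ∀ n → n ≤ E n
  n≤En zero    = z≤n
  n≤En (suc n) = ≤-trans (s≤s (n≤En n)) (E-< n)

  -- The sequence cannot jump over a member, and staying below v up to index v would contradict v ≤
  -- `E v`.
  E-index : ∀ {v} → InE v → Σ ℕ λ n → E n ≡ v
  E-index {v} v∈ = [ id , (λ v< → contradiction (n≤En v) (<⇒≱ v<)) ]′ (go v)
    where
    step : ∀ n → E n ≤ v → (Σ ℕ λ n → E n ≡ v) ⊎ E n < v
    step n le with m≤n⇒m<n∨m≡n le
    ... | inj₁ lt = inj₂ lt
    ... | inj₂ eq = inj₁ (n , eq)
    go : ∀ n → (Σ ℕ λ n → E n ≡ v) ⊎ E n < v
    go zero = step 0 z≤n
    go (suc n) with go n
    ... | inj₁ found = inj₁ found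
    ... | inj₂ lt = step (suc n) (E-next n v∈ lt)

  E-prev : ∀ n {v} → InE v → v < E (suc n) → v ≤ E n
  E-prev n v∈ v< = ≮⇒≥ λ En<v → <⇒≱ v< (E-next n v∈ En<v)

  pattern-holds : ∀ q .{{_ : NonZero q}} r 𝐚 n →
    (∀ i → E (n + toℕ i) % q ≡ 𝐚 i % q) → patternAt? q r 𝐚 n ≡ true
  pattern-holds q r 𝐚 n h = go r (n +_) 𝐚 h
    where
    go : ∀ r (g : ℕ → ℕ) (𝐚 : Fin r → ℕ) → (∀ i → E (g (toℕ i)) % q ≡ 𝐚 i % q) → pattern-helper q r g 𝐚 _≡ᵇ_ ≡ true
    go zero    g 𝐚 h = refl
    go (suc r) g 𝐚 h = cong₂ _∧_ (does-≟⁺ (h Fin.zero)) (go r (λ i → g (suc i)) (λ i → 𝐚 (Fin.suc i)) (λ i → h (Fin.suc i)))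

  module _ (q : ℕ) .{{_ : NonZero q}} (r : ℕ) (𝐚 : Fin r → ℕ) where

    -- The count `N` with the candidate positions as a separate list, so that the range can grow
    -- while x stays fixed.
    counted : ℕ → List ℕ → ℕ
    counted x ns = length (filter (λ n → E n ≤? x) (N-helper x q r 𝐚 ns))

    counted-snoc-≤ : ∀ x ns n → counted x ns ≤ counted x (ns ++ [ n ])
    counted-snoc-≤ x [] n = z≤n
    counted-snoc-≤ x (m ∷ ns) n with patternAt? q r 𝐚 m
    ... | false = counted-snoc-≤ x ns n
    ... | true with E m ≤ᵇ x
    ...   | true  = s≤s (counted-snoc-≤ x ns n)
    ...   | false = counted-snoc-≤ x ns n

    counted-snoc-< : ∀ x ns n → patternAt? q r 𝐚 n ≡ true → E n ≤ x → counted x ns < counted x (ns ++ [ n ])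
    counted-snoc-< x [] n pat le rewrite pat with E n ≤ᵇ x | ≤⇒≤ᵇ le
    ... | true | _ = s≤s z≤n
    counted-snoc-< x (m ∷ ns) n pat le with patternAt? q r 𝐚 m
    ... | false = counted-snoc-< x ns n pat le
    ... | true with E m ≤ᵇ x
    ...   | true  = s≤s (counted-snoc-< x ns n pat le)
    ...   | false = counted-snoc-< x ns n pat le

    counted-mono : ∀ x {m n} → m ≤ n → counted x (upTo m) ≤ counted x (upTo n)
    counted-mono x {m} {zero} z≤n = ≤-refl
    counted-mono x {m} {suc n} le with m≤n⇒m<n∨m≡n le
    ... | inj₂ refl = ≤-refl
    ... | inj₁ (s≤s m≤n) = ≤-trans (counted-mono x m≤n)
      (≤-trans (counted-snoc-≤ x (upTo n) n) (≤-reflexive (cong (counted x) (applyUpTo-∷ʳ id n))))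

    N-unbounded : (∀ b → Σ ℕ λ n → b ≤ n × patternAt? q r 𝐚 n ≡ true) → ∀ M → Σ ℕ λ x → M ≤ N x q r 𝐚
    N-unbounded often M with go M
      where
      go : ∀ M → Σ ℕ λ L → Σ ℕ λ x₀ → ∀ x → x₀ ≤ x → M ≤ counted x (upTo L)
      go zero = 0 , 0 , λ _ _ → z≤n
      go (suc M) with go M
      ... | L , x₀ , h with often L
      ... | n , L≤n , pat = suc n , x₀ ⊔ E n , λ x le →
        ≤-trans (s≤s (≤-trans (h x (m⊔n≤o⇒m≤o x₀ (E n) le)) (counted-mono x L≤n)))
          (≤-trans (counted-snoc-< x (upTo n) n pat (m⊔n≤o⇒n≤o x₀ (E n) le))
            (≤-reflexive (cong (counted x) (applyUpTo-∷ʳ id n))))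
    -- With x at least L, the range `upTo (suc x)` in `N` covers `upTo L`.
    ... | L , x₀ , h = x₀ ⊔ L , ≤-trans (h (x₀ ⊔ L) (m≤m⊔n x₀ L)) (counted-mono (x₀ ⊔ L) (≤-trans (m≤n⊔m x₀ L) (n≤1+n _)))

-- From two runs of members to a pattern of consecutive members.

module Patterns where

  open import Defs
  open Enumeration
  open import Data.Nat
  open import Data.Nat.Properties
  open import Data.Nat.DivMod using (_%_)
  open import Data.Product using (Σ; _×_; _,_)
  open import Data.Sum using (inj₁; inj₂)
  open import Relation.Binary.PropositionalEquality using (_≡_; refl; sym; trans; cong; subst)

  E-mono : ∀ {m n} → m ≤ n → E m ≤ E n
  E-mono {m} {n} m≤n with m≤n⇒m<n∨m≡n m≤n
  E-mono {m} {n} m≤n | inj₂ refl = ≤-refl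
  E-mono {m} {suc n} m≤n | inj₁ (s≤s m≤n′) = ≤-trans (E-mono m≤n′) (<⇒≤ (E-< n))

  -- The run has s + 1 members, at indices 0 to s; further elements of 𝐄 may lie between them.
  record Run (s : ℕ) : Set where
    field
      at     : ℕ → ℕ
      member : ∀ t → InE (at t)
      <-suc  : ∀ t → t < s → at t < at (suc t)

    mono : ∀ {t t′} → t ≤ t′ → t′ ≤ s → at t ≤ at t′
    mono {t} {t′} le le′ with m≤n⇒m<n∨m≡n le
    mono le le′ | inj₂ refl = ≤-refl
    mono {t} {suc t′} le le′ | inj₁ (s≤s t≤t′) = ≤-trans (mono t≤t′ (<⇒≤ le′)) (<⇒≤ (<-suc t′ le′))

  -- Let n₀ be the index of the last member of the first run. Going down i steps from n₀ cannot fall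
  -- below the i-th member from the end of that run, and going up i + 1 steps cannot pass the i-th
  -- member of the second. So the s + 1 elements of 𝐄 on either side lie in the two ranges, whatever
  -- they are, and starting at n₀ - j puts the change of class after index j.
  consecutive-runs : ∀ q .{{_ : NonZero q}} a b s (e f : Run s) →
    Run.at e s < Run.at f 0 →
    (∀ {v} → InE v → Run.at e 0 ≤ v → v ≤ Run.at e s → v % q ≡ a) →
    (∀ {v} → InE v → Run.at e s < v → v ≤ Run.at f s → v % q ≡ b) →
    ∀ j → j ≤ s → Σ ℕ λ n → Run.at e 0 ≤ E n ×
      (∀ i → i ≤ j → E (n + i) % q ≡ a) × (∀ i → j < i → i ≤ j + suc s → E (n + i) % q ≡ b)
  consecutive-runs q a b s e f e<f left right j j≤s with E-index (Run.member e s)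
  ... | n₀ , En₀≡ = found (down j j≤s)
    where
    module e = Run e
    module f = Run f
    down : ∀ i → i ≤ s → Σ ℕ λ m → m + i ≡ n₀ × e.at (s ∸ i) ≤ E m
    down zero    _ = n₀ , +-identityʳ n₀ , ≤-reflexive (sym En₀≡)
    down (suc i) i<s with down i (<⇒≤ i<s)
    ... | m , eq , le = step m eq (<-≤-trans (subst (λ z → e.at (s ∸ suc i) < e.at z) s≡ (e.<-suc (s ∸ suc i) (∸-monoʳ-< (s≤s z≤n) i<s))) le)
      where
      s≡ : suc (s ∸ suc i) ≡ s ∸ i
      s≡ = sym (+-∸-assoc 1 i<s)
      step : ∀ m → m + i ≡ n₀ → e.at (s ∸ suc i) < E m → Σ ℕ λ m → m + suc i ≡ n₀ × e.at (s ∸ suc i) ≤ E m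
      step (suc m) eq lt = m , trans (+-suc m i) eq , E-prev m (e.member (s ∸ suc i)) lt
    up : ∀ i → i ≤ s → E (suc (n₀ + i)) ≤ f.at i
    up zero    _ = E-next (n₀ + 0) (f.member 0) (subst (_< f.at 0) (trans (sym En₀≡) (cong E (sym (+-identityʳ n₀)))) e<f)
    up (suc i) i<s = E-next (n₀ + suc i) (f.member (suc i)) (≤-<-trans (≤-trans (≤-reflexive (cong E (+-suc n₀ i))) (up i (<⇒≤ i<s))) (f.<-suc i i<s))
    found : (Σ ℕ λ m → m + j ≡ n₀ × e.at (s ∸ j) ≤ E m) → Σ ℕ λ n → e.at 0 ≤ E n ×
      (∀ i → i ≤ j → E (n + i) % q ≡ a) × (∀ i → j < i → i ≤ j + suc s → E (n + i) % q ≡ b)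
    found (m , eq , le) = m , low , first , second
      where
      low : e.at 0 ≤ E m
      low = ≤-trans (e.mono z≤n (m∸n≤m s j)) le
      first : ∀ i → i ≤ j → E (m + i) % q ≡ a
      first i i≤j = left (E-member (m + i)) (≤-trans low (E-mono (m≤m+n m i)))
        (≤-trans (E-mono (≤-trans (+-monoʳ-≤ m i≤j) (≤-reflexive eq))) (≤-reflexive En₀≡))
      second : ∀ i → j < i → i ≤ j + suc s → E (m + i) % q ≡ b
      second i j<i i≤ = subst (λ z → E z % q ≡ b) index (right (E-member (suc (n₀ + i′)))
          (≤-<-trans (≤-reflexive (sym En₀≡)) (<-≤-trans (E-< n₀) (E-mono (s≤s (m≤m+n n₀ i′)))))
          (≤-trans (up i′ i′≤s) (f.mono i′≤s ≤-refl)))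
        where
        i′ = i ∸ suc j
        i≡ : suc j + i′ ≡ i
        i≡ = m+[n∸m]≡n j<i
        i′≤s : i′ ≤ s
        i′≤s = +-cancelˡ-≤ (suc j) i′ s (≤-trans (≤-reflexive i≡) (≤-trans i≤ (≤-reflexive (+-suc j s))))
        index : suc (n₀ + i′) ≡ m + i
        index = trans (cong (λ z → suc (z + i′)) (sym eq)) (trans (cong suc (+-assoc m j i′)) (trans (sym (+-suc m (j + i′))) (cong (m +_) i≡)))

open import Algebra.Bundles using (CommutativeMonoid)
open import Data.Bool using (true; false; if_then_else_)
open import Data.Empty using (⊥; ⊥-elim)
open import Data.Fin using (Fin; toℕ; fromℕ<)
open import Data.Fin.Permutation using (permutation)
open import Data.Fin.Properties using (toℕ<n; toℕ-fromℕ<; toℕ-injective)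
open import Data.Integer using (ℤ; +_; -[1+_]; -_; _+_; _-_; _*_; ∣_∣; 0ℤ; 1ℤ; -1ℤ)
import Data.Integer.Divisibility.Signed as ℤ∣
import Data.Integer.Properties as ℤ
open import Data.Integer.Tactic.RingSolver using (solve-∀)
open import Data.List using ([]; _∷_)
open import Data.List.Relation.Unary.All using ([]; _∷_)
open import Data.Nat as ℕ using (ℕ; zero; suc; NonZero; z≤n; s≤s; pred; _!)
open import Data.Nat.Coprimality as Coprimality using (Coprime; coprime-Bézout; coprime-divisor; prime⇒coprime; coprime?; gcd≡1⇒coprime)
open import Data.Nat.DivMod using (_%_; _/_; m≡m%n+[m/n]*n; m%n<n; m%n%n≡m%n; m*n/n≡m; /-monoˡ-≤; m/n*n≤m; m<n*o⇒m/o<n; /-monoʳ-≤; %-distribˡ-*; [m+kn]%n≡m%n)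
import Data.Nat.Divisibility as ℕ
open import Data.Nat.GCD using (module Bézout; gcd; gcd[m,n]∣m; gcd[m,n]∣n)
open import Data.Nat.Induction using (<-rec)
open import Data.Nat.ListAction using (product)
open import Data.Nat.Primality using (Prime; euclidsLemma; prime⇒irreducible; ¬prime[1]; prime⇒nonZero; prime⇒nonTrivial; prime[2]; prime?)
open import Data.Nat.Primality.Factorisation using (factorise)
import Data.Nat.Properties as ℕ
import Data.Nat.Tactic.RingSolver as ℕR
open import Data.Product using (Σ; _×_; _,_; proj₁; proj₂)
open import Data.Sum using (_⊎_; inj₁; inj₂; reduce; [_,_]′)
import Data.Sum as Sum
open import Data.Unit using (⊤; tt)
open import Defs using (InE)
open import Level using (0ℓ)
open import Relation.Binary using (tri<; tri≈; tri>)
open import Relation.Binary.Bundles using (Setoid)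
open import Relation.Binary.PropositionalEquality using (_≡_; refl; sym; trans; cong; subst; cong₂; _≢_; module ≡-Reasoning)
import Relation.Binary.Reasoning.Setoid as SetoidReasoning
open import Relation.Nullary using (¬_; Dec; contradiction; yes; no; does)
open import Relation.Nullary.Decidable using (map′; dec-true; dec-false)

-- Congruences between integers, units and Chinese remaindering.

module Congruences where

  open import Data.Integer using (_^_)

  infix 4 _≋_[_]

  -- Keeping the quotient as data turns the compatibility laws into polynomial identities for the
  -- ring solver.
  record _≋_[_] (a b : ℤ) (n : ℕ) : Set where
    constructor quot
    field
      q  : ℤ
      eq : a ≡ b + q * + n

  module _ {n : ℕ} where

    ≋-reflexive : ∀ {a b} → a ≡ b → a ≋ b [ n ]
    ≋-reflexive {a} refl = quot 0ℤ (l a (+ n))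
      where
      l : ∀ a m → a ≡ a + 0ℤ * m
      l = solve-∀

    ≋-refl : ∀ {a} → a ≋ a [ n ]
    ≋-refl = ≋-reflexive refl

    ≋-sym : ∀ {a b} → a ≋ b [ n ] → b ≋ a [ n ]
    ≋-sym {b = b} (quot q refl) = quot (- q) (l b q (+ n))
      where
      l : ∀ b q m → b ≡ b + q * m + (- q) * m
      l = solve-∀

    ≋-trans : ∀ {a b c} → a ≋ b [ n ] → b ≋ c [ n ] → a ≋ c [ n ]
    ≋-trans {c = c} (quot q refl) (quot r refl) = quot (r + q) (l c q r (+ n))
      where
      l : ∀ c q r m → c + r * m + q * m ≡ c + (r + q) * m
      l = solve-∀

    ≋-+ : ∀ {a b c d} → a ≋ b [ n ] → c ≋ d [ n ] → a + c ≋ b + d [ n ]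
    ≋-+ {b = b} {d = d} (quot q refl) (quot r refl) = quot (q + r) (l b d q r (+ n))
      where
      l : ∀ b d q r m → (b + q * m) + (d + r * m) ≡ b + d + (q + r) * m
      l = solve-∀

    ≋-* : ∀ {a b c d} → a ≋ b [ n ] → c ≋ d [ n ] → a * c ≋ b * d [ n ]
    ≋-* {b = b} {d = d} (quot q refl) (quot r refl) = quot (q * d + b * r + q * r * + n) (l b d q r (+ n))
      where
      l : ∀ b d q r m → (b + q * m) * (d + r * m) ≡ b * d + (q * d + b * r + q * r * m) * m
      l = solve-∀

    ≋-neg : ∀ {a b} → a ≋ b [ n ] → - a ≋ - b [ n ]
    ≋-neg {b = b} (quot q refl) = quot (- q) (l b q (+ n))
      where
      l : ∀ b q m → - (b + q * m) ≡ - b + (- q) * m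
      l = solve-∀

    ≋-- : ∀ {a b c d} → a ≋ b [ n ] → c ≋ d [ n ] → a - c ≋ b - d [ n ]
    ≋-- p q = ≋-+ p (≋-neg q)

    ≋-*ˡ : ∀ {a b} c → a ≋ b [ n ] → c * a ≋ c * b [ n ]
    ≋-*ˡ c p = ≋-* (≋-refl {c}) p

    ≋-*ʳ : ∀ {a b} c → a ≋ b [ n ] → a * c ≋ b * c [ n ]
    ≋-*ʳ c p = ≋-* p (≋-refl {c})

    ≋-+ˡ : ∀ {a b} c → a ≋ b [ n ] → c + a ≋ c + b [ n ]
    ≋-+ˡ c p = ≋-+ (≋-refl {c}) p

    ≋-+ʳ : ∀ {a b} c → a ≋ b [ n ] → a + c ≋ b + c [ n ]
    ≋-+ʳ c p = ≋-+ p (≋-refl {c})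

    ≋-sub⁻ : ∀ {a b} → a - b ≋ 0ℤ [ n ] → a ≋ b [ n ]
    ≋-sub⁻ {a} {b} (quot q eq) = quot q (trans (l a b) (trans (cong (λ z → b + z) eq) (m b (q * + n))))
      where
      l : ∀ a b → a ≡ b + (a - b)
      l = solve-∀
      m : ∀ b x → b + (0ℤ + x) ≡ b + x
      m = solve-∀

    ≋-sub : ∀ {a b} → a ≋ b [ n ] → a - b ≋ 0ℤ [ n ]
    ≋-sub {b = b} p = ≋-trans (≋-- p (≋-refl {b})) (≋-reflexive (ℤ.+-inverseʳ b))

    modulus≋0 : + n ≋ 0ℤ [ n ]
    modulus≋0 = quot 1ℤ (l (+ n))
      where
      l : ∀ m → m ≡ 0ℤ + 1ℤ * m
      l = solve-∀

  ≋-setoid : ℕ → Setoid _ _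
  ≋-setoid n = record
    { Carrier = ℤ ; _≈_ = λ a b → a ≋ b [ n ]
    ; isEquivalence = record { refl = ≋-refl ; sym = ≋-sym ; trans = ≋-trans } }

  module ≋-Reasoning (n : ℕ) = SetoidReasoning (≋-setoid n)

  ∣⇒≋0 : ∀ {n m} → n ℕ.∣ m → + m ≋ 0ℤ [ n ]
  ∣⇒≋0 {n} (ℕ.divides q refl) = quot (+ q) (trans (ℤ.pos-* q n) (sym (ℤ.+-identityˡ _)))

  ∣∣⇒≋0 : ∀ {n} a → n ℕ.∣ ∣ a ∣ → a ≋ 0ℤ [ n ]
  ∣∣⇒≋0 (+ m)      d = ∣⇒≋0 d
  ∣∣⇒≋0 -[1+ m ] d = ≋-neg (∣⇒≋0 d)

  ≋0⇒∣ : ∀ {n a} → a ≋ 0ℤ [ n ] → n ℕ.∣ ∣ a ∣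
  ≋0⇒∣ {n} (quot q eq) = ℤ∣.∣⇒∣ᵤ {+ n} (ℤ∣.divides q (trans eq (ℤ.+-identityˡ _)))

  ≋0? : ∀ n a → Dec (a ≋ 0ℤ [ n ])
  ≋0? n a = map′ (∣∣⇒≋0 a) ≋0⇒∣ (n ℕ.∣? ∣ a ∣)

  ≋-dvd : ∀ {m n a b} → m ℕ.∣ n → a ≋ b [ n ] → a ≋ b [ m ]
  ≋-dvd {m} {b = b} (ℕ.divides k refl) (quot q refl) = quot (q * + k)
    (cong (λ z → b + z) (trans (cong (q *_) (ℤ.pos-* k m)) (sym (ℤ.*-assoc q (+ k) (+ m)))))

  %≡⇒≋ : ∀ {n} .{{_ : NonZero n}} a b → a % n ≡ b % n → + a ≋ + b [ n ]
  %≡⇒≋ {n} a b e = ≋-trans (l a) (≋-trans (≋-reflexive (cong +_ e)) (≋-sym (l b)))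
    where
    l : ∀ a → + a ≋ + (a % n) [ n ]
    l a = quot (+ (a / n)) (trans (cong +_ (m≡m%n+[m/n]*n a n))
      (trans (ℤ.pos-+ (a % n) _) (cong (λ z → + (a % n) + z) (ℤ.pos-* (a / n) n))))

  ≋-small : ∀ {n r s} → r ℕ.< n → s ℕ.< n → + r ≋ + s [ n ] → r ≡ s
  ≋-small {n} {r} {s} r<n s<n p = ℤ.+-injective (trans (l (+ r) (+ s)) (trans (cong (λ z → + s + z) z) (ℤ.+-identityʳ _)))
    where
    l : ∀ a b → a ≡ b + (a - b)
    l = solve-∀
    bound : ∣ + r - + s ∣ ℕ.< n
    bound = ℕ.≤-<-trans (ℕ.≤-trans (ℕ.≤-reflexive (cong ∣_∣ (ℤ.m-n≡m⊖n r s))) (ℤ.∣m⊝n∣≤m⊔n r s)) (ℕ.⊔-lub r<n s<n)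
    z : + r - + s ≡ 0ℤ
    z with ∣ + r - + s ∣ in eq | ≋0⇒∣ (≋-sub p)
    ... | zero  | _ = ℤ.∣i∣≡0⇒i≡0 eq
    ... | suc t | d = contradiction (ℕ.≤-trans (ℕ.∣⇒≤ d) (ℕ.≤-reflexive (sym eq))) (ℕ.<⇒≱ bound)

  ≋⇒%≡ : ∀ {n} .{{_ : NonZero n}} a b → + a ≋ + b [ n ] → a % n ≡ b % n
  ≋⇒%≡ {n} a b p = ≋-small (m%n<n a n) (m%n<n b n) (≋-trans (≋-sym (l a)) (≋-trans p (l b)))
    where
    l : ∀ a → + a ≋ + (a % n) [ n ]
    l a = %≡⇒≋ a (a % n) (sym (Data.Nat.DivMod.m%n%n≡m%n a n))

  residue : ∀ n .{{_ : NonZero n}} a → Σ ℕ λ r → r ℕ.< n × + r ≋ a [ n ]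
  residue n (+ a) = a % n , m%n<n a n , %≡⇒≋ (a % n) a (Data.Nat.DivMod.m%n%n≡m%n a n)
  residue n@(suc m) -[1+ a ] = r % n , m%n<n r n , ≋-trans (%≡⇒≋ (r % n) r (Data.Nat.DivMod.m%n%n≡m%n r n)) z
    where
    r = suc a ℕ.* m
    l : ∀ a m → a * m ≡ - a + a * (1ℤ + m)
    l = solve-∀
    z : + r ≋ -[1+ a ] [ n ]
    z = quot (+ suc a) (trans (ℤ.pos-* (suc a) m) (l (+ suc a) (+ m)))

  -- Coprimality as invertibility modulo n: it covers negative a and makes cancellation a
  -- multiplication.
  record Coprimeᶻ (a : ℤ) (n : ℕ) : Set where
    constructor _,_
    field
      inverse   : ℤ
      inverse-≋ : a * inverse ≋ 1ℤ [ n ]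

  coprime⇒inverse : ∀ {a n} → Coprime a n → Coprimeᶻ (+ a) n
  coprime⇒inverse {a} {n} c with coprime-Bézout c
  ... | Bézout.+- x y e = + x , quot (+ y) (sym (trans (cong (λ z → 1ℤ + z) (sym (ℤ.pos-* y n)))
          (trans (cong +_ e) (trans (cong +_ (ℕ.*-comm x a)) (ℤ.pos-* a x)))))
  ... | Bézout.-+ x y e = - (+ x) , quot (- (+ y)) (l (+ a) (+ x) (+ y) (+ n)
          (trans (cong (λ z → 1ℤ + z) (sym (ℤ.pos-* x a))) (trans (cong +_ e) (ℤ.pos-* y n))))
    where
    l : ∀ a x y n → 1ℤ + x * a ≡ y * n → a * - x ≡ 1ℤ + - y * n
    l a x y n e = trans (k a x) (trans (cong (λ z → 1ℤ - z) e) (k′ y n))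
      where
      k : ∀ a x → a * - x ≡ 1ℤ - (1ℤ + x * a)
      k = solve-∀
      k′ : ∀ y n → 1ℤ - y * n ≡ 1ℤ + - y * n
      k′ = solve-∀

  inverse⇒coprime : ∀ {a n} → Coprimeᶻ (+ a) n → Coprime a n
  inverse⇒coprime {a} {n} (i , p) {d} (d∣a , d∣n) = ℕ.∣1⇒≡1 (≋0⇒∣ (begin
    1ℤ       ≈⟨ ≋-dvd d∣n p ⟨
    + a * i  ≈⟨ ≋-*ʳ i (∣⇒≋0 d∣a) ⟩
    0ℤ * i   ≡⟨ ℤ.*-zeroˡ i ⟩
    0ℤ ∎))
    where open ≋-Reasoning d

  cancel : ∀ {c a b n} → Coprimeᶻ c n → c * a ≋ c * b [ n ] → a ≋ b [ n ]
  cancel {c} {a} {b} {n} (i , p) e = ≋-trans (≋-sym (l a)) (≋-trans (≋-*ˡ i e) (l b))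
    where
    k : ∀ i c a → i * (c * a) ≡ c * i * a
    k = solve-∀
    l : ∀ a → i * (c * a) ≋ a [ n ]
    l a = ≋-trans (≋-reflexive (k i c a)) (≋-trans (≋-*ʳ a p) (≋-reflexive (ℤ.*-identityˡ a)))

  ≋-coprime : ∀ {m n a b} → Coprime m n → a ≋ b [ m ] → a ≋ b [ n ] → a ≋ b [ m ℕ.* n ]
  ≋-coprime {m} {n} {a} {b} c p q = ≋-sub⁻ (∣∣⇒≋0 (a - b) (l (≋0⇒∣ (≋-sub p)) (≋0⇒∣ (≋-sub q))))
    where
    l : ∀ {x} → m ℕ.∣ x → n ℕ.∣ x → m ℕ.* n ℕ.∣ x
    l (ℕ.divides k refl) n∣ with coprime-divisor {n} {m} {k} (Coprimality.sym c) (subst (n ℕ.∣_) (ℕ.*-comm k m) n∣)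
    ... | ℕ.divides j refl = ℕ.divides j (trans (ℕ.*-assoc j n m) (cong (j ℕ.*_) (ℕ.*-comm n m)))

  crt : ∀ {m n} → Coprime m n → ∀ a b → Σ ℤ λ x → x ≋ a [ m ] × x ≋ b [ n ]
  crt {m} {n} c a b with coprime⇒inverse c
  ... | i , p = a + + m * i * (b - a)
    , quot (i * (b - a)) (k₁ a b i (+ m))
    , ≋-trans (≋-+ˡ a (≋-*ʳ (b - a) p)) (≋-reflexive (k₂ a b))
    where
    k₁ : ∀ a b i m → a + m * i * (b - a) ≡ a + i * (b - a) * m
    k₁ = solve-∀
    k₂ : ∀ a b → a + 1ℤ * (b - a) ≡ b
    k₂ = solve-∀

  prime-≋0 : ∀ {p} → Prime p → ∀ a b → a * b ≋ 0ℤ [ p ] → a ≋ 0ℤ [ p ] ⊎ b ≋ 0ℤ [ p ]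
  prime-≋0 pr a b e = Sum.map (∣∣⇒≋0 a) (∣∣⇒≋0 b)
    (euclidsLemma ∣ a ∣ ∣ b ∣ pr (subst (_ ℕ.∣_) (ℤ.∣i*j∣≡∣i∣*∣j∣ a b) (≋0⇒∣ e)))

  prime∤⇒coprime : ∀ {p m} → Prime p → ¬ p ℕ.∣ m → Coprime p m
  prime∤⇒coprime pr p∤m (d∣p , d∣m) with prime⇒irreducible pr d∣p
  ... | inj₁ d≡1 = d≡1
  ... | inj₂ refl = contradiction d∣m p∤m

  coprime⇒prime∤ : ∀ {p m n} → Prime p → Coprime m n → p ℕ.∣ m → ¬ p ℕ.∣ n
  coprime⇒prime∤ pr c p∣m p∣n with c (p∣m , p∣n)
  ... | refl = ¬prime[1] pr

  coprime-*ʳ : ∀ {m n o} → Coprime m n → Coprime m o → Coprime m (n ℕ.* o)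
  coprime-*ʳ {m} {n} c c′ {d} (d∣m , d∣no) = c′ (d∣m , coprime-divisor (λ { (e∣d , e∣n) → c (ℕ.∣-trans e∣d d∣m , e∣n) }) d∣no)

  coprime-*ˡ : ∀ {m n o} → Coprime m o → Coprime n o → Coprime (m ℕ.* n) o
  coprime-*ˡ c c′ = Coprimality.sym (coprime-*ʳ (Coprimality.sym c) (Coprimality.sym c′))

  coprime-^ʳ : ∀ {m n} k → Coprime m n → Coprime m (n ℕ.^ k)
  coprime-^ʳ zero    c = Coprimality.sym (Coprimality.1-coprimeTo _)
  coprime-^ʳ (suc k) c = coprime-*ʳ c (coprime-^ʳ k c)

  coprime-^ˡ : ∀ {m n} k → Coprime m n → Coprime (m ℕ.^ k) n
  coprime-^ˡ k c = Coprimality.sym (coprime-^ʳ k (Coprimality.sym c))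

  coprime-dvdˡ : ∀ {d m n} → d ℕ.∣ m → Coprime m n → Coprime d n
  coprime-dvdˡ d∣m c (e∣d , e∣n) = c (ℕ.∣-trans e∣d d∣m , e∣n)

  coprime-dvdʳ : ∀ {d m n} → d ℕ.∣ n → Coprime m n → Coprime m d
  coprime-dvdʳ d∣n c (e∣m , e∣d) = c (e∣m , ℕ.∣-trans e∣d d∣n)

-- Binary forms of determinant 1, and division by primes inside 𝐄.

module SumsOfTwoSquares where

  open Congruences

  square≡∣∣² : ∀ a → a * a ≡ + (∣ a ∣ ℕ.* ∣ a ∣)
  square≡∣∣² (+ a)    = sym (ℤ.pos-* a a)
  square≡∣∣² -[1+ a ] = refl

  InE-fromℤ : ∀ {v} m n → + v ≡ m * m + n * n → InE v
  InE-fromℤ m n e = ∣ m ∣ , ∣ n ∣ , ℤ.+-injective (sym (trans e (cong₂ _+_ (square≡∣∣² m) (square≡∣∣² n))))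

  -- Gram matrix of the vectors (α, γ) and (β, δ): the form a x² + 2b x y + c y² equals (α x + β y)²
  -- + (γ x + δ y)².
  record Gram (a b c : ℕ) : Set where
    constructor gram
    field
      α β γ δ : ℕ
      a≡ : a ≡ α ℕ.* α ℕ.+ γ ℕ.* γ
      b≡ : b ≡ α ℕ.* β ℕ.+ γ ℕ.* δ
      c≡ : c ≡ β ℕ.* β ℕ.+ δ ℕ.* δ

  Gram-swap : ∀ {a b c} → Gram a b c → Gram c b a
  Gram-swap (gram α β γ δ p q r) = gram β α δ γ r (trans q (cong₂ ℕ._+_ (ℕ.*-comm α β) (ℕ.*-comm γ δ))) p

  split-≤ : ∀ {m n} → m ℕ.≤ n → Σ ℕ λ d → n ≡ m ℕ.+ d
  split-≤ {m} {n} le = n ℕ.∸ m , sym (ℕ.m+[n∸m]≡n le)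

  -- Reduction of the positive form (a, b, c) of determinant 1 by (x, y) ↦ (x - y, y).
  unimodular⇒Gram : ∀ b {a c} → a ℕ.* c ≡ suc (b ℕ.* b) → Gram a b c
  unimodular⇒Gram = <-rec (λ b → ∀ {a c} → a ℕ.* c ≡ suc (b ℕ.* b) → Gram a b c) go
    where
    go : ∀ b → (∀ {b′} → b′ ℕ.< b → ∀ {a c} → a ℕ.* c ≡ suc (b′ ℕ.* b′) → Gram a b′ c) →
         ∀ {a c} → a ℕ.* c ≡ suc (b ℕ.* b) → Gram a b c
    go zero rec {a} {c} e with ℕ.m*n≡1⇒m≡1 a c e | ℕ.m*n≡1⇒n≡1 a c e
    ... | refl | refl = gram 1 0 0 1 refl refl refl
    go b@(suc b₁) rec {a} {c} e = [ (λ a≤c → step a≤c e) , (λ c≤a → Gram-swap (step c≤a (trans (ℕ.*-comm c a) e))) ]′ (ℕ.≤-total a c)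
      where
      step : ∀ {a c} → a ℕ.≤ c → a ℕ.* c ≡ suc (b ℕ.* b) → Gram a b c
      step {zero} _ ()
      step {a@(suc a₁)} {c} a≤c e with split-≤ a≤b
        where
        l : ∀ b → 1 ℕ.+ (b ℕ.* b ℕ.+ (b ℕ.+ b)) ≡ suc b ℕ.* suc b
        l = ℕR.solve-∀
        a≤b : a ℕ.≤ b
        -- Otherwise a and c both exceed b, while (b + 1)² > b² + 1 because b is positive.
        a≤b = ℕ.≮⇒≥ λ b<a → ℕ.<⇒≱ (ℕ.m<m+n (suc (b ℕ.* b)) {b ℕ.+ b} (ℕ.s≤s ℕ.z≤n))
          (ℕ.≤-trans (ℕ.≤-reflexive (l b)) (ℕ.≤-trans (ℕ.*-mono-≤ b<a (ℕ.≤-trans b<a a≤c)) (ℕ.≤-reflexive e)))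
      ... | d , b≡ with split-≤ (ℕ.<⇒≤ (ℕ.*-cancelˡ-< a (a ℕ.+ (d ℕ.+ d)) c lt))
        where
        l : ∀ a d → suc ((a ℕ.+ d) ℕ.* (a ℕ.+ d)) ≡ a ℕ.* (a ℕ.+ (d ℕ.+ d)) ℕ.+ suc (d ℕ.* d)
        l = ℕR.solve-∀
        e′ : a ℕ.* c ≡ a ℕ.* (a ℕ.+ (d ℕ.+ d)) ℕ.+ suc (d ℕ.* d)
        e′ = trans e (trans (cong (λ b → suc (b ℕ.* b)) b≡) (l a d))
        lt : a ℕ.* (a ℕ.+ (d ℕ.+ d)) ℕ.< a ℕ.* c
        lt = ℕ.<-≤-trans (ℕ.m<m+n _ (ℕ.s≤s ℕ.z≤n)) (ℕ.≤-reflexive (sym e′))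
      ... | c′ , refl with rec {d} (ℕ.<-≤-trans (ℕ.m<n+m d (ℕ.s≤s ℕ.z≤n)) (ℕ.≤-reflexive (sym b≡))) {a} {c′} eq
        where
        l : ∀ a d → suc ((a ℕ.+ d) ℕ.* (a ℕ.+ d)) ≡ a ℕ.* (a ℕ.+ (d ℕ.+ d)) ℕ.+ suc (d ℕ.* d)
        l = ℕR.solve-∀
        eq : a ℕ.* c′ ≡ suc (d ℕ.* d)
        eq = ℕ.+-cancelˡ-≡ (a ℕ.* (a ℕ.+ (d ℕ.+ d))) _ _ (trans (sym (ℕ.*-distribˡ-+ a _ c′)) (trans e (trans (cong (λ b → suc (b ℕ.* b)) b≡) (l a d))))
      ... | gram α β γ δ p q r = gram α (α ℕ.+ β) γ (γ ℕ.+ δ) p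
        (trans b≡ (trans (cong₂ ℕ._+_ p q) (k₁ α β γ δ)))
        (trans (cong₂ (λ x y → x ℕ.+ (y ℕ.+ y) ℕ.+ c′) p q) (trans (cong (λ z → _ ℕ.+ z) r) (k₂ α β γ δ)))
        where
        k₁ : ∀ α β γ δ → (α ℕ.* α ℕ.+ γ ℕ.* γ) ℕ.+ (α ℕ.* β ℕ.+ γ ℕ.* δ) ≡ α ℕ.* (α ℕ.+ β) ℕ.+ γ ℕ.* (γ ℕ.+ δ)
        k₁ = ℕR.solve-∀
        k₂ : ∀ α β γ δ → (α ℕ.* α ℕ.+ γ ℕ.* γ) ℕ.+ ((α ℕ.* β ℕ.+ γ ℕ.* δ) ℕ.+ (α ℕ.* β ℕ.+ γ ℕ.* δ)) ℕ.+ (β ℕ.* β ℕ.+ δ ℕ.* δ)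
             ≡ (α ℕ.+ β) ℕ.* (α ℕ.+ β) ℕ.+ (γ ℕ.+ δ) ℕ.* (γ ℕ.+ δ)
        k₂ = ℕR.solve-∀

  -- If r represents ι and n c = r² + 1, the form (n, r, c) has determinant 1, so its value n at (1,
  -- 0) is a sum of two squares.
  -1-square⇒InE : ∀ {n} .{{_ : NonZero n}} ι → ι * ι + 1ℤ ≋ 0ℤ [ n ] → InE n
  -1-square⇒InE {n} ι p with residue n ι
  ... | r , _ , r≋ι with ≋0⇒∣ {n} {+ (r ℕ.* r ℕ.+ 1)} (≋-trans (≋-reflexive (trans (ℤ.pos-+ (r ℕ.* r) 1) (cong (λ z → z + 1ℤ) (ℤ.pos-* r r)))) (≋-trans (≋-+ʳ 1ℤ (≋-* r≋ι r≋ι)) p))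
  ... | ℕ.divides c e with unimodular⇒Gram r {n} {c} (trans (ℕ.*-comm n c) (trans (sym e) (ℕ.+-comm (r ℕ.* r) 1)))
  ... | gram α _ γ _ n≡ _ _ = α , γ , sym n≡

  prime-dvd-square : ∀ {p} → Prime p → ∀ {a} → a * a ≋ 0ℤ [ p ] → a ≋ 0ℤ [ p ]
  prime-dvd-square pr {a} e = reduce (prime-≋0 pr a a e)

  -- With p = c² + d², p divides (cK - dX)(cK + dX). Whichever factor it divides is one coordinate
  -- of the product of X + iK with c ± di up to units; that product has norm p² v, so the other
  -- coordinate is divisible by p as well and both can be divided by p.
  quotient-InE : ∀ {p} → Prime p → InE p → ∀ {v} X K → X * X + K * K ≡ + p * + v → InE v
  quotient-InE {p} pr (c₀ , d₀ , refl) {v} X K e = main (prime-≋0 pr (c * K - d * X) (c * K + d * X) split)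
    where
    instance _ = prime⇒nonZero pr
    c = + c₀
    d = + d₀
    p≡ : + p ≡ c * c + d * d
    p≡ = trans (ℤ.pos-+ (c₀ ℕ.* c₀) _) (cong₂ _+_ (ℤ.pos-* c₀ c₀) (ℤ.pos-* d₀ d₀))
    l : ∀ c d X K → (c * K - d * X) * (c * K + d * X) ≡ c * c * (X * X + K * K) - X * X * (c * c + d * d)
    l = solve-∀
    z : ∀ a b → a * 0ℤ - b * 0ℤ ≡ 0ℤ
    z = solve-∀
    split : (c * K - d * X) * (c * K + d * X) ≋ 0ℤ [ p ]
    split = ≋-trans (≋-reflexive (l c d X K)) (≋-trans
      (≋-- (≋-*ˡ (c * c) (≋-trans (≋-reflexive e) (≋-trans (≋-*ʳ (+ v) modulus≋0) (≋-reflexive (ℤ.*-zeroˡ (+ v))))))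
           (≋-*ˡ (X * X) (≋-trans (≋-reflexive (sym p≡)) modulus≋0)))
      (≋-reflexive (z (c * c) (X * X))))
    finish : ∀ m n → (0ℤ + m * + p) * (0ℤ + m * + p) + (0ℤ + n * + p) * (0ℤ + n * + p) ≡ + p * (+ p * + v) → InE v
    finish m n e = InE-fromℤ m n (sym (ℤ.*-cancelˡ-≡ (+ p) _ _ (ℤ.*-cancelˡ-≡ (+ p) _ _ (trans (k m n (+ p)) e))))
      where
      k : ∀ m n p → p * (p * (m * m + n * n)) ≡ (0ℤ + m * p) * (0ℤ + m * p) + (0ℤ + n * p) * (0ℤ + n * p)
      k = solve-∀
    from : ∀ a b → a * a + b * b ≡ + p * (+ p * + v) → a ≋ 0ℤ [ p ] → InE v
    from a b e a≋0 = both e a≋0 (prime-dvd-square pr {b} b²≋0)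
      where
      both : ∀ {a b} → a * a + b * b ≡ + p * (+ p * + v) → a ≋ 0ℤ [ p ] → b ≋ 0ℤ [ p ] → InE v
      both e (quot m refl) (quot n refl) = finish m n e
      l′ : ∀ a b → b * b ≡ a * a + b * b - a * a
      l′ = solve-∀
      b²≋0 : b * b ≋ 0ℤ [ p ]
      b²≋0 = ≋-trans (≋-reflexive (l′ a b)) (≋-trans (≋-- (≋-trans (≋-reflexive e) (≋-*ʳ (+ p * + v) modulus≋0)) (≋-* a≋0 a≋0))
        (≋-reflexive (trans (ℤ.+-identityʳ _) (ℤ.*-zeroˡ (+ p * + v)))))
    l₁ : ∀ c d X K → (c * K - d * X) * (c * K - d * X) + (c * X + d * K) * (c * X + d * K) ≡ (c * c + d * d) * (X * X + K * K)
    l₁ = solve-∀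
    l₂ : ∀ c d X K → (c * K + d * X) * (c * K + d * X) + (c * X - d * K) * (c * X - d * K) ≡ (c * c + d * d) * (X * X + K * K)
    l₂ = solve-∀
    e′ : (c * c + d * d) * (X * X + K * K) ≡ + p * (+ p * + v)
    e′ = cong₂ _*_ (sym p≡) e
    main : c * K - d * X ≋ 0ℤ [ p ] ⊎ c * K + d * X ≋ 0ℤ [ p ] → InE v
    main (inj₁ h) = from (c * K - d * X) (c * X + d * K) (trans (l₁ c d X K) e′) h
    main (inj₂ h) = from (c * K + d * X) (c * X - d * K) (trans (l₂ c d X K) e′) h

-- Finite products and sums in a commutative monoid.

module BigOperators where

  record Bijective< (n : ℕ) (σ τ : ℕ → ℕ) : Set where
    field
      σ<  : ∀ {i} → i ℕ.< n → σ i ℕ.< n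
      τ<  : ∀ {i} → i ℕ.< n → τ i ℕ.< n
      τ∘σ : ∀ {i} → i ℕ.< n → τ (σ i) ≡ i
      σ∘τ : ∀ {i} → i ℕ.< n → σ (τ i) ≡ i

  module BigOp (M : CommutativeMonoid 0ℓ 0ℓ) where
    open CommutativeMonoid M using (Carrier; _≈_; _∙_; ε; reflexive; ∙-cong; ∙-congˡ; identityˡ; assoc; comm)
      renaming (refl to ≈-refl; sym to ≈-sym; trans to ≈-trans)
    open import Algebra.Properties.CommutativeMonoid.Sum M using (sum; sum-permute; sum-cong-≋)
    open import Algebra.Properties.CommutativeSemigroup (CommutativeMonoid.commutativeSemigroup M) using (interchange)

    big : ℕ → (ℕ → Carrier) → Carrier
    big zero    f = ε
    big (suc n) f = f 0 ∙ big n (λ i → f (suc i))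

    big-cong : ∀ n {f g} → (∀ i → i ℕ.< n → f i ≈ g i) → big n f ≈ big n g
    big-cong zero    h = ≈-refl
    big-cong (suc n) h = ∙-cong (h 0 (s≤s z≤n)) (big-cong n (λ i i<n → h (suc i) (s≤s i<n)))

    big-∙ : ∀ n f g → big n (λ i → f i ∙ g i) ≈ big n f ∙ big n g
    big-∙ zero    f g = ≈-sym (identityˡ ε)
    big-∙ (suc n) f g = ≈-trans (∙-congˡ (big-∙ n _ _)) (interchange _ _ _ _)

    big-ε : ∀ n {f} → (∀ i → i ℕ.< n → f i ≈ ε) → big n f ≈ ε
    big-ε zero    h = ≈-refl
    big-ε (suc n) h = ≈-trans (∙-cong (h 0 (s≤s z≤n)) (big-ε n (λ i i<n → h (suc i) (s≤s i<n)))) (identityˡ ε)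

    big-swap : ∀ m n (f : ℕ → ℕ → Carrier) → big m (λ i → big n (f i)) ≈ big n (λ j → big m (λ i → f i j))
    big-swap zero    n f = ≈-sym (big-ε n (λ _ _ → ≈-refl))
    big-swap (suc m) n f = ≈-trans (∙-congˡ (big-swap m n _)) (≈-sym (big-∙ n _ _))

    big-+ : ∀ m n f → big (m ℕ.+ n) f ≈ big m f ∙ big n (λ i → f (m ℕ.+ i))
    big-+ zero    n f = ≈-sym (identityˡ _)
    big-+ (suc m) n f = ≈-trans (∙-congˡ (big-+ m n _)) (≈-sym (assoc _ _ _))

    big-snoc : ∀ n f → big (suc n) f ≈ big n f ∙ f n
    big-snoc zero    f = comm _ _
    big-snoc (suc n) f = ≈-trans (∙-congˡ (big-snoc n _)) (≈-sym (assoc _ _ _))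

    private
      big-sum : ∀ n f → big n f ≈ sum {n} (λ i → f (toℕ i))
      big-sum zero    f = ≈-refl
      big-sum (suc n) f = ∙-congˡ (big-sum n _)

    big-permute : ∀ n f {σ τ} → Bijective< n σ τ → big n (λ i → f (σ i)) ≈ big n f
    big-permute n f {σ} {τ} b = ≈-sym (≈-trans (big-sum n f) (≈-trans (sum-permute (λ i → f (toℕ i)) π)
      (≈-trans (sum-cong-≋ λ i → reflexive (cong f (toℕ-fromℕ< (σ< (toℕ<n i))))) (≈-sym (big-sum n _)))))
      where
      open Bijective< b
      fwd bwd : Fin n → Fin n
      fwd i = fromℕ< (σ< (toℕ<n i))
      bwd i = fromℕ< (τ< (toℕ<n i))
      π = permutation fwd bwd
            (λ i → toℕ-injective (trans (toℕ-fromℕ< _) (trans (cong σ (toℕ-fromℕ< _)) (σ∘τ (toℕ<n i)))))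
            (λ i → toℕ-injective (trans (toℕ-fromℕ< _) (trans (cong τ (toℕ-fromℕ< _)) (τ∘σ (toℕ<n i)))))

-- The Jacobi symbol by Gauss's lemma, and quadratic reciprocity.

module JacobiSymbol where

  open Congruences
  open BigOperators
  open import Data.Bool using (T)
  open import Data.Integer using (_^_)

  open BigOp ℤ.*-1-commutativeMonoid using () renaming
    (big to Π; big-cong to Π-cong; big-∙ to Π-*; big-ε to Π-1; big-swap to Π-swap; big-permute to Π-permute)

  data Sign : ℤ → Set where
    pos : Sign 1ℤ
    neg : Sign -1ℤ

  Sign-* : ∀ {s t} → Sign s → Sign t → Sign (s * t)
  Sign-* pos pos = pos
  Sign-* pos neg = neg
  Sign-* neg pos = neg
  Sign-* neg neg = pos

  Sign-square : ∀ {s} → Sign s → s * s ≡ 1ℤ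
  Sign-square pos = refl
  Sign-square neg = refl

  Sign-*≡1 : ∀ {s t} → Sign s → Sign t → s * t ≡ 1ℤ → s ≡ t
  Sign-*≡1 pos pos _ = refl
  Sign-*≡1 neg neg _ = refl

  Sign-Π : ∀ n {f} → (∀ i → Sign (f i)) → Sign (Π n f)
  Sign-Π zero    h = pos
  Sign-Π (suc n) h = Sign-* (h 0) (Sign-Π n (λ i → h (suc i)))

  par : ℕ → ℤ
  par zero    = 1ℤ
  par (suc n) = -1ℤ * par n

  Sign-par : ∀ n → Sign (par n)
  Sign-par zero    = pos
  Sign-par (suc n) = Sign-* neg (Sign-par n)

  par-+ : ∀ m n → par (m ℕ.+ n) ≡ par m * par n
  par-+ zero    n = sym (ℤ.*-identityˡ _)
  par-+ (suc m) n = trans (cong (-1ℤ *_) (par-+ m n)) (sym (ℤ.*-assoc -1ℤ (par m) (par n)))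

  par-double : ∀ m → par (m ℕ.+ m) ≡ 1ℤ
  par-double m = trans (par-+ m m) (Sign-square (Sign-par m))

  par-odd* : ∀ h k → par (suc (h ℕ.+ h) ℕ.* k) ≡ par k
  par-odd* h k = trans (par-+ k _) (trans (cong (par k *_) (trans (cong par (ℕ.*-distribʳ-+ k h h)) (par-double (h ℕ.* k)))) (ℤ.*-identityʳ _))

  Π-par : ∀ n k → Π n (λ _ → par k) ≡ par (n ℕ.* k)
  Π-par zero    k = refl
  Π-par (suc n) k = trans (cong (par k *_) (Π-par n k)) (sym (par-+ k (n ℕ.* k)))

  suc-pred : ∀ {m} → 0 ℕ.< m → suc (pred m) ≡ m
  suc-pred {suc m} _ = refl

  module Gauss (h n : ℕ) .{{_ : NonZero n}} (n≡ : n ≡ suc (h ℕ.+ h)) where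

    h<n : h ℕ.< n
    h<n = subst (h ℕ.<_) (sym n≡) (s≤s (ℕ.m≤m+n h h))

    -- Least absolute residues: r is congruent to the sign times u, with u at most h.
    data Folded (r : ℕ) : ℤ → ℕ → Set where
      low  : r ℕ.≤ h → Folded r 1ℤ r
      high : ∀ {u} → r ℕ.+ u ≡ n → u ℕ.≤ h → Folded r -1ℤ u

    sgn : ℕ → ℤ
    sgn r = if r ℕ.≤ᵇ h then 1ℤ else -1ℤ

    mag : ℕ → ℕ
    mag r = if r ℕ.≤ᵇ h then r else n ℕ.∸ r

    fold : ∀ {r} → r ℕ.< n → Folded r (sgn r) (mag r)
    fold {r} r<n with r ℕ.≤ᵇ h in eq
    ... | true  = low (ℕ.≤ᵇ⇒≤ r h (subst T (sym eq) _))
    ... | false = high (ℕ.m+[n∸m]≡n (ℕ.<⇒≤ r<n)) (ℕ.≤-trans (ℕ.∸-monoʳ-≤ n h<r) (ℕ.≤-reflexive (trans (cong (ℕ._∸ suc h) n≡) (ℕ.m+n∸m≡n h h))))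
      where
      h<r : suc h ℕ.≤ r
      h<r = ℕ.≰⇒> λ r≤h → subst T eq (ℕ.≤⇒≤ᵇ r≤h)

    Sign-sgn : ∀ r → Sign (sgn r)
    Sign-sgn r with r ℕ.≤ᵇ h
    ... | true  = pos
    ... | false = neg

    folded-≋ : ∀ {r s u} → Folded r s u → + r ≋ s * + u [ n ]
    folded-≋ {r} (low _) = ≋-reflexive (sym (ℤ.*-identityˡ (+ r)))
    folded-≋ {r} {u = u} (high e _) = quot 1ℤ (trans (l (+ r) (+ u)) (cong (λ z → -1ℤ * + u + 1ℤ * z) (trans (sym (ℤ.pos-+ r u)) (cong +_ e))))
      where
      l : ∀ r u → r ≡ -1ℤ * u + 1ℤ * (r + u)
      l = solve-∀

    folded-pos : ∀ {r s u} → Folded r s u → 0 ℕ.< r → r ℕ.< n → 0 ℕ.< u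
    folded-pos (low _) 0<r _ = 0<r
    folded-pos {r} {u = zero} (high e _) _ r<n = contradiction (trans (sym (ℕ.+-identityʳ r)) e) (ℕ.<⇒≢ r<n)
    folded-pos {u = suc u} (high e _) _ _ = s≤s z≤n

    folded-≤ : ∀ {r s u} → Folded r s u → u ℕ.≤ h
    folded-≤ (low p) = p
    folded-≤ (high _ p) = p

    sign-unique : ∀ {s t u v} → Sign s → Sign t → 0 ℕ.< u → u ℕ.≤ h → v ℕ.≤ h → s * + u ≋ t * + v [ n ] → s ≡ t × u ≡ v
    sign-unique {u = u} {v} ps pt 0<u u≤h v≤h e = go ps pt e
      where
      same : + u ≋ + v [ n ] → u ≡ v
      same = ≋-small (ℕ.≤-<-trans u≤h h<n) (ℕ.≤-<-trans v≤h h<n)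
      opp : + u + + v ≋ 0ℤ [ n ] → ∀ {A : Set} → A
      opp p = contradiction (≋-small {n} {u ℕ.+ v} {0} (ℕ.<-≤-trans (s≤s (ℕ.+-mono-≤ u≤h v≤h)) (ℕ.≤-reflexive (sym n≡))) (ℕ.>-nonZero⁻¹ n) (≋-trans (≋-reflexive (ℤ.pos-+ u v)) p))
        (λ u+v≡0 → ℕ.<⇒≢ 0<u (sym (ℕ.m+n≡0⇒m≡0 u u+v≡0)))
      l₁ : ∀ u v → u + v ≡ 1ℤ * u - -1ℤ * v
      l₁ = solve-∀
      l₂ : ∀ u v → u + v ≡ - (-1ℤ * u - 1ℤ * v)
      l₂ = solve-∀
      go : ∀ {s t} → Sign s → Sign t → s * + u ≋ t * + v [ n ] → s ≡ t × u ≡ v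
      go pos pos e = refl , same (≋-trans (≋-reflexive (sym (ℤ.*-identityˡ _))) (≋-trans e (≋-reflexive (ℤ.*-identityˡ _))))
      go pos neg e = opp (≋-trans (≋-reflexive (l₁ (+ u) (+ v))) (≋-sub e))
      go neg pos e = opp (≋-trans (≋-reflexive (l₂ (+ u) (+ v))) (≋-neg (≋-sub e)))
      go neg neg e = refl , same (≋-trans (≋-reflexive (m (+ u))) (≋-trans (≋-neg e) (≋-reflexive (sym (m (+ v))))))
        where
        m : ∀ u → u ≡ - (-1ℤ * u)
        m = solve-∀

    s : ℕ → ℕ → ℤ
    s a j = sgn ((a ℕ.* j) % n)

    σ : ℕ → ℕ → ℕ
    σ a j = mag ((a ℕ.* j) % n)

    -- Gauss's lemma taken as the definition. For composite odd n it still gives the Jacobi symbol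
    -- (a/n) when a is coprime to n, so multiplicativity and reciprocity are reached without
    -- factoring n.
    J : ℕ → ℤ
    J a = Π h (λ i → s a (suc i))

    Sign-s : ∀ a j → Sign (s a j)
    Sign-s a j = Sign-sgn ((a ℕ.* j) % n)

    Sign-J : ∀ a → Sign (J a)
    Sign-J a = Sign-Π h (λ i → Sign-s a (suc i))

    sσ-≋ : ∀ a j → + a * + j ≋ s a j * + σ a j [ n ]
    sσ-≋ a j = ≋-trans (≋-reflexive (sym (ℤ.pos-* a j))) (≋-trans (%≡⇒≋ (a ℕ.* j) _ (sym (m%n%n≡m%n (a ℕ.* j) n))) (folded-≋ (fold (m%n<n (a ℕ.* j) n))))

    σ≤h : ∀ a j → σ a j ℕ.≤ h
    σ≤h a j = folded-≤ (fold (m%n<n (a ℕ.* j) n))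

    σ>0 : ∀ {a j} → Coprime n a → 0 ℕ.< j → j ℕ.≤ h → 0 ℕ.< σ a j
    σ>0 {a} {suc j} c _ j≤h = folded-pos (fold (m%n<n (a ℕ.* suc j) n)) 0<r (m%n<n (a ℕ.* suc j) n)
      where
      0<r : 0 ℕ.< (a ℕ.* suc j) % n
      0<r = ℕ.n≢0⇒n>0 λ r≡0 → ℕ.<⇒≱ (ℕ.≤-<-trans j≤h h<n)
        (ℕ.∣⇒≤ (coprime-divisor c (ℕ.m%n≡0⇒n∣m (a ℕ.* suc j) n r≡0)))

    sσ-unique : ∀ {a j t v} → Coprime n a → 0 ℕ.< j → j ℕ.≤ h → Sign t → v ℕ.≤ h → + a * + j ≋ t * + v [ n ] → s a j ≡ t × σ a j ≡ v
    sσ-unique {a} {j} c 0<j j≤h pt v≤h e = sign-unique (Sign-s a j) pt (σ>0 c 0<j j≤h) (σ≤h a j) v≤h (≋-trans (≋-sym (sσ-≋ a j)) e)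

    inverseℕ : ∀ {a} → Coprime n a → Σ ℕ λ b → Coprime n b × + a * + b ≋ 1ℤ [ n ]
    inverseℕ {a} c with coprime⇒inverse (Coprimality.sym c)
    ... | i , p with residue n i
    ... | b , _ , b≋i = b , Coprimality.sym (inverse⇒coprime (+ a , ≋-trans (≋-reflexive (ℤ.*-comm (+ b) (+ a))) q)) , q
      where
      q : + a * + b ≋ 1ℤ [ n ]
      q = ≋-trans (≋-*ˡ (+ a) b≋i) p

    σ-inverse : ∀ {a b} → Coprime n a → Coprime n b → + a * + b ≋ 1ℤ [ n ] → ∀ {j} → 0 ℕ.< j → j ℕ.≤ h → σ b (σ a j) ≡ j
    σ-inverse {a} {b} ca cb e {j} 0<j j≤h = proj₂ (sσ-unique cb (σ>0 ca 0<j j≤h) (σ≤h a j) (Sign-s a j) j≤h (begin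
      + b * + σ a j                        ≡⟨ ℤ.*-identityˡ _ ⟨
      1ℤ * (+ b * + σ a j)                 ≡⟨ cong (_* (+ b * + σ a j)) (Sign-square (Sign-s a j)) ⟨
      s a j * s a j * (+ b * + σ a j)      ≡⟨ l (s a j) (+ b) (+ σ a j) ⟩
      s a j * (+ b * (s a j * + σ a j))    ≈⟨ ≋-*ˡ (s a j) (≋-*ˡ (+ b) (sσ-≋ a j)) ⟨
      s a j * (+ b * (+ a * + j))          ≡⟨ l′ (s a j) (+ b) (+ a) (+ j) ⟩
      s a j * (+ a * + b * + j)            ≈⟨ ≋-*ˡ (s a j) (≋-*ʳ (+ j) e) ⟩
      s a j * (1ℤ * + j)                   ≡⟨ cong (s a j *_) (ℤ.*-identityˡ (+ j)) ⟩
      s a j * + j ∎))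
      where
      open ≋-Reasoning n
      l : ∀ t b u → t * t * (b * u) ≡ t * (b * (t * u))
      l = solve-∀
      l′ : ∀ t b a j → t * (b * (a * j)) ≡ t * (a * b * j)
      l′ = solve-∀

    σ-bijective : ∀ {a} → Coprime n a → Σ (ℕ → ℕ) λ τ → Bijective< h (λ i → pred (σ a (suc i))) τ
    σ-bijective {a} c with inverseℕ c
    ... | b , c′ , e = (λ i → pred (σ b (suc i))) , record
      { σ< = λ i<h → bound c i<h ; τ< = λ i<h → bound c′ i<h
      ; τ∘σ = λ i<h → inv c c′ e i<h ; σ∘τ = λ i<h → inv c′ c (≋-trans (≋-reflexive (ℤ.*-comm (+ b) (+ a))) e) i<h }
      where
      bound : ∀ {a} → Coprime n a → ∀ {i} → i ℕ.< h → pred (σ a (suc i)) ℕ.< h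
      bound {a} c {i} i<h = ℕ.≤-trans (ℕ.≤-reflexive (suc-pred (σ>0 c (s≤s z≤n) i<h))) (σ≤h a (suc i))
      inv : ∀ {a b} → Coprime n a → Coprime n b → + a * + b ≋ 1ℤ [ n ] → ∀ {i} → i ℕ.< h → pred (σ b (suc (pred (σ a (suc i))))) ≡ i
      inv {a} {b} ca cb e i<h = cong pred (trans (cong (σ b) (suc-pred (σ>0 ca (s≤s z≤n) i<h))) (σ-inverse ca cb e (s≤s z≤n) i<h))

    Π-σ : ∀ {a} → Coprime n a → ∀ (f : ℕ → ℤ) → Π h (λ i → f (σ a (suc i))) ≡ Π h (λ i → f (suc i))
    Π-σ {a} c f = trans (Π-cong h {λ i → f (σ a (suc i))} {λ i → f (suc (pred (σ a (suc i))))}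
        (λ i i<h → cong f (sym (suc-pred (σ>0 c (s≤s z≤n) i<h)))))
      (Π-permute h (λ i → f (suc i)) (proj₂ (σ-bijective c)))

    -- Multiplying j by b and then by a picks up the sign of b at j and that of a at `σ b j`; over
    -- all j the latter run through all signs of a, since `σ b` permutes 1, ..., h.
    J-* : ∀ {a b} → Coprime n a → Coprime n b → J (a ℕ.* b) ≡ J a * J b
    J-* {a} {b} ca cb = trans (Π-cong h step) (trans (Π-* h _ _) (cong (_* J b) (Π-σ cb (s a))))
      where
      open ≋-Reasoning n
      l : ∀ a t u → a * (t * u) ≡ t * (a * u)
      l = solve-∀
      l′ : ∀ t t′ u → t * (t′ * u) ≡ t′ * t * u
      l′ = solve-∀
      step : ∀ i → i ℕ.< h → s (a ℕ.* b) (suc i) ≡ s a (σ b (suc i)) * s b (suc i)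
      step i i<h = proj₁ (sσ-unique (coprime-*ʳ ca cb) (s≤s z≤n) i<h (Sign-* (Sign-s a (σ b j)) (Sign-s b j)) (σ≤h a (σ b j)) (begin
        + (a ℕ.* b) * + j           ≡⟨ cong (_* + j) (ℤ.pos-* a b) ⟩
        + a * + b * + j             ≡⟨ ℤ.*-assoc (+ a) (+ b) (+ j) ⟩
        + a * (+ b * + j)           ≈⟨ ≋-*ˡ (+ a) (sσ-≋ b j) ⟩
        + a * (s b j * + σ b j)     ≡⟨ l (+ a) (s b j) (+ σ b j) ⟩
        s b j * (+ a * + σ b j)     ≈⟨ ≋-*ˡ (s b j) (sσ-≋ a (σ b j)) ⟩
        s b j * (s a (σ b j) * + σ a (σ b j)) ≡⟨ l′ (s b j) (s a (σ b j)) (+ σ a (σ b j)) ⟩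
        s a (σ b j) * s b j * + σ a (σ b j) ∎))
        where j = suc i

    J-≋ : ∀ {a b} → + a ≋ + b [ n ] → J a ≡ J b
    J-≋ {a} {b} e = Π-cong h (λ i _ → cong sgn (≋⇒%≡ (a ℕ.* suc i) (b ℕ.* suc i)
      (≋-trans (≋-reflexive (ℤ.pos-* a (suc i))) (≋-trans (≋-*ʳ (+ suc i) e) (≋-reflexive (sym (ℤ.pos-* b (suc i))))))))

    J-sign : ∀ {a t} → Coprime n a → Sign t → + a ≋ t [ n ] → J a ≡ Π h (λ _ → t)
    J-sign {a} {t} c pt e = Π-cong h (λ i i<h → proj₁ (sσ-unique c (s≤s z≤n) i<h pt i<h (≋-*ʳ (+ suc i) e)))

    J-1 : J 1 ≡ 1ℤ
    J-1 = trans (J-sign (Coprimality.sym (Coprimality.1-coprimeTo n)) pos ≋-refl) (Π-1 h (λ _ _ → refl))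

    J--1 : ∀ {a} → Coprime n a → + a ≋ -1ℤ [ n ] → J a ≡ par h
    J--1 c e = trans (J-sign c neg e) (trans (Π-par h 1) (cong par (ℕ.*-identityʳ h)))

    -- Multiply the congruences a j ≡ ± `σ a j` over all j and cancel h!, which is a unit because n
    -- is prime.
    euler : Prime n → ∀ {a} → Coprime n a → (+ a) ^ h ≋ J a [ n ]
    euler pr {a} c = cancel H-unit (begin
      H * (+ a) ^ h                     ≡⟨ ℤ.*-comm H _ ⟩
      (+ a) ^ h * H                     ≡⟨ cong (_* H) (Π-const h (+ a)) ⟨
      Π h (λ _ → + a) * H               ≡⟨ Π-* h (λ _ → + a) (λ i → + suc i) ⟨
      Π h (λ i → + a * + suc i)         ≈⟨ Π-≋ h (λ i → sσ-≋ a (suc i)) ⟩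
      Π h (λ i → s a (suc i) * + σ a (suc i)) ≡⟨ Π-* h (λ i → s a (suc i)) (λ i → + σ a (suc i)) ⟩
      J a * Π h (λ i → + σ a (suc i))   ≡⟨ cong (J a *_) (Π-σ c (λ u → + u)) ⟩
      J a * H                           ≡⟨ ℤ.*-comm (J a) H ⟩
      H * J a ∎)
      where
      open ≋-Reasoning n
      H = Π h (λ i → + suc i)
      Π-const : ∀ k t → Π k (λ _ → t) ≡ t ^ k
      Π-const zero    t = refl
      Π-const (suc k) t = cong (t *_) (Π-const k t)
      Π-≋ : ∀ k {f g} → (∀ i → f i ≋ g i [ n ]) → Π k f ≋ Π k g [ n ]
      Π-≋ zero    p = ≋-refl
      Π-≋ (suc k) p = ≋-* (p 0) (Π-≋ k (λ i → p (suc i)))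
      Π-unit : ∀ k {f} → (∀ i → i ℕ.< k → Coprimeᶻ (f i) n) → Coprimeᶻ (Π k f) n
      Π-unit zero    p = 1ℤ , ≋-refl
      Π-unit (suc k) {f} p with p 0 (s≤s z≤n) | Π-unit k (λ i i<k → p (suc i) (s≤s i<k))
      ... | x , px | y , py = x * y , ≋-trans (≋-reflexive (l (f 0) _ x y)) (≋-* px py)
        where
        l : ∀ a b x y → a * b * (x * y) ≡ (a * x) * (b * y)
        l = solve-∀
      H-unit : Coprimeᶻ H n
      H-unit = Π-unit h (λ i i<h → coprime⇒inverse (Coprimality.sym (prime⇒coprime pr (ℕ.≤-<-trans i<h h<n))))

    J-square : ∀ {a} → Coprime n a → J (a ℕ.* a) ≡ 1ℤ
    J-square {a} c = trans (J-* c c) (Sign-square (Sign-J a))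

  par-dvd : ∀ k f → f ℕ.≤ k → Π k (λ i → if suc i ℕ.≤ᵇ f then -1ℤ else 1ℤ) ≡ par f
  par-dvd k zero _ = Π-1 k (λ _ _ → refl)
  par-dvd (suc k) (suc f) (s≤s f≤k) = cong (-1ℤ *_) (trans (Π-cong k (λ i _ → refl)) (par-dvd k f f≤k))

  module Reciprocity (h n : ℕ) .{{_ : NonZero n}} (n≡ : n ≡ suc (h ℕ.+ h)) (g m : ℕ) .{{_ : NonZero m}} (m≡ : m ≡ suc (g ℕ.+ g)) where

    open Gauss h n n≡

    -- Eisenstein's lattice points: -1 marks the points of the rectangle on one side of the
    -- diagonal.
    T′ : ℕ → ℕ → ℤ
    T′ j i = if n ℕ.* suc i ℕ.≤ᵇ m ℕ.* suc j then -1ℤ else 1ℤ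

    private
      -- As n is odd, j ≡ r + f modulo 2. The magnitude u has the parity of r when r is low and the
      -- opposite one when r + u = n, so the sign t is visible in the parities.
      parity : ∀ {a f r t u j} → Folded r t u → a ≡ r ℕ.+ f ℕ.* n → par a ≡ par j → t ≡ par f * par j * par u
      parity {a} {f} {r} {j = j} F a≡ pa = go F
        where
        n-par : ∀ k → par (k ℕ.* n) ≡ par k
        n-par k = trans (cong par (trans (ℕ.*-comm k n) (cong (ℕ._* k) n≡))) (par-odd* h k)
        base : par j ≡ par r * par f
        base = trans (sym pa) (trans (cong par a≡) (trans (par-+ r (f ℕ.* n)) (cong (par r *_) (n-par f))))
        l : ∀ r f → f * (r * f) * r ≡ (r * r) * (f * f)
        l = solve-∀
        unit : par f * par j * par r ≡ 1ℤ
        unit = trans (cong (λ z → par f * z * par r) base) (trans (l (par r) (par f)) (cong₂ _*_ (Sign-square (Sign-par r)) (Sign-square (Sign-par f))))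
        go : ∀ {t u} → Folded r t u → t ≡ par f * par j * par u
        go (low _) = sym unit
        go {u = u} (high e _) = trans (cong (-1ℤ *_) (sym unit)) (trans (l′ (par f) (par j) (par r)) (cong (λ z → par f * par j * z) (sym ur)))
          where
          l′ : ∀ f j r → -1ℤ * (f * j * r) ≡ f * j * (-1ℤ * r)
          l′ = solve-∀
          r*u : par r * par u ≡ -1ℤ
          r*u = trans (sym (par-+ r u)) (trans (cong par e) (trans (cong par n≡) (cong (-1ℤ *_) (par-double h))))
          l″ : ∀ r u → r * r * u ≡ r * (r * u)
          l″ = solve-∀
          ur : par u ≡ -1ℤ * par r
          ur = trans (sym (ℤ.*-identityˡ (par u))) (trans (cong (_* par u) (sym (Sign-square (Sign-par r)))) (trans (l″ (par r) (par u)) (trans (cong (par r *_) r*u) (ℤ.*-comm (par r) -1ℤ))))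

    fl : ℕ → ℕ
    fl j = (m ℕ.* j) / n

    fl≤ : ∀ {i} → i ℕ.< h → fl (suc i) ℕ.≤ g
    fl≤ {i} i<h = ℕ.≤-pred (m<n*o⇒m/o<n {m ℕ.* suc i} {suc g} {n} (ℕ.*-cancelˡ-< 2 _ _ (ℕ.≤-<-trans le lt)))
      where
      le : 2 ℕ.* (m ℕ.* suc i) ℕ.≤ m ℕ.* (h ℕ.+ h)
      le = ℕ.≤-trans (ℕ.≤-reflexive (l m (suc i))) (ℕ.*-monoʳ-≤ m (ℕ.+-mono-≤ i<h i<h))
        where
        l : ∀ m j → 2 ℕ.* (m ℕ.* j) ≡ m ℕ.* (j ℕ.+ j)
        l = ℕR.solve-∀
      lt : m ℕ.* (h ℕ.+ h) ℕ.< 2 ℕ.* (suc g ℕ.* n)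
      lt = subst (λ m → m ℕ.* (h ℕ.+ h) ℕ.< 2 ℕ.* (suc g ℕ.* n)) (sym m≡) (subst (λ n → suc (g ℕ.+ g) ℕ.* (h ℕ.+ h) ℕ.< 2 ℕ.* (suc g ℕ.* n)) (sym n≡)
        (ℕ.≤-trans (s≤s (ℕ.m≤m+n _ (g ℕ.+ g ℕ.+ (h ℕ.+ h) ℕ.+ 1))) (ℕ.≤-reflexive (l g h))))
        where
        l : ∀ g h → suc (suc (g ℕ.+ g) ℕ.* (h ℕ.+ h) ℕ.+ (g ℕ.+ g ℕ.+ (h ℕ.+ h) ℕ.+ 1)) ≡ 2 ℕ.* (suc g ℕ.* suc (h ℕ.+ h))
        l = ℕR.solve-∀

    -- The parities of j and of `σ m j` have the same product over all j and cancel. The floors of m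
    -- j / n remain, and each floor counts the lattice points of one column below the diagonal.
    J-lattice : Coprime n m → J m ≡ Π h (λ j → Π g (T′ j))
    J-lattice c = begin
      J m
        ≡⟨ Π-cong h (λ i _ → signs i) ⟩
      Π h (λ i → par (fl (suc i)) * par (suc i) * par (σ m (suc i)))
        ≡⟨ Π-* h (λ i → par (fl (suc i)) * par (suc i)) (λ i → par (σ m (suc i))) ⟩
      Π h (λ i → par (fl (suc i)) * par (suc i)) * Π h (λ i → par (σ m (suc i)))
        ≡⟨ cong₂ _*_ (Π-* h (λ i → par (fl (suc i))) (λ i → par (suc i))) (Π-σ c par) ⟩
      Π h (λ i → par (fl (suc i))) * P * P
        ≡⟨ ℤ.*-assoc (Π h (λ i → par (fl (suc i)))) P P ⟩
      Π h (λ i → par (fl (suc i))) * (P * P)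
        ≡⟨ cong (Π h (λ i → par (fl (suc i))) *_) (Sign-square (Sign-Π h (λ i → Sign-par (suc i)))) ⟩
      Π h (λ i → par (fl (suc i))) * 1ℤ
        ≡⟨ ℤ.*-identityʳ (Π h (λ i → par (fl (suc i)))) ⟩
      Π h (λ i → par (fl (suc i)))
        ≡⟨ Π-cong h (λ j j<h → trans (sym (par-dvd g (fl (suc j)) (fl≤ j<h))) (Π-cong g (λ i _ → compare j i))) ⟩
      Π h (λ j → Π g (T′ j)) ∎
      where
      open ≡-Reasoning
      P = Π h (λ i → par (suc i))
      signs : ∀ i → s m (suc i) ≡ par (fl (suc i)) * par (suc i) * par (σ m (suc i))
      signs i = parity {m ℕ.* suc i} {fl (suc i)} {j = suc i} (fold (m%n<n (m ℕ.* suc i) n)) (m≡m%n+[m/n]*n (m ℕ.* suc i) n)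
        (trans (cong (λ z → par (z ℕ.* suc i)) m≡) (par-odd* g (suc i)))
      iff : ∀ {a b c d} → (a ℕ.≤ b → c ℕ.≤ d) → (c ℕ.≤ d → a ℕ.≤ b) → (a ℕ.≤ᵇ b) ≡ (c ℕ.≤ᵇ d)
      iff {a} {b} {c} {d} f f′ with a ℕ.≤ᵇ b in e₁ | c ℕ.≤ᵇ d in e₂
      ... | true  | true  = refl
      ... | false | false = refl
      ... | true  | false = contradiction (ℕ.≤⇒≤ᵇ (f (ℕ.≤ᵇ⇒≤ a b (subst T (sym e₁) _)))) (subst T e₂)
      ... | false | true  = contradiction (ℕ.≤⇒≤ᵇ (f′ (ℕ.≤ᵇ⇒≤ c d (subst T (sym e₂) _)))) (subst T e₁)
      compare : ∀ j i → (if suc i ℕ.≤ᵇ fl (suc j) then -1ℤ else 1ℤ) ≡ T′ j i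
      compare j i = cong (λ b → if b then -1ℤ else 1ℤ) (iff {suc i} {fl (suc j)}
        (λ le → ℕ.≤-trans (ℕ.≤-reflexive (ℕ.*-comm n (suc i))) (ℕ.≤-trans (ℕ.*-monoˡ-≤ n le) (m/n*n≤m (m ℕ.* suc j) n)))
        (λ le → ℕ.≤-trans (ℕ.≤-reflexive (sym (m*n/n≡m (suc i) n))) (/-monoˡ-≤ n (ℕ.≤-trans (ℕ.≤-reflexive (ℕ.*-comm (suc i) n)) le))))

  module _ (h n : ℕ) .{{_ : NonZero n}} (n≡ : n ≡ suc (h ℕ.+ h)) (g m : ℕ) .{{_ : NonZero m}} (m≡ : m ≡ suc (g ℕ.+ g)) where

    private
      module R₁ = Reciprocity h n n≡ g m m≡
      module R₂ = Reciprocity g m m≡ h n n≡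

    -- Coprimality keeps the h × g lattice points off the diagonal, so each is marked in exactly one
    -- of the two lattice products.
    reciprocity : Coprime n m → Gauss.J h n n≡ m * Gauss.J g m m≡ n ≡ par (h ℕ.* g)
    reciprocity c = begin
      Gauss.J h n n≡ m * Gauss.J g m m≡ n
        ≡⟨ cong₂ _*_ (R₁.J-lattice c) (trans (R₂.J-lattice (Coprimality.sym c)) (Π-swap g h R₂.T′)) ⟩
      Π h (λ j → Π g (R₁.T′ j)) * Π h (λ j → Π g (λ i → R₂.T′ i j))
        ≡⟨ Π-* h (λ j → Π g (R₁.T′ j)) (λ j → Π g (λ i → R₂.T′ i j)) ⟨
      Π h (λ j → Π g (R₁.T′ j) * Π g (λ i → R₂.T′ i j))
        ≡⟨ Π-cong h (λ j j<h → trans (sym (Π-* g (R₁.T′ j) (λ i → R₂.T′ i j))) (Π-cong g (λ i _ → opposite j j<h i))) ⟩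
      Π h (λ j → Π g (λ i → -1ℤ))
        ≡⟨ Π-cong h (λ _ _ → trans (Π-par g 1) (cong par (ℕ.*-identityʳ g))) ⟩
      Π h (λ j → par g)
        ≡⟨ Π-par h g ⟩
      par (h ℕ.* g) ∎
      where
      open ≡-Reasoning
      ≤ᵇ-true : ∀ {a b} → a ℕ.≤ b → (a ℕ.≤ᵇ b) ≡ true
      ≤ᵇ-true {a} {b} le with a ℕ.≤ᵇ b | ℕ.≤⇒≤ᵇ le
      ... | true | _ = refl
      ≤ᵇ-false : ∀ {a b} → b ℕ.< a → (a ℕ.≤ᵇ b) ≡ false
      ≤ᵇ-false {a} {b} lt with a ℕ.≤ᵇ b in eq
      ... | false = refl
      ... | true  = contradiction (ℕ.≤ᵇ⇒≤ a b (subst T (sym eq) _)) (ℕ.<⇒≱ lt)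
      distinct : ∀ j → j ℕ.< h → ∀ i → n ℕ.* suc i ≢ m ℕ.* suc j
      distinct j j<h i e = ℕ.<⇒≱ (ℕ.≤-<-trans j<h (Gauss.h<n h n n≡)) (ℕ.∣⇒≤ (coprime-divisor c (ℕ.divides (suc i) (trans (sym e) (ℕ.*-comm n (suc i))))))
      opposite : ∀ j → j ℕ.< h → ∀ i → R₁.T′ j i * R₂.T′ i j ≡ -1ℤ
      opposite j j<h i with ℕ.<-cmp (n ℕ.* suc i) (m ℕ.* suc j)
      ... | tri< lt _ _ = cong₂ (λ b b′ → (if b then -1ℤ else 1ℤ) * (if b′ then -1ℤ else 1ℤ)) (≤ᵇ-true (ℕ.<⇒≤ lt)) (≤ᵇ-false lt)
      ... | tri≈ _ eq _ = contradiction eq (distinct j j<h i)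
      ... | tri> _ _ gt = cong₂ (λ b b′ → (if b then -1ℤ else 1ℤ) * (if b′ then -1ℤ else 1ℤ)) (≤ᵇ-false gt) (≤ᵇ-true (ℕ.<⇒≤ gt))

-- Existence of nonresidues for prime and for nonsquare moduli.

module Nonresidues where

  open Congruences
  open JacobiSymbol
  open import Data.Integer using (_^_)

  -- Iterated forward difference. It replaces the bound on the number of roots of a polynomial in
  -- the search for a nonresidue.
  Δ : ℕ → (ℕ → ℤ) → ℕ → ℤ
  Δ zero    f x = f x
  Δ (suc k) f x = Δ k f (suc x) - Δ k f x

  Δ-leibniz : ∀ k f x → Δ (suc k) (λ y → + y * f y) x ≡ (+ x + + suc k) * Δ (suc k) f x + + suc k * Δ k f x
  Δ-leibniz zero f x = l (+ x) (f x) (f (suc x))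
    where
    l : ∀ x a b → (1ℤ + x) * b - x * a ≡ (x + 1ℤ) * (b - a) + 1ℤ * a
    l = solve-∀
  Δ-leibniz (suc k) f x = trans (cong₂ _-_ (Δ-leibniz k f (suc x)) (Δ-leibniz k f x))
    (l (+ x) (+ k) (Δ k f x) (Δ k f (suc x)) (Δ k f (suc (suc x))))
    where
    l : ∀ x k a b c → ((1ℤ + x + (1ℤ + k)) * (c - b) + (1ℤ + k) * b) - ((x + (1ℤ + k)) * (b - a) + (1ℤ + k) * a)
      ≡ (x + (1ℤ + (1ℤ + k))) * ((c - b) - (b - a)) + (1ℤ + (1ℤ + k)) * (b - a)
    l = solve-∀

  fac : ℕ → ℤ
  fac zero    = 1ℤ
  fac (suc d) = + suc d * fac d

  Δ-power : ∀ d x → Δ d (λ y → (+ y) ^ d) x ≡ fac d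
  Δ-power zero    x = refl
  Δ-power (suc d) x = trans (Δ-leibniz d (λ y → (+ y) ^ d) x)
    (trans (cong₂ (λ a b → (+ x + + suc d) * (a - b) + + suc d * b) (Δ-power d (suc x)) (Δ-power d x)) (l (+ x + + suc d) (+ suc d) (fac d)))
    where
    l : ∀ x d a → x * (a - a) + d * a ≡ d * a
    l = solve-∀

  Δ-≋0 : ∀ {n f c} k y → (∀ i → i ℕ.≤ suc k → f (i ℕ.+ y) ≋ c [ n ]) → Δ (suc k) f y ≋ 0ℤ [ n ]
  Δ-≋0 {c = c} zero    y h = ≋-trans (≋-- (h 1 ℕ.≤-refl) (h 0 z≤n)) (≋-reflexive (ℤ.+-inverseʳ c))
  Δ-≋0 {n} {f} {c} (suc k) y h = ≋-- (Δ-≋0 {c = c} k (suc y) (λ i i≤ → subst (λ z → f z ≋ c [ n ]) (sym (ℕ.+-suc i y)) (h (suc i) (s≤s i≤))))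
    (Δ-≋0 {c = c} k y (λ i i≤ → h i (ℕ.m≤n⇒m≤1+n i≤)))

  module _ (h n : ℕ) .{{_ : NonZero n}} (n≡ : n ≡ suc (h ℕ.+ h)) (pr : Prime n) where
    open Gauss h n n≡

    private
      h≢0 : h ≢ 0
      h≢0 refl = ¬prime[1] (subst Prime n≡ pr)

      coprime-suc : ∀ {i} → i ℕ.≤ h → Coprime n (suc i)
      coprime-suc {i} i≤h = prime⇒coprime pr (subst (suc i ℕ.<_) (sym n≡) (s≤s (ℕ.≤-trans (s≤s i≤h) (ℕ.+-monoˡ-≤ h (ℕ.n≢0⇒n>0 h≢0)))))

      fac-unit : ∀ d → d ℕ.≤ suc h → Coprimeᶻ (fac d) n
      fac-unit zero    _ = 1ℤ , ≋-refl
      fac-unit (suc d) (s≤s d≤h) with coprime⇒inverse (Coprimality.sym (coprime-suc d≤h)) | fac-unit d (ℕ.m≤n⇒m≤1+n d≤h)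
      ... | x , px | y , py = x * y , ≋-trans (≋-reflexive (l (+ suc d) (fac d) x y)) (≋-* px py)
        where
        l : ∀ a b x y → a * b * (x * y) ≡ (a * x) * (b * y)
        l = solve-∀

      all-one : (∀ i → i ℕ.≤ h → J (suc i) ≡ 1ℤ) → ⊥
      all-one all = contra (fac-unit h (ℕ.n≤1+n h))
        where
        k = ℕ.pred h
        eq : h ≡ suc k
        eq = sym (suc-pred (ℕ.n≢0⇒n>0 h≢0))
        fac≋0 : fac h ≋ 0ℤ [ n ]
        fac≋0 = ≋-trans (≋-reflexive (sym (trans (cong (λ z → Δ z (λ y → (+ y) ^ h) 1) (sym eq)) (Δ-power h 1)))) (Δ-≋0 {c = 1ℤ} k 1 values)
          where
          values : ∀ i → i ℕ.≤ suc k → (+ (i ℕ.+ 1)) ^ h ≋ 1ℤ [ n ]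
          values i i≤ = subst (λ z → (+ z) ^ h ≋ 1ℤ [ n ]) (ℕ.+-comm 1 i)
            (≋-trans (euler pr (coprime-suc i≤h)) (≋-reflexive (all i i≤h)))
            where
            i≤h : i ℕ.≤ h
            i≤h = subst (i ℕ.≤_) (sym eq) i≤
        contra : Coprimeᶻ (fac h) n → ⊥
        contra (x , px) = ¬prime[1] (subst Prime (ℕ.∣1⇒≡1 (≋0⇒∣ (≋-trans (≋-sym px) (≋-trans (≋-*ʳ x fac≋0) (≋-reflexive (ℤ.*-zeroˡ x)))))) pr)

    -- If 1, ..., h + 1 all had symbol 1, Euler's criterion would make y^h ≡ 1 at h + 1 consecutive
    -- points. Then the h-th difference of y^h, which is h!, would vanish modulo the prime n = 2h +
    -- 1.
    J-nontrivial : Σ ℕ λ a → Coprime n a × J a ≡ -1ℤ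
    J-nontrivial with search (suc h)
      where
      search : ∀ k → (Σ ℕ λ i → i ℕ.< k × J (suc i) ≡ -1ℤ) ⊎ (∀ i → i ℕ.< k → J (suc i) ≡ 1ℤ)
      search zero = inj₂ λ _ ()
      search (suc k) with search k
      ... | inj₁ (i , i<k , e) = inj₁ (i , ℕ.m≤n⇒m≤1+n i<k , e)
      ... | inj₂ all with ±1 (Sign-J (suc k))
        where
        ±1 : ∀ {s} → Sign s → s ≡ 1ℤ ⊎ s ≡ -1ℤ
        ±1 pos = inj₁ refl
        ±1 neg = inj₂ refl
      ...   | inj₂ e = inj₁ (k , ℕ.≤-refl , e)
      ...   | inj₁ e = inj₂ λ i i<1+k → last i (ℕ.m≤n⇒m<n∨m≡n (ℕ.≤-pred i<1+k))
        where
        last : ∀ i → i ℕ.< k ⊎ i ≡ k → J (suc i) ≡ 1ℤ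
        last i (inj₁ i<k) = all i i<k
        last i (inj₂ refl) = e
    ... | inj₁ (i , s≤s i≤h , e) = suc i , coprime-suc i≤h , e
    ... | inj₂ all = ⊥-elim (all-one λ i i≤h → all i (s≤s i≤h))

  prime-divisor : ∀ n → n ≢ 0 → n ≢ 1 → Σ ℕ λ p → Prime p × p ℕ.∣ n
  prime-divisor zero n≢0 _ = contradiction refl n≢0
  prime-divisor n@(suc _) _ n≢1 with factorise n
  ... | record { factors = [] ; isFactorisation = e } = contradiction e n≢1
  ... | record { factors = p ∷ ps ; isFactorisation = e ; factorsPrime = pr ∷ _ } = p , pr , ℕ.divides (product ps) (trans e (ℕ.*-comm p _))

  split-power : ∀ {p} → Prime p → ∀ n → n ≢ 0 → Σ ℕ λ v → Σ ℕ λ m → n ≡ p ℕ.^ v ℕ.* m × ¬ p ℕ.∣ m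
  split-power {p} pr = <-rec (λ n → n ≢ 0 → Σ ℕ λ v → Σ ℕ λ m → n ≡ p ℕ.^ v ℕ.* m × ¬ p ℕ.∣ m) go
    where
    go : ∀ n → (∀ {k} → k ℕ.< n → k ≢ 0 → Σ ℕ λ v → Σ ℕ λ m → k ≡ p ℕ.^ v ℕ.* m × ¬ p ℕ.∣ m) →
         n ≢ 0 → Σ ℕ λ v → Σ ℕ λ m → n ≡ p ℕ.^ v ℕ.* m × ¬ p ℕ.∣ m
    go n rec n≢0 with p ℕ.∣? n
    ... | no p∤n = 0 , n , sym (ℕ.+-identityʳ n) , p∤n
    ... | yes (ℕ.divides k refl) with rec (ℕ.m<m*n k p {{ℕ.≢-nonZero k≢0}} (ℕ.nonTrivial⇒n>1 p {{prime⇒nonTrivial pr}})) k≢0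
      where
      k≢0 : k ≢ 0
      k≢0 refl = n≢0 refl
    ...   | v , m , refl , p∤m = suc v , m , trans (ℕ.*-comm (p ℕ.^ v ℕ.* m) p) (sym (ℕ.*-assoc p (p ℕ.^ v) m)) , p∤m

  Square : ℕ → Set
  Square n = Σ ℕ λ k → k ℕ.* k ≡ n

  parity : ∀ n → Σ ℕ λ k → n ≡ k ℕ.+ k ⊎ n ≡ suc (k ℕ.+ k)
  parity zero = 0 , inj₁ refl
  parity (suc n) with parity n
  ... | k , inj₁ refl = k , inj₂ refl
  ... | k , inj₂ refl = suc k , inj₁ (cong suc (sym (ℕ.+-suc k k)))

  -- A prime power with even exponent is a square and can be split off: the cofactor is smaller and
  -- still not a square.
  odd-exponent : ∀ g → g ≢ 0 → ¬ Square g → Σ ℕ λ p → Prime p × Σ ℕ λ k → Σ ℕ λ m → g ≡ p ℕ.* ((p ℕ.^ k ℕ.* p ℕ.^ k) ℕ.* m) × ¬ p ℕ.∣ m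
  odd-exponent = <-rec Goal go
    where
    Goal : ℕ → Set
    Goal g = g ≢ 0 → ¬ Square g → Σ ℕ λ p → Prime p × Σ ℕ λ k → Σ ℕ λ m → g ≡ p ℕ.* ((p ℕ.^ k ℕ.* p ℕ.^ k) ℕ.* m) × ¬ p ℕ.∣ m
    go : ∀ g → (∀ {g′} → g′ ℕ.< g → Goal g′) → Goal g
    go g rec g≢0 ¬sq with prime-divisor g g≢0 (λ { refl → ¬sq (1 , refl) })
    ... | p , pr , p∣g with split-power pr g g≢0
    ... | v , m , refl , p∤m with parity v
    ... | k , inj₂ refl = p , pr , k , m , trans (ℕ.*-assoc p _ m) (cong (λ z → p ℕ.* (z ℕ.* m)) (ℕ.^-distribˡ-+-* p k k)) , p∤m
    ... | zero , inj₁ refl = contradiction (subst (p ℕ.∣_) (ℕ.+-identityʳ m) p∣g) p∤m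
    ... | suc k , inj₁ refl with rec {m} m<g m≢0 ¬sqm
      where
      m≢0 : m ≢ 0
      m≢0 refl = g≢0 (ℕ.*-zeroʳ (p ℕ.^ (suc k ℕ.+ suc k)))
      instance _ = prime⇒nonZero pr
      m<g : m ℕ.< p ℕ.^ (suc k ℕ.+ suc k) ℕ.* m
      m<g = ℕ.<-≤-trans (ℕ.m<m*n m p {{ℕ.≢-nonZero m≢0}} (ℕ.nonTrivial⇒n>1 p {{prime⇒nonTrivial pr}}))
        (ℕ.≤-trans (ℕ.≤-reflexive (ℕ.*-comm m p)) (ℕ.*-monoˡ-≤ m (ℕ.m≤m*n p (p ℕ.^ (k ℕ.+ suc k)) {{ℕ.m^n≢0 p (k ℕ.+ suc k)}})))
      ¬sqm : ¬ Square m
      ¬sqm (x , refl) = ¬sq (p ℕ.^ suc k ℕ.* x , trans (l (p ℕ.^ suc k) x) (cong (ℕ._* (x ℕ.* x)) (sym (ℕ.^-distribˡ-+-* p (suc k) (suc k)))))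
        where
        l : ∀ a x → (a ℕ.* x) ℕ.* (a ℕ.* x) ≡ (a ℕ.* a) ℕ.* (x ℕ.* x)
        l = ℕR.solve-∀
    ...   | p′ , pr′ , k′ , m′ , refl , p′∤m′ = p′ , pr′ , k′ , a ℕ.* m′ , l a p′ (p′ ℕ.^ k′ ℕ.* p′ ℕ.^ k′) m′ , p′∤
      where
      a = p ℕ.^ (suc k ℕ.+ suc k)
      l : ∀ a p b m → a ℕ.* (p ℕ.* (b ℕ.* m)) ≡ p ℕ.* (b ℕ.* (a ℕ.* m))
      l = ℕR.solve-∀
      p∤p′ : ¬ p ℕ.∣ p′
      p∤p′ d = p∤m (ℕ.∣-trans d (ℕ.m∣m*n _))
      p′∤ : ¬ p′ ℕ.∣ a ℕ.* m′
      p′∤ d = p′∤m′ (coprime-divisor (coprime-^ʳ (suc k ℕ.+ suc k) (Coprimality.sym (prime∤⇒coprime pr p∤p′))) d)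

  dvd-odd : ∀ {d n} → d ℕ.∣ n → (Σ ℕ λ h → n ≡ suc (h ℕ.+ h)) → Σ ℕ λ a → d ≡ suc (a ℕ.+ a)
  dvd-odd {d} (ℕ.divides q refl) (h , e) with parity d
  ... | a , inj₂ refl = a , refl
  ... | a , inj₁ refl = contradiction (ℕ.∣n⇒∣m*n q (ℕ.divides a (l a))) (odd∤ (subst (_≡ suc (h ℕ.+ h)) refl e))
    where
    l : ∀ a → a ℕ.+ a ≡ a ℕ.* 2
    l = ℕR.solve-∀
    odd∤ : ∀ {n} → n ≡ suc (h ℕ.+ h) → ¬ 2 ℕ.∣ n
    odd∤ refl d with ℕ.∣m+n∣m⇒∣n (subst (2 ℕ.∣_) (ℕ.+-comm 1 (h ℕ.+ h)) d) (ℕ.divides h (l h))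
    ... | d′ with () ← ℕ.∣1⇒≡1 d′

  -- The modulus m is ≡ 1 (mod 4), so the sign in reciprocity has even exponent.
  J-swap : ∀ h n .{{_ : NonZero n}} (n≡ : n ≡ suc (h ℕ.+ h)) t m .{{_ : NonZero m}} (m≡ : m ≡ suc ((t ℕ.+ t) ℕ.+ (t ℕ.+ t))) →
    Coprime n m → Gauss.J h n n≡ m ≡ Gauss.J (t ℕ.+ t) m m≡ n
  J-swap h n n≡ t m m≡ c = Sign-*≡1 (Gauss.Sign-J h n n≡ m) (Gauss.Sign-J (t ℕ.+ t) m m≡ n)
    (trans (reciprocity h n n≡ (t ℕ.+ t) m m≡ c) (trans (cong par (ℕ.*-distribˡ-+ h t t)) (par-double (h ℕ.* t))))

  -- Makes the character (·/g) nontrivial. With p of odd exponent in g, take n to be a nonresidue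
  -- modulo p and 1 modulo the part of 4 D g prime to p. As n ≡ 1 (mod 4), reciprocity turns (n/g)
  -- into (g/n), which factors over p, a square and m; turning back, p contributes -1 and m
  -- contributes 1.
  nonresidue : ∀ t g .{{_ : NonZero g}} (g≡ : g ≡ suc ((t ℕ.+ t) ℕ.+ (t ℕ.+ t))) → ¬ Square g → ∀ D → D ≢ 0 →
    Σ ℕ λ n → Coprime D n × Coprime g n × Gauss.J (t ℕ.+ t) g g≡ n ≡ -1ℤ
  nonresidue t g g≡ ¬sq D D≢0 with odd-exponent g (ℕ.≢-nonZero⁻¹ g) ¬sq
  ... | p , pr , k , m , e , p∤m with dvd-odd {p} {g} (ℕ.divides (p ℕ.^ k ℕ.* p ℕ.^ k ℕ.* m) (trans e (ℕ.*-comm p _))) (t ℕ.+ t , g≡)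
                                    | dvd-odd {m} {g} (ℕ.divides (p ℕ.* (p ℕ.^ k ℕ.* p ℕ.^ k)) (trans e (sym (ℕ.*-assoc p _ m)))) (t ℕ.+ t , g≡)
  ... | hp , p≡ | hm , m≡ = result
    where
    instance
      nzp : NonZero p
      nzp = prime⇒nonZero pr
      nzm : NonZero m
      nzm = ℕ.≢-nonZero λ { refl → contradiction m≡ λ () }
    m∣g : m ℕ.∣ g
    m∣g = ℕ.divides (p ℕ.* (p ℕ.^ k ℕ.* p ℕ.^ k)) (trans e (sym (ℕ.*-assoc p _ m)))
    M = 4 ℕ.* (D ℕ.* g)
    M≢0 : M ≢ 0
    M≢0 e₀ = ℕ.≢-nonZero⁻¹ (4 ℕ.* (D ℕ.* g)) {{ℕ.m*n≢0 4 (D ℕ.* g) {{_}} {{ℕ.m*n≢0 D g {{ℕ.≢-nonZero D≢0}}}}}} e₀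
    open Σ (split-power pr M M≢0) renaming (proj₁ to v; proj₂ to rest)
    D₁ = proj₁ rest
    M≡ : M ≡ p ℕ.^ v ℕ.* D₁
    M≡ = proj₁ (proj₂ rest)
    p∤D₁ : ¬ p ℕ.∣ D₁
    p∤D₁ = proj₂ (proj₂ rest)
    p≢2 : ¬ p ℕ.∣ 2
    p≢2 d with dvd-odd d₂ (hp , p≡)
      where
      d₂ : 2 ℕ.∣ p
      d₂ with Data.Nat.Primality.prime⇒irreducible prime[2] d
      ... | inj₁ refl = contradiction pr ¬prime[1]
      ... | inj₂ refl = ℕ.∣-refl
    ... | zero , ()
    ... | suc a , e₂ = contradiction (cong ℕ.pred (cong ℕ.pred e₂)) (λ e₃ → ℕ.0≢1+n (trans e₃ (ℕ.+-suc a a)))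
    ∣D₁ : ∀ {x} → x ℕ.∣ M → Coprime p x → x ℕ.∣ D₁
    ∣D₁ {x} x∣M c = coprime-divisor (coprime-^ʳ v (Coprimality.sym c)) (subst (x ℕ.∣_) M≡ x∣M)
    m∣D₁ : m ℕ.∣ D₁
    m∣D₁ = ∣D₁ (ℕ.∣n⇒∣m*n 4 (ℕ.∣n⇒∣m*n D m∣g)) (prime∤⇒coprime pr p∤m)
    4∣D₁ : 4 ℕ.∣ D₁
    4∣D₁ = ∣D₁ (ℕ.m∣m*n (D ℕ.* g)) (coprime-*ʳ {p} {2} {2} (prime∤⇒coprime pr p≢2) (prime∤⇒coprime pr p≢2))
    module P = Gauss hp p p≡
    open Σ (J-nontrivial hp p p≡ pr) renaming (proj₁ to u; proj₂ to u-props)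
    c-pD₁ : Coprime p D₁
    c-pD₁ = prime∤⇒coprime pr p∤D₁
    D₁≢0 : D₁ ≢ 0
    D₁≢0 e₀ = M≢0 (trans M≡ (trans (cong (p ℕ.^ v ℕ.*_) e₀) (ℕ.*-zeroʳ (p ℕ.^ v))))
    x = crt c-pD₁ (+ u) 1ℤ
    instance
      nz : NonZero (p ℕ.* D₁)
      nz = ℕ.m*n≢0 p D₁ {{nzp}} {{ℕ.≢-nonZero D₁≢0}}
    open Σ (residue (p ℕ.* D₁) (proj₁ x)) renaming (proj₁ to n₀; proj₂ to n₀-props)
    n₀≋u : + n₀ ≋ + u [ p ]
    n₀≋u = ≋-trans (≋-dvd (ℕ.m∣m*n D₁) (proj₂ n₀-props)) (proj₁ (proj₂ x))
    n₀≋1 : + n₀ ≋ 1ℤ [ D₁ ]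
    n₀≋1 = ≋-trans (≋-dvd (ℕ.n∣m*n p) (proj₂ n₀-props)) (proj₂ (proj₂ x))
    c-D₁ : Coprime n₀ D₁
    c-D₁ = inverse⇒coprime (1ℤ , ≋-trans (≋-reflexive (ℤ.*-identityʳ _)) n₀≋1)
    c-p : Coprime n₀ p
    c-p with coprime⇒inverse (Coprimality.sym (proj₁ u-props))
    ... | i , q = inverse⇒coprime (i , ≋-trans (≋-*ʳ i n₀≋u) q)
    c-M : Coprime n₀ M
    c-M = subst (Coprime n₀) (sym M≡) (coprime-*ʳ (coprime-^ʳ v c-p) c-D₁)
    c-g : Coprime g n₀
    c-g = Coprimality.sym (coprime-dvdʳ (ℕ.∣n⇒∣m*n 4 (ℕ.n∣m*n D)) c-M)
    τ = n₀ / 4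
    n₀≡ : n₀ ≡ suc ((τ ℕ.+ τ) ℕ.+ (τ ℕ.+ τ))
    n₀≡ = trans (m≡m%n+[m/n]*n n₀ 4) (trans (cong (ℕ._+ τ ℕ.* 4) (≋⇒%≡ n₀ 1 (≋-dvd 4∣D₁ n₀≋1))) (cong suc (l τ)))
      where
      l : ∀ τ → τ ℕ.* 4 ≡ (τ ℕ.+ τ) ℕ.+ (τ ℕ.+ τ)
      l = ℕR.solve-∀
    instance
      nz₀ : NonZero n₀
      nz₀ = ℕ.≢-nonZero λ e₀ → ℕ.0≢1+n (trans (sym e₀) n₀≡)
    module N₀ = Gauss (τ ℕ.+ τ) n₀ n₀≡
    pk = p ℕ.^ k
    c-pk : Coprime n₀ pk
    c-pk = coprime-^ʳ k c-p
    c-m : Coprime n₀ m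
    c-m = coprime-dvdʳ m∣D₁ c-D₁
    J≡ : Gauss.J (t ℕ.+ t) g g≡ n₀ ≡ -1ℤ
    J≡ = begin
      Gauss.J (t ℕ.+ t) g g≡ n₀             ≡⟨ J-swap (t ℕ.+ t) g g≡ τ n₀ n₀≡ c-g ⟩
      N₀.J g                               ≡⟨ cong N₀.J e ⟩
      N₀.J (p ℕ.* ((pk ℕ.* pk) ℕ.* m))     ≡⟨ N₀.J-* c-p (coprime-*ʳ (coprime-*ʳ c-pk c-pk) c-m) ⟩
      N₀.J p * N₀.J ((pk ℕ.* pk) ℕ.* m)    ≡⟨ cong (N₀.J p *_) (trans (N₀.J-* (coprime-*ʳ c-pk c-pk) c-m) (cong (_* N₀.J m) (N₀.J-square c-pk))) ⟩
      N₀.J p * (1ℤ * N₀.J m)               ≡⟨ cong₂ (λ a b → a * (1ℤ * b)) (sym (J-swap hp p p≡ τ n₀ n₀≡ (Coprimality.sym c-p))) (sym (J-swap hm m m≡ τ n₀ n₀≡ (Coprimality.sym c-m))) ⟩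
      P.J n₀ * (1ℤ * Gauss.J hm m m≡ n₀)   ≡⟨ cong₂ (λ a b → a * (1ℤ * b)) (trans (P.J-≋ n₀≋u) (proj₂ u-props)) (trans (Gauss.J-≋ hm m m≡ {n₀} {1} (≋-dvd m∣D₁ n₀≋1)) (Gauss.J-1 hm m m≡)) ⟩
      -1ℤ ∎
      where open ≡-Reasoning
    result : Σ ℕ λ n → Coprime D n × Coprime g n × Gauss.J (t ℕ.+ t) g g≡ n ≡ -1ℤ
    result = n₀ , Coprimality.sym (coprime-dvdʳ (ℕ.∣n⇒∣m*n 4 (ℕ.m∣m*n g)) c-M) , c-g , J≡

-- Sums over multiples, initial segments and blocks between squares.

module Counting where

  open BigOperators

  open BigOp ℤ.+-0-commutativeMonoid public using () renaming
    (big to ∑; big-cong to ∑-cong; big-∙ to ∑-+; big-ε to ∑-0; big-swap to ∑-swap; big-permute to ∑-permute; big-snoc to ∑-snoc; big-+ to ∑-split)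
  open BigOp ℕ.+-0-commutativeMonoid public using () renaming
    (big to ∑ⁿ; big-snoc to ∑ⁿ-snoc; big-+ to ∑ⁿ-split)

  ∑-*ˡ : ∀ n c f → ∑ n (λ i → c * f i) ≡ c * ∑ n f
  ∑-*ˡ zero    c f = sym (ℤ.*-zeroʳ c)
  ∑-*ˡ (suc n) c f = trans (cong (λ z → c * f 0 + z) (∑-*ˡ n c (λ i → f (suc i)))) (sym (ℤ.*-distribˡ-+ c (f 0) _))

  ∣∑∣≤ : ∀ n {f} B → (∀ i → i ℕ.< n → ∣ f i ∣ ℕ.≤ B) → ∣ ∑ n f ∣ ℕ.≤ n ℕ.* B
  ∣∑∣≤ zero    B h = z≤n
  ∣∑∣≤ (suc n) {f} B h = ℕ.≤-trans (ℤ.∣i+j∣≤∣i∣+∣j∣ (f 0) _) (ℕ.+-mono-≤ (h 0 (s≤s z≤n)) (∣∑∣≤ n B (λ i i<n → h (suc i) (s≤s i<n))))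

  𝟙 : {A : Set} → Dec A → ℤ
  𝟙 d = if does d then 1ℤ else 0ℤ

  𝟙-yes : ∀ {A : Set} (d : Dec A) → A → 𝟙 d ≡ 1ℤ
  𝟙-yes d a = cong (λ b → if b then 1ℤ else 0ℤ) (dec-true d a)

  𝟙-no : ∀ {A : Set} (d : Dec A) → ¬ A → 𝟙 d ≡ 0ℤ
  𝟙-no d ¬a = cong (λ b → if b then 1ℤ else 0ℤ) (dec-false d ¬a)

  𝟙-cong : ∀ {A B : Set} (d : Dec A) (e : Dec B) → (A → B) → (B → A) → 𝟙 d ≡ 𝟙 e
  𝟙-cong (yes a) e f g = sym (𝟙-yes e (f a))
  𝟙-cong (no ¬a) e f g = sym (𝟙-no e (λ b → ¬a (g b)))

  first-multiple : ∀ c (φ : ℕ → ℤ) k → k ℕ.< c → ∑ (suc k) (λ j → 𝟙 (c ℕ.∣? j) * φ j) ≡ φ 0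
  first-multiple c φ k k<c = trans (cong₂ _+_ (trans (cong (_* φ 0) (𝟙-yes (c ℕ.∣? 0) (c ℕ.∣0))) (ℤ.*-identityˡ (φ 0)))
      (∑-0 k (λ i i<k → trans (cong (_* φ (suc i)) (𝟙-no (c ℕ.∣? suc i) (λ d → ℕ.<⇒≱ (ℕ.≤-<-trans i<k k<c) (ℕ.∣⇒≤ d)))) (ℤ.*-zeroˡ (φ (suc i))))))
    (ℤ.+-identityʳ (φ 0))

  ∑-multiples : ∀ c .{{_ : NonZero c}} M (φ : ℕ → ℤ) → ∑ (M ℕ.* c) (λ d → 𝟙 (c ℕ.∣? d) * φ d) ≡ ∑ M (λ e → φ (e ℕ.* c))
  ∑-multiples c zero φ = refl
  ∑-multiples c@(suc c₁) (suc M) φ = trans (∑-split c (M ℕ.* c) (λ d → 𝟙 (c ℕ.∣? d) * φ d))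
    (cong₂ _+_ (first-multiple c φ c₁ ℕ.≤-refl)
      (trans (∑-cong (M ℕ.* c) (λ i _ → cong (_* φ (c ℕ.+ i)) (𝟙-cong (c ℕ.∣? (c ℕ.+ i)) (c ℕ.∣? i) (λ d → ℕ.∣m+n∣m⇒∣n d ℕ.∣-refl) (ℕ.∣m∣n⇒∣m+n ℕ.∣-refl))))
        (∑-multiples c M (λ i → φ (c ℕ.+ i)))))

  ∑-multiples-≤ : ∀ c .{{_ : NonZero c}} X (φ : ℕ → ℤ) → ∑ (suc X) (λ d → 𝟙 (c ℕ.∣? d) * φ d) ≡ ∑ (suc (X / c)) (λ e → φ (e ℕ.* c))
  ∑-multiples-≤ c X φ = begin
    ∑ (suc X) Φ
      ≡⟨ cong (λ z → ∑ z Φ) (trans (cong suc (trans (m≡m%n+[m/n]*n X c) (ℕ.+-comm (X % c) _))) (sym (ℕ.+-suc (M ℕ.* c) (X % c)))) ⟩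
    ∑ (M ℕ.* c ℕ.+ suc (X % c)) Φ
      ≡⟨ ∑-split (M ℕ.* c) (suc (X % c)) Φ ⟩
    ∑ (M ℕ.* c) Φ + ∑ (suc (X % c)) (λ j → Φ (M ℕ.* c ℕ.+ j))
      ≡⟨ cong₂ _+_ (∑-multiples c M φ) (trans (∑-cong (suc (X % c)) shift) (trans (first-multiple c (λ j → φ (M ℕ.* c ℕ.+ j)) (X % c) (m%n<n X c)) (cong φ (ℕ.+-identityʳ (M ℕ.* c))))) ⟩
    ∑ M (λ e → φ (e ℕ.* c)) + φ (M ℕ.* c)
      ≡⟨ ∑-snoc M (λ e → φ (e ℕ.* c)) ⟨
    ∑ (suc M) (λ e → φ (e ℕ.* c)) ∎
    where
    open ≡-Reasoning
    M = X / c
    Φ : ℕ → ℤ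
    Φ d = 𝟙 (c ℕ.∣? d) * φ d
    shift : ∀ j → j ℕ.< suc (X % c) → Φ (M ℕ.* c ℕ.+ j) ≡ 𝟙 (c ℕ.∣? j) * φ (M ℕ.* c ℕ.+ j)
    shift j _ = cong (_* φ (M ℕ.* c ℕ.+ j)) (𝟙-cong (c ℕ.∣? (M ℕ.* c ℕ.+ j)) (c ℕ.∣? j)
      (λ d → ℕ.∣m+n∣m⇒∣n d (ℕ.n∣m*n M)) (ℕ.∣m∣n⇒∣m+n (ℕ.n∣m*n M)))

  ∑-extend : ∀ M k φ → (∀ i → φ (M ℕ.+ i) ≡ 0ℤ) → ∑ (M ℕ.+ k) φ ≡ ∑ M φ
  ∑-extend M k φ h = trans (∑-split M k φ) (trans (cong (λ z → ∑ M φ + z) (∑-0 k (λ i _ → h i))) (ℤ.+-identityʳ (∑ M φ)))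

  ∑-trunc : ∀ M k φ → ∑ (M ℕ.+ k) (λ e → 𝟙 (e ℕ.<? M) * φ e) ≡ ∑ M φ
  ∑-trunc M k φ = trans (∑-extend M k (λ e → 𝟙 (e ℕ.<? M) * φ e)
      (λ i → trans (cong (_* φ (M ℕ.+ i)) (𝟙-no (M ℕ.+ i ℕ.<? M) (ℕ.m+n≮m M i))) (ℤ.*-zeroˡ (φ (M ℕ.+ i)))))
    (∑-cong M (λ e e<M → trans (cong (_* φ e) (𝟙-yes (e ℕ.<? M) e<M)) (ℤ.*-identityˡ (φ e))))

  -- For the hyperbola method: the indices i with e ≤ X / (Y + i + 1) form an initial segment, over
  -- which sums of a character stay bounded.
  ∑-initial : ∀ L {B : ℕ → Set} (b : ∀ i → Dec (B i)) φ → (∀ i → B (suc i) → B i) →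
    Σ ℕ λ L′ → ∑ L (λ i → 𝟙 (b i) * φ i) ≡ ∑ L′ φ
  ∑-initial zero b φ down = 0 , refl
  ∑-initial (suc L) {B} b φ down with b L
  ... | yes bL = suc L , ∑-cong (suc L) (λ i i<1+L → trans (cong (_* φ i) (𝟙-yes (b i) (below i (ℕ.≤-pred i<1+L)))) (ℤ.*-identityˡ (φ i)))
    where
    go : ∀ k i → B (k ℕ.+ i) → B i
    go zero    i x = x
    go (suc k) i x = go k i (down (k ℕ.+ i) x)
    below : ∀ i → i ℕ.≤ L → B i
    below i i≤L = go (L ℕ.∸ i) i (subst B (sym (ℕ.m∸n+n≡m i≤L)) bL)
  ... | no ¬bL with ∑-initial L b φ down
  ... | L′ , e = L′ , trans (∑-snoc L (λ i → 𝟙 (b i) * φ i)) (trans (cong₂ _+_ e (trans (cong (_* φ L) (𝟙-no (b L) ¬bL)) (ℤ.*-zeroˡ (φ L)))) (ℤ.+-identityʳ (∑ L′ φ)))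

  ∑ⁿ-mono : ∀ φ {m n} → m ℕ.≤ n → ∑ⁿ m φ ℕ.≤ ∑ⁿ n φ
  ∑ⁿ-mono φ {m} {n} m≤n = subst (λ z → ∑ⁿ m φ ℕ.≤ ∑ⁿ z φ) (ℕ.m+[n∸m]≡n m≤n)
    (ℕ.≤-trans (ℕ.m≤m+n _ _) (ℕ.≤-reflexive (sym (∑ⁿ-split m (n ℕ.∸ m) φ))))

  ∑ⁿ-points : ∀ φ Y b L (x : ℕ → ℕ) → (∀ i → x i ℕ.< x (suc i)) → (∀ i → i ℕ.< L → x i ℕ.< Y × b ℕ.≤ φ (x i)) → L ℕ.* b ℕ.≤ ∑ⁿ Y φ
  ∑ⁿ-points φ Y b zero x inc h = z≤n
  ∑ⁿ-points φ Y b (suc L) x inc h = begin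
    b ℕ.+ L ℕ.* b              ≡⟨ ℕ.+-comm b _ ⟩
    L ℕ.* b ℕ.+ b              ≤⟨ ℕ.+-mono-≤ (∑ⁿ-points φ (x L) b L x inc (λ i i<L → mono i<L , proj₂ (h i (ℕ.m≤n⇒m≤1+n i<L)))) (proj₂ (h L ℕ.≤-refl)) ⟩
    ∑ⁿ (x L) φ ℕ.+ φ (x L)     ≡⟨ ∑ⁿ-snoc (x L) φ ⟨
    ∑ⁿ (suc (x L)) φ           ≤⟨ ∑ⁿ-mono φ (proj₁ (h L ℕ.≤-refl)) ⟩
    ∑ⁿ Y φ ∎
    where
    open ℕ.≤-Reasoning
    mono : ∀ {i j} → i ℕ.< j → x i ℕ.< x j
    mono {i} {suc j} (s≤s i≤j) with ℕ.m≤n⇒m<n∨m≡n i≤j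
    ... | inj₁ i<j = ℕ.<-trans (mono i<j) (inc j)
    ... | inj₂ refl = inc j

  -- Cutting at squares puts the numbers u² + c w² with different u into different blocks, so
  -- nothing is counted twice as long as c w² ≤ 2u.
  ∑ⁿ-squares : ∀ Y φ → ∑ⁿ (Y ℕ.* Y) φ ≡ ∑ⁿ Y (λ u → ∑ⁿ (suc (u ℕ.+ u)) (λ v → φ (u ℕ.* u ℕ.+ v)))
  ∑ⁿ-squares zero φ = refl
  ∑ⁿ-squares (suc Y) φ = begin
    ∑ⁿ (suc Y ℕ.* suc Y) φ                      ≡⟨ cong (λ z → ∑ⁿ z φ) (l Y) ⟩
    ∑ⁿ (Y ℕ.* Y ℕ.+ suc (Y ℕ.+ Y)) φ            ≡⟨ ∑ⁿ-split (Y ℕ.* Y) (suc (Y ℕ.+ Y)) φ ⟩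
    ∑ⁿ (Y ℕ.* Y) φ ℕ.+ B Y                      ≡⟨ cong (ℕ._+ B Y) (∑ⁿ-squares Y φ) ⟩
    ∑ⁿ Y B ℕ.+ B Y                              ≡⟨ ∑ⁿ-snoc Y B ⟨
    ∑ⁿ (suc Y) B ∎
    where
    open ≡-Reasoning
    B : ℕ → ℕ
    B u = ∑ⁿ (suc (u ℕ.+ u)) (λ v → φ (u ℕ.* u ℕ.+ v))
    l : ∀ Y → suc Y ℕ.* suc Y ≡ Y ℕ.* Y ℕ.+ suc (Y ℕ.+ Y)
    l = ℕR.solve-∀

  ∑-∣∣ : ∀ n φ → (∀ i → i ℕ.< n → φ i ≡ + ∣ φ i ∣) → ∑ n φ ≡ + ∑ⁿ n (λ i → ∣ φ i ∣)
  ∑-∣∣ zero φ h = refl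
  ∑-∣∣ (suc n) φ h = trans (cong₂ _+_ (h 0 (s≤s z≤n)) (∑-∣∣ n (λ i → φ (suc i)) (λ i i<n → h (suc i) (s≤s i<n)))) (sym (ℤ.pos-+ ∣ φ 0 ∣ _))

-- Real characters and their convolution.

module Characters where

  open Congruences
  open Counting
  open JacobiSymbol using (Sign; pos; neg; Sign-square)
  open Nonresidues using (prime-divisor; split-power)
  open import Data.Integer using (_^_)

  -- A real nonprincipal character: P is a period and D decides where it vanishes. Separate
  -- parameters let two characters of different conductors share the same P and D. The vanishing
  -- mean is the form in which nontriviality enters the estimates.
  record Character (P D : ℕ) (f : ℕ → ℤ) : Set where
    field
      periodic       : ∀ n → f (P ℕ.+ n) ≡ f n
      multiplicative : ∀ m n → f (m ℕ.* n) ≡ f m * f n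
      unit           : ∀ {n} → Coprime D n → Sign (f n)
      nonunit        : ∀ {n} → ¬ Coprime D n → f n ≡ 0ℤ
      mean-zero      : ∑ P f ≡ 0ℤ

  ∣Sign∣ : ∀ {s} → Sign s → ∣ s ∣ ≡ 1
  ∣Sign∣ pos = refl
  ∣Sign∣ neg = refl

  module CharacterProperties {P D : ℕ} {f : ℕ → ℤ} .{{_ : NonZero P}} (D≢1 : D ≢ 1) (char : Character P D f) where
    open Character char

    f-0 : f 0 ≡ 0ℤ
    f-0 = nonunit λ c → D≢1 (Coprimality.0-coprimeTo-m⇒m≡1 (Coprimality.sym c))

    f-1 : f 1 ≡ 1ℤ
    f-1 = trans (multiplicative 1 1) (Sign-square (unit (Coprimality.sym (Coprimality.1-coprimeTo D))))

    f-^ : ∀ p k → f (p ℕ.^ k) ≡ f p ^ k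
    f-^ p zero    = f-1
    f-^ p (suc k) = trans (multiplicative p (p ℕ.^ k)) (cong (f p *_) (f-^ p k))

    ∣f∣≤1 : ∀ n → ∣ f n ∣ ℕ.≤ 1
    ∣f∣≤1 n with coprime? D n
    ... | yes c = ℕ.≤-reflexive (∣Sign∣ (unit c))
    ... | no ¬c = subst (λ z → ∣ z ∣ ℕ.≤ 1) (sym (nonunit ¬c)) z≤n

    periods : ∀ k n → f (k ℕ.* P ℕ.+ n) ≡ f n
    periods zero    n = refl
    periods (suc k) n = trans (cong f (ℕ.+-assoc P (k ℕ.* P) n)) (trans (periodic (k ℕ.* P ℕ.+ n)) (periods k n))

    ∑-periods : ∀ k → ∑ (k ℕ.* P) f ≡ 0ℤ
    ∑-periods zero    = refl
    ∑-periods (suc k) = trans (∑-split P (k ℕ.* P) f) (trans (cong₂ _+_ mean-zero (trans (∑-cong (k ℕ.* P) (λ i _ → periodic i)) (∑-periods k))) refl)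

    ∣∑f∣≤P : ∀ M → ∣ ∑ M f ∣ ℕ.≤ P
    ∣∑f∣≤P M = subst (λ z → ∣ z ∣ ℕ.≤ P) (sym eq)
      (ℕ.≤-trans (∣∑∣≤ (M % P) 1 (λ i _ → ∣f∣≤1 i)) (ℕ.≤-trans (ℕ.≤-reflexive (ℕ.*-identityʳ (M % P))) (ℕ.<⇒≤ (m%n<n M P))))
      where
      k = M / P
      eq : ∑ M f ≡ ∑ (M % P) f
      eq = trans (cong (λ z → ∑ z f) (trans (m≡m%n+[m/n]*n M P) (ℕ.+-comm (M % P) _)))
        (trans (∑-split (k ℕ.* P) (M % P) f)
          (trans (cong₂ _+_ (∑-periods k) (∑-cong (M % P) (λ i _ → periods k i))) (ℤ.+-identityˡ (∑ (M % P) f))))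

    ∣∑f-interval∣≤2P : ∀ a L → ∣ ∑ L (λ i → f (a ℕ.+ i)) ∣ ℕ.≤ P ℕ.+ P
    ∣∑f-interval∣≤2P a L = subst (λ z → ∣ z ∣ ℕ.≤ P ℕ.+ P) (sym eq)
      (ℕ.≤-trans (ℤ.∣i-j∣≤∣i∣+∣j∣ (∑ (a ℕ.+ L) f) (∑ a f)) (ℕ.+-mono-≤ (∣∑f∣≤P (a ℕ.+ L)) (∣∑f∣≤P a)))
      where
      l : ∀ x y → y ≡ x + y - x
      l = solve-∀
      eq : ∑ L (λ i → f (a ℕ.+ i)) ≡ ∑ (a ℕ.+ L) f - ∑ a f
      eq = trans (l (∑ a f) _) (cong (λ z → z - ∑ a f) (sym (∑-split a L f)))

  geometric : ℤ → ℕ → ℤ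
  geometric x zero    = 1ℤ
  geometric x (suc k) = geometric x k + x ^ suc k

  -- With a = f p and b = g p this is (f ⋆ g)(p^k), the sum of a^i b^(k - i), since b² = 1. It can
  -- be negative only when a = b = -1.
  coefficient : ∀ {a b} → Sign a → Sign b → a ≡ 1ℤ ⊎ b ≡ 1ℤ → ∀ k →
    Σ ℕ λ c → b ^ k * geometric (a * b) k ≡ + c × (a ≡ 1ℤ → b ≡ 1ℤ → 1 ℕ.≤ c)
  coefficient pos pos _ k = suc k , trans (cong₂ _*_ (ℤ.^-zeroˡ k) (ones k)) (ℤ.*-identityˡ (+ suc k)) , λ _ _ → s≤s z≤n
    where
    ones : ∀ k → geometric 1ℤ k ≡ + suc k
    ones zero    = refl
    ones (suc k) = trans (cong₂ _+_ (ones k) (ℤ.^-zeroˡ (suc k))) (cong +_ (ℕ.+-comm (suc k) 1))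
  coefficient {a} {b} pa pb h k = mixed pa pb h (alternating k)
    where
    alternating : ∀ k → (-1ℤ ^ k ≡ 1ℤ × geometric -1ℤ k ≡ 1ℤ) ⊎ (-1ℤ ^ k ≡ -1ℤ × geometric -1ℤ k ≡ 0ℤ)
    alternating zero = inj₁ (refl , refl)
    alternating (suc k) with alternating k
    ... | inj₁ (e , e′) = inj₂ (cong (-1ℤ *_) e , cong₂ (λ x y → x + -1ℤ * y) e′ e)
    ... | inj₂ (e , e′) = inj₁ (cong (-1ℤ *_) e , cong₂ (λ x y → x + -1ℤ * y) e′ e)
    mixed : ∀ {a b} → Sign a → Sign b → a ≡ 1ℤ ⊎ b ≡ 1ℤ →
      (-1ℤ ^ k ≡ 1ℤ × geometric -1ℤ k ≡ 1ℤ) ⊎ (-1ℤ ^ k ≡ -1ℤ × geometric -1ℤ k ≡ 0ℤ) →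
      Σ ℕ λ c → b ^ k * geometric (a * b) k ≡ + c × (a ≡ 1ℤ → b ≡ 1ℤ → 1 ℕ.≤ c)
    mixed pos pos h _ = coefficient pos pos h k
    mixed pos neg _ (inj₁ (e , e′)) = 1 , cong₂ _*_ e e′ , λ _ ()
    mixed pos neg _ (inj₂ (e , e′)) = 0 , cong₂ _*_ e e′ , λ _ ()
    mixed neg pos _ (inj₁ (e , e′)) = 1 , cong₂ _*_ (ℤ.^-zeroˡ k) e′ , λ ()
    mixed neg pos _ (inj₂ (e , e′)) = 0 , cong₂ _*_ (ℤ.^-zeroˡ k) e′ , λ ()
    mixed neg neg (inj₁ ()) _
    mixed neg neg (inj₂ ()) _

  module Convolution {P D : ℕ} {f g : ℕ → ℤ} .{{_ : NonZero P}} (D≢1 : D ≢ 1) (cf : Character P D f) (cg : Character P D g) where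
    private
      module f = CharacterProperties D≢1 cf
      module g = CharacterProperties D≢1 cg
      module Chf = Character cf
      module Chg = Character cg

    ψ : ℕ → ℤ
    ψ d = f d * g d

    ψ-* : ∀ m n → ψ (m ℕ.* n) ≡ ψ m * ψ n
    ψ-* m n = trans (cong₂ _*_ (Chf.multiplicative m n) (Chg.multiplicative m n)) (l (f m) (f n) (g m) (g n))
      where
      l : ∀ a b c d → a * b * (c * d) ≡ (a * c) * (b * d)
      l = solve-∀

    ψ-^ : ∀ p k → ψ (p ℕ.^ k) ≡ ψ p ^ k
    ψ-^ p zero    = cong₂ _*_ f.f-1 g.f-1
    ψ-^ p (suc k) = trans (ψ-* p (p ℕ.^ k)) (cong (ψ p *_) (ψ-^ p k))

    -- The divisor sum 1 ⋆ ψ. One cut-off N common to all n is what allows double sums to be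
    -- interchanged.
    A : ℕ → ℕ → ℤ
    A N n = ∑ N (λ d → 𝟙 (d ℕ.∣? n) * ψ d)

    A-range : ∀ {N n} → n ≢ 0 → n ℕ.< N → A N n ≡ A (suc n) n
    A-range {N} {n} n≢0 n<N = subst (λ z → A z n ≡ A (suc n) n) (ℕ.m+[n∸m]≡n n<N)
      (∑-extend (suc n) (N ℕ.∸ suc n) (λ d → 𝟙 (d ℕ.∣? n) * ψ d)
        (λ i → trans (cong (_* ψ (suc n ℕ.+ i)) (𝟙-no (suc n ℕ.+ i ℕ.∣? n)
          (λ d → ℕ.<⇒≱ (s≤s (ℕ.m≤m+n n i)) (ℕ.∣⇒≤ {{ℕ.≢-nonZero n≢0}} d)))) (ℤ.*-zeroˡ (ψ (suc n ℕ.+ i)))))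

    -- A divisor of p^(k+1) m that does not already divide p^k m contains the full power p^(k+1).
    divisor-split : ∀ {p} → Prime p → ∀ k {m} → m ≢ 0 → ¬ p ℕ.∣ m → ∀ d →
      𝟙 (d ℕ.∣? (p ℕ.^ suc k ℕ.* m)) ≡ 𝟙 (d ℕ.∣? (p ℕ.^ k ℕ.* m)) + 𝟙 (p ℕ.^ suc k ℕ.∣? d) * 𝟙 (d ℕ.∣? (p ℕ.^ suc k ℕ.* m))
    divisor-split {p} pr k {m} m≢0 p∤m d = go (p ℕ.^ suc k ℕ.∣? d)
      where
      instance _ = prime⇒nonZero pr
      c = p ℕ.^ suc k
      cm = 𝟙 (d ℕ.∣? (c ℕ.* m))
      go : (x : Dec (c ℕ.∣ d)) → cm ≡ 𝟙 (d ℕ.∣? (p ℕ.^ k ℕ.* m)) + 𝟙 x * cm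
      go (yes c∣d) = trans (l cm) (cong (λ z → z + 1ℤ * cm) (sym (𝟙-no (d ℕ.∣? (p ℕ.^ k ℕ.* m))
        (λ d∣ → p∤m (ℕ.*-cancelˡ-∣ (p ℕ.^ k) {{ℕ.m^n≢0 p k}} (subst (ℕ._∣ p ℕ.^ k ℕ.* m) (ℕ.*-comm p (p ℕ.^ k)) (ℕ.∣-trans c∣d d∣)))))))
        where
        l : ∀ x → x ≡ 0ℤ + 1ℤ * x
        l = solve-∀
      go (no c∤d) = trans (𝟙-cong (d ℕ.∣? (c ℕ.* m)) (d ℕ.∣? (p ℕ.^ k ℕ.* m)) down up) (l (𝟙 (d ℕ.∣? (p ℕ.^ k ℕ.* m))) cm)
        where
        l : ∀ x y → x ≡ x + 0ℤ * y
        l = solve-∀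
        up : d ℕ.∣ p ℕ.^ k ℕ.* m → d ℕ.∣ c ℕ.* m
        up d∣ = subst (d ℕ.∣_) (sym (ℕ.*-assoc p (p ℕ.^ k) m)) (ℕ.∣n⇒∣m*n p d∣)
        d≢0 : d ≢ 0
        d≢0 refl = c∤d (c ℕ.∣0)
        down : d ℕ.∣ c ℕ.* m → d ℕ.∣ p ℕ.^ k ℕ.* m
        down d∣ with split-power pr d d≢0
        ... | j , d′ , refl , p∤d′ = ℕ.*-pres-∣ (power j≤k) d′∣m
          where
          power : ∀ {i j} → i ℕ.≤ j → p ℕ.^ i ℕ.∣ p ℕ.^ j
          power {i} {j} i≤j = ℕ.divides (p ℕ.^ (j ℕ.∸ i)) (trans (cong (p ℕ.^_) (sym (ℕ.m∸n+n≡m i≤j))) (ℕ.^-distribˡ-+-* p (j ℕ.∸ i) i))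
          j≤k : j ℕ.≤ k
          j≤k = ℕ.≮⇒≥ λ k<j → c∤d (ℕ.∣m⇒∣m*n d′ (power k<j))
          d′∣m : d′ ℕ.∣ m
          d′∣m = coprime-divisor (coprime-^ʳ (suc k) (Coprimality.sym (prime∤⇒coprime pr p∤d′))) (ℕ.∣-trans (ℕ.n∣m*n (p ℕ.^ j)) d∣)

    A-step : ∀ {p} → Prime p → ∀ k {m} → m ≢ 0 → ¬ p ℕ.∣ m →
      A (suc (p ℕ.^ suc k ℕ.* m)) (p ℕ.^ suc k ℕ.* m) ≡ A (suc (p ℕ.^ k ℕ.* m)) (p ℕ.^ k ℕ.* m) + ψ p ^ suc k * A (suc m) m
    A-step {p} pr k {m} m≢0 p∤m = begin
      A (suc (c ℕ.* m)) (c ℕ.* m)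
        ≡⟨ A-range cm≢0 cm<N ⟨
      A N (c ℕ.* m)
        ≡⟨ ∑-cong N (λ d _ → trans (cong (_* ψ d) (divisor-split pr k m≢0 p∤m d)) (l (𝟙 (d ℕ.∣? (p ℕ.^ k ℕ.* m))) (𝟙 (c ℕ.∣? d)) (𝟙 (d ℕ.∣? (c ℕ.* m))) (ψ d))) ⟩
      ∑ N (λ d → 𝟙 (d ℕ.∣? (p ℕ.^ k ℕ.* m)) * ψ d + 𝟙 (c ℕ.∣? d) * (𝟙 (d ℕ.∣? (c ℕ.* m)) * ψ d))
        ≡⟨ ∑-+ N (λ d → 𝟙 (d ℕ.∣? (p ℕ.^ k ℕ.* m)) * ψ d) (λ d → 𝟙 (c ℕ.∣? d) * (𝟙 (d ℕ.∣? (c ℕ.* m)) * ψ d)) ⟩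
      A N (p ℕ.^ k ℕ.* m) + ∑ N (λ d → 𝟙 (c ℕ.∣? d) * (𝟙 (d ℕ.∣? (c ℕ.* m)) * ψ d))
        ≡⟨ cong₂ _+_ (A-range pm≢0 pm<N) (∑-multiples c (suc m) (λ d → 𝟙 (d ℕ.∣? (c ℕ.* m)) * ψ d)) ⟩
      A (suc (p ℕ.^ k ℕ.* m)) (p ℕ.^ k ℕ.* m) + ∑ (suc m) (λ e → 𝟙 ((e ℕ.* c) ℕ.∣? (c ℕ.* m)) * ψ (e ℕ.* c))
        ≡⟨ cong (λ z → A (suc (p ℕ.^ k ℕ.* m)) (p ℕ.^ k ℕ.* m) + z) (trans (∑-cong (suc m) (λ e _ → term e)) (∑-*ˡ (suc m) (ψ p ^ suc k) (λ e → 𝟙 (e ℕ.∣? m) * ψ e))) ⟩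
      A (suc (p ℕ.^ k ℕ.* m)) (p ℕ.^ k ℕ.* m) + ψ p ^ suc k * A (suc m) m ∎
      where
      open ≡-Reasoning
      instance
        nzp : NonZero p
        nzp = prime⇒nonZero pr
      c = p ℕ.^ suc k
      instance
        nzc : NonZero c
        nzc = ℕ.m^n≢0 p (suc k)
      N = suc m ℕ.* c
      l : ∀ a b x y → (a + b * x) * y ≡ a * y + b * (x * y)
      l = solve-∀
      cm≢0 : c ℕ.* m ≢ 0
      cm≢0 e = ℕ.≢-nonZero⁻¹ (c ℕ.* m) {{ℕ.m*n≢0 c m {{nzc}} {{ℕ.≢-nonZero m≢0}}}} e
      pm≢0 : p ℕ.^ k ℕ.* m ≢ 0
      pm≢0 e = ℕ.≢-nonZero⁻¹ (p ℕ.^ k ℕ.* m) {{ℕ.m*n≢0 (p ℕ.^ k) m {{ℕ.m^n≢0 p k}} {{ℕ.≢-nonZero m≢0}}}} e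
      cm<N : c ℕ.* m ℕ.< N
      cm<N = ℕ.<-≤-trans (ℕ.m<n+m (c ℕ.* m) (ℕ.>-nonZero⁻¹ c)) (ℕ.≤-reflexive (cong (c ℕ.+_) (ℕ.*-comm c m)))
      pm<N : p ℕ.^ k ℕ.* m ℕ.< N
      pm<N = ℕ.≤-<-trans (ℕ.*-monoˡ-≤ m (ℕ.m≤n*m (p ℕ.^ k) p)) cm<N
      term : ∀ e → 𝟙 ((e ℕ.* c) ℕ.∣? (c ℕ.* m)) * ψ (e ℕ.* c) ≡ ψ p ^ suc k * (𝟙 (e ℕ.∣? m) * ψ e)
      term e = trans (cong₂ _*_ (𝟙-cong ((e ℕ.* c) ℕ.∣? (c ℕ.* m)) (e ℕ.∣? m)
            (λ d → ℕ.*-cancelˡ-∣ c (subst (ℕ._∣ c ℕ.* m) (ℕ.*-comm e c) d)) (λ d → subst (ℕ._∣ c ℕ.* m) (ℕ.*-comm c e) (ℕ.*-monoʳ-∣ c d)))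
          (trans (ψ-* e c) (cong (ψ e *_) (ψ-^ p (suc k)))))
        (l′ (𝟙 (e ℕ.∣? m)) (ψ e) (ψ p ^ suc k))
        where
        l′ : ∀ a b x → a * (b * x) ≡ x * (a * b)
        l′ = solve-∀

    A-power : ∀ {p} → Prime p → ∀ k {m} → m ≢ 0 → ¬ p ℕ.∣ m →
      A (suc (p ℕ.^ k ℕ.* m)) (p ℕ.^ k ℕ.* m) ≡ geometric (ψ p) k * A (suc m) m
    A-power pr zero {m} m≢0 p∤m = trans (cong (λ z → A (suc z) z) (ℕ.*-identityˡ m)) (sym (ℤ.*-identityˡ (A (suc m) m)))
    A-power {p} pr (suc k) {m} m≢0 p∤m = trans (A-step pr k m≢0 p∤m)
      (trans (cong (λ z → z + ψ p ^ suc k * A (suc m) m) (A-power pr k m≢0 p∤m)) (sym (ℤ.*-distribʳ-+ (A (suc m) m) (geometric (ψ p) k) (ψ p ^ suc k))))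

    -- The convolution f ⋆ g, as g · (1 ⋆ ψ).
    F : ℕ → ℤ
    F n = g n * A (suc n) n

    F-power : ∀ {p} → Prime p → ∀ k {m} → m ≢ 0 → ¬ p ℕ.∣ m → F (p ℕ.^ k ℕ.* m) ≡ (g p ^ k * geometric (ψ p) k) * F m
    F-power {p} pr k {m} m≢0 p∤m = trans (cong₂ _*_ (trans (Chg.multiplicative (p ℕ.^ k) m) (cong (_* g m) (g.f-^ p k))) (A-power pr k m≢0 p∤m))
      (l (g p ^ k) (g m) (geometric (ψ p) k) (A (suc m) m))
      where
      l : ∀ a b c d → a * b * (c * d) ≡ a * c * (b * d)
      l = solve-∀

    Good : ℕ → Set
    Good n = ∀ {p} → Prime p → p ℕ.∣ n → f p ≡ 1ℤ × g p ≡ 1ℤ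

    -- F is the product of its values at prime powers, each of which is nonnegative when no prime
    -- has both values -1, and positive where both values are 1.
    F-nonneg : ∀ {X} → (∀ {p} → Prime p → p ℕ.≤ X → Coprime D p → f p ≡ 1ℤ ⊎ g p ≡ 1ℤ) →
      ∀ n → n ≢ 0 → n ℕ.≤ X → Coprime D n → Σ ℕ λ v → F n ≡ + v × (Good n → 1 ℕ.≤ v)
    F-nonneg {X} H = <-rec Goal go
      where
      Goal : ℕ → Set
      Goal n = n ≢ 0 → n ℕ.≤ X → Coprime D n → Σ ℕ λ v → F n ≡ + v × (Good n → 1 ℕ.≤ v)
      go : ∀ n → (∀ {m} → m ℕ.< n → Goal m) → Goal n
      go n rec n≢0 n≤X c with n ℕ.≟ 1
      ... | yes refl = 1 , F1 , λ _ → s≤s z≤n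
        where
        F1 : F 1 ≡ + 1
        F1 = trans (cong₂ (λ x y → x * (0ℤ * ψ 0 + (1ℤ * y + 0ℤ))) g.f-1 (cong₂ _*_ f.f-1 g.f-1)) (cong (λ z → 1ℤ * (z + 1ℤ)) (ℤ.*-zeroˡ (ψ 0)))
      ... | no n≢1 with prime-divisor n n≢0 n≢1
      ... | p , pr , p∣n with split-power pr n n≢0
      ... | k , m , refl , p∤m = combine (rec m<n m≢0 (ℕ.≤-trans (ℕ.<⇒≤ m<n) n≤X) (coprime-dvdʳ (ℕ.n∣m*n (p ℕ.^ k)) c))
          (coefficient (Chf.unit cp) (Chg.unit cp) (H pr (ℕ.≤-trans (ℕ.∣⇒≤ {{ℕ.≢-nonZero n≢0}} p∣n) n≤X) cp) k)
        where
        cp : Coprime D p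
        cp = coprime-dvdʳ p∣n c
        m≢0 : m ≢ 0
        m≢0 refl = p∤m (p ℕ.∣0)
        m<n : m ℕ.< p ℕ.^ k ℕ.* m
        m<n = ℕ.≤∧≢⇒< (ℕ.m≤n*m m (p ℕ.^ k) {{ℕ.m^n≢0 p k {{prime⇒nonZero pr}}}}) (λ e → p∤m (subst (p ℕ.∣_) (sym e) p∣n))
        combine : (Σ ℕ λ v → F m ≡ + v × (Good m → 1 ℕ.≤ v)) →
          (Σ ℕ λ a → g p ^ k * geometric (ψ p) k ≡ + a × (f p ≡ 1ℤ → g p ≡ 1ℤ → 1 ℕ.≤ a)) →
          Σ ℕ λ v → F (p ℕ.^ k ℕ.* m) ≡ + v × (Good (p ℕ.^ k ℕ.* m) → 1 ℕ.≤ v)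
        combine (v , e , good) (a , e′ , good′) = a ℕ.* v , trans (F-power pr k m≢0 p∤m) (trans (cong₂ _*_ e′ e) (sym (ℤ.pos-* a v))) ,
          λ G → ℕ.*-mono-≤ (good′ (proj₁ (G pr p∣n)) (proj₂ (G pr p∣n))) (good (λ pr′ d → G pr′ (ℕ.∣n⇒∣m*n (p ℕ.^ k) d)))

-- A prime at which two characters both take the value -1.

module CharacterClash where

  open Congruences
  open Counting
  open Characters
  open JacobiSymbol using (Sign; pos; neg; Sign-square)
  open import Data.Integer using (_^_)

  module ConvolutionBound {P D : ℕ} {f g : ℕ → ℤ} .{{_ : NonZero P}} (D≢1 : D ≢ 1) (cf : Character P D f) (cg : Character P D g) where
    open Convolution D≢1 cf cg
    private
      module f = CharacterProperties D≢1 cf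
      module g = CharacterProperties D≢1 cg
      module Chf = Character cf
      module Chg = Character cg

    -- On units g² = 1, and elsewhere both sides vanish because f and g share D. This recovers f ⋆ g
    -- from the form g · (1 ⋆ ψ).
    fgg : ∀ d → g d * ψ d ≡ f d
    fgg d with coprime? D d
    ... | yes c = trans (l (f d) (g d)) (trans (cong (f d *_) (Sign-square (Chg.unit c))) (ℤ.*-identityʳ (f d)))
      where
      l : ∀ a b → b * (a * b) ≡ a * (b * b)
      l = solve-∀
    ... | no ¬c = trans (cong (_* ψ d) (Chg.nonunit ¬c)) (trans (ℤ.*-zeroˡ (ψ d)) (sym (Chf.nonunit ¬c)))

    ∑F : ∀ X → ∑ (suc X) F ≡ ∑ X (λ i → f (suc i) * ∑ (suc (X / suc i)) g)
    ∑F X = begin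
      ∑ (suc X) F
        ≡⟨ ∑-cong (suc X) (λ n n≤X → trans (range n n≤X) (sym (∑-*ˡ (suc X) (g n) (λ d → 𝟙 (d ℕ.∣? n) * ψ d)))) ⟩
      ∑ (suc X) (λ n → ∑ (suc X) (λ d → g n * (𝟙 (d ℕ.∣? n) * ψ d)))
        ≡⟨ ∑-swap (suc X) (suc X) (λ n d → g n * (𝟙 (d ℕ.∣? n) * ψ d)) ⟩
      ∑ (suc X) (λ d → ∑ (suc X) (λ n → g n * (𝟙 (d ℕ.∣? n) * ψ d)))
        ≡⟨ cong₂ _+_ (∑-0 (suc X) (λ n _ → vanish n)) (∑-cong X (λ i _ → column i)) ⟩
      0ℤ + ∑ X (λ i → f (suc i) * ∑ (suc (X / suc i)) g)
        ≡⟨ ℤ.+-identityˡ _ ⟩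
      ∑ X (λ i → f (suc i) * ∑ (suc (X / suc i)) g) ∎
      where
      open ≡-Reasoning
      range : ∀ n → n ℕ.< suc X → F n ≡ g n * A (suc X) n
      range zero    _ = trans (cong (_* A 1 0) g.f-0) (trans (ℤ.*-zeroˡ (A 1 0)) (sym (trans (cong (_* A (suc X) 0) g.f-0) (ℤ.*-zeroˡ (A (suc X) 0)))))
      range (suc n) n<N = cong (g (suc n) *_) (sym (A-range {suc X} (λ ()) n<N))
      vanish : ∀ n → g n * (𝟙 (0 ℕ.∣? n) * ψ 0) ≡ 0ℤ
      vanish n = trans (cong (λ z → g n * (𝟙 (0 ℕ.∣? n) * (z * g 0))) f.f-0) (l (g n) (𝟙 (0 ℕ.∣? n)) (g 0))
        where
        l : ∀ a b c → a * (b * (0ℤ * c)) ≡ 0ℤ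
        l = solve-∀
      column : ∀ i → ∑ (suc X) (λ n → g n * (𝟙 (suc i ℕ.∣? n) * ψ (suc i))) ≡ f (suc i) * ∑ (suc (X / suc i)) g
      column i = begin
        ∑ (suc X) (λ n → g n * (𝟙 (d ℕ.∣? n) * ψ d))
          ≡⟨ ∑-cong (suc X) (λ n _ → l (g n) (𝟙 (d ℕ.∣? n)) (ψ d)) ⟩
        ∑ (suc X) (λ n → 𝟙 (d ℕ.∣? n) * (g n * ψ d))
          ≡⟨ ∑-multiples-≤ d X (λ n → g n * ψ d) ⟩
        ∑ (suc (X / d)) (λ e → g (e ℕ.* d) * ψ d)
          ≡⟨ ∑-cong (suc (X / d)) (λ e _ → trans (cong (_* ψ d) (Chg.multiplicative e d)) (trans (l′ (g e) (g d) (ψ d)) (cong (_* g e) (fgg d)))) ⟩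
        ∑ (suc (X / d)) (λ e → f d * g e)
          ≡⟨ ∑-*ˡ (suc (X / d)) (f d) g ⟩
        f d * ∑ (suc (X / d)) g ∎
        where
        d = suc i
        l : ∀ a b c → a * (b * c) ≡ b * (a * c)
        l = solve-∀
        l′ : ∀ a b c → a * b * c ≡ b * c * a
        l′ = solve-∀

    ∣*∣≤ : ∀ {a b B} → ∣ a ∣ ℕ.≤ 1 → ∣ b ∣ ℕ.≤ B → ∣ a * b ∣ ℕ.≤ B
    ∣*∣≤ {a} {b} {B} ha hb = ℕ.≤-trans (ℕ.≤-reflexive (ℤ.∣i*j∣≡∣i∣*∣j∣ a b)) (ℕ.≤-trans (ℕ.*-mono-≤ ha hb) (ℕ.≤-reflexive (ℕ.*-identityˡ B)))

    -- Dirichlet's hyperbola method.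
    ∣∑F∣≤ : ∀ Y → ∣ ∑ (suc (Y ℕ.* Y)) F ∣ ℕ.≤ Y ℕ.* P ℕ.+ suc Y ℕ.* (P ℕ.+ P)
    ∣∑F∣≤ Y = subst (λ z → ∣ z ∣ ℕ.≤ Y ℕ.* P ℕ.+ suc Y ℕ.* (P ℕ.+ P)) (sym total)
      (ℕ.≤-trans (ℤ.∣i+j∣≤∣i∣+∣j∣ (∑ Y T) _) (ℕ.+-mono-≤ first (subst (λ z → ∣ z ∣ ℕ.≤ suc Y ℕ.* (P ℕ.+ P)) (sym second) (∣∑∣≤ (suc Y) {λ e → g e * ∑ L (λ i → 𝟙 (e ℕ.<? M i) * f (suc (Y ℕ.+ i)))} (P ℕ.+ P) (λ e _ → row e)))))
      where
      open ≡-Reasoning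
      X = Y ℕ.* Y
      L = X ℕ.∸ Y
      Y≤X : ∀ Y → Y ℕ.≤ Y ℕ.* Y
      Y≤X zero    = z≤n
      Y≤X (suc Y) = ℕ.m≤m+n (suc Y) _
      T : ℕ → ℤ
      T i = f (suc i) * ∑ (suc (X / suc i)) g
      total : ∑ (suc X) F ≡ ∑ Y T + ∑ L (λ i → T (Y ℕ.+ i))
      total = trans (∑F X) (trans (cong (λ z → ∑ z T) (sym (ℕ.m+[n∸m]≡n (Y≤X Y)))) (∑-split Y L T))
      first : ∣ ∑ Y T ∣ ℕ.≤ Y ℕ.* P
      first = ∣∑∣≤ Y P (λ i _ → ∣*∣≤ {f (suc i)} (f.∣f∣≤1 (suc i)) (g.∣∑f∣≤P (suc (X / suc i))))
      M : ℕ → ℕ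
      M i = suc (X / suc (Y ℕ.+ i))
      M≤ : ∀ i → M i ℕ.≤ suc Y
      M≤ i = m<n*o⇒m/o<n {X} {suc Y} {suc (Y ℕ.+ i)} (s≤s (ℕ.≤-trans (ℕ.*-monoʳ-≤ Y (ℕ.≤-trans (ℕ.m≤m+n Y i) (ℕ.n≤1+n (Y ℕ.+ i)))) (ℕ.m≤n+m (Y ℕ.* suc (Y ℕ.+ i)) (Y ℕ.+ i))))
      -- For divisors d > Y the cofactor e is at most Y. Exchanging the sums leaves, for each such
      -- e, a sum of f over an interval.
      second : ∑ L (λ i → T (Y ℕ.+ i)) ≡ ∑ (suc Y) (λ e → g e * ∑ L (λ i → 𝟙 (e ℕ.<? M i) * f (suc (Y ℕ.+ i))))
      second = begin
        ∑ L (λ i → T (Y ℕ.+ i))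
          ≡⟨ ∑-cong L (λ i _ → trans (cong (f (suc (Y ℕ.+ i)) *_) (sym (trans (cong (λ z → ∑ z (λ e → 𝟙 (e ℕ.<? M i) * g e)) (sym (ℕ.m+[n∸m]≡n (M≤ i)))) (∑-trunc (M i) (suc Y ℕ.∸ M i) g))))
                       (sym (∑-*ˡ (suc Y) (f (suc (Y ℕ.+ i))) (λ e → 𝟙 (e ℕ.<? M i) * g e)))) ⟩
        ∑ L (λ i → ∑ (suc Y) (λ e → f (suc (Y ℕ.+ i)) * (𝟙 (e ℕ.<? M i) * g e)))
          ≡⟨ ∑-swap L (suc Y) (λ i e → f (suc (Y ℕ.+ i)) * (𝟙 (e ℕ.<? M i) * g e)) ⟩
        ∑ (suc Y) (λ e → ∑ L (λ i → f (suc (Y ℕ.+ i)) * (𝟙 (e ℕ.<? M i) * g e)))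
          ≡⟨ ∑-cong (suc Y) (λ e _ → trans (∑-cong L (λ i _ → l (f (suc (Y ℕ.+ i))) (𝟙 (e ℕ.<? M i)) (g e))) (∑-*ˡ L (g e) (λ i → 𝟙 (e ℕ.<? M i) * f (suc (Y ℕ.+ i))))) ⟩
        ∑ (suc Y) (λ e → g e * ∑ L (λ i → 𝟙 (e ℕ.<? M i) * f (suc (Y ℕ.+ i)))) ∎
        where
        l : ∀ a b c → a * (b * c) ≡ c * (b * a)
        l = solve-∀
      row : ∀ e → ∣ g e * ∑ L (λ i → 𝟙 (e ℕ.<? M i) * f (suc (Y ℕ.+ i))) ∣ ℕ.≤ P ℕ.+ P
      row e = ∣*∣≤ {g e} (g.∣f∣≤1 e) (bound (∑-initial L (λ i → e ℕ.<? M i) (λ i → f (suc (Y ℕ.+ i)))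
          (λ i lt → ℕ.<-≤-trans lt (s≤s (/-monoʳ-≤ X (s≤s (ℕ.+-monoʳ-≤ Y (ℕ.n≤1+n i))))))))
        where
        bound : (Σ ℕ λ L′ → ∑ L (λ i → 𝟙 (e ℕ.<? M i) * f (suc (Y ℕ.+ i))) ≡ ∑ L′ (λ i → f (suc (Y ℕ.+ i)))) →
          ∣ ∑ L (λ i → 𝟙 (e ℕ.<? M i) * f (suc (Y ℕ.+ i))) ∣ ℕ.≤ P ℕ.+ P
        bound (L′ , eq) = subst (λ z → ∣ z ∣ ℕ.≤ P ℕ.+ P) (sym eq) (f.∣∑f-interval∣≤2P (suc Y) L′)

  module _ {P D : ℕ} {f g : ℕ → ℤ} .{{_ : NonZero P}} (D≢0 : D ≢ 0) (D≢1 : D ≢ 1) (cf : Character P D f) (cg : Character P D g)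
    (c : ℕ) (c≢0 : c ≢ 0)
    (link : ∀ {p u w} → Prime p → Coprime D p → p ℕ.∣ u ℕ.* u ℕ.+ c ℕ.* (w ℕ.* w) → ¬ p ℕ.∣ w → f p ≡ g p) where
    open Convolution D≢1 cf cg
    open ConvolutionBound D≢1 cf cg
    private
      module Chf = Character cf
      module Chg = Character cg
      instance
        nzD : NonZero D
        nzD = ℕ.≢-nonZero D≢0
        nzc : NonZero c
        nzc = ℕ.≢-nonZero c≢0
      1<D : 1 ℕ.< D
      1<D = ℕ.≤∧≢⇒< (ℕ.>-nonZero⁻¹ D) (λ e → D≢1 (sym e))

      -- With L values of u and J of w there are L J = 3P (Y + 1) + 1 points, one more than the
      -- bound 3P (Y + 1) on the summatory function at Y². `U` dominates every c w², which keeps u²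
      -- + c w² below (u + 1)².
      J = suc (3 ℕ.* P ℕ.* D)
      U = c ℕ.* (D ℕ.^ J ℕ.* D ℕ.^ J)
      L = suc (3 ℕ.* P ℕ.* (2 ℕ.+ D ℕ.* U))
      Y = suc (D ℕ.* (U ℕ.+ L))
      X = Y ℕ.* Y

      -1-prime : Set
      -1-prime = Σ ℕ λ p → Prime p × Coprime D p × f p ≡ -1ℤ × g p ≡ -1ℤ

      NoClash : ℕ → Set
      NoClash X = ∀ {p} → Prime p → p ℕ.≤ X → Coprime D p → f p ≡ 1ℤ ⊎ g p ≡ 1ℤ

      last : ∀ {p X} {A : Set} → p ℕ.≤ suc X → (p ℕ.≤ X → Coprime D p → A) → (p ≡ suc X → A) → Coprime D p → A
      last le small eq c with ℕ.m≤n⇒m<n∨m≡n le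
      ... | inj₁ (s≤s p≤X) = small p≤X c
      ... | inj₂ p≡ = eq p≡

      search : ∀ X → -1-prime ⊎ NoClash X
      search zero = inj₂ λ { pr z≤n _ → contradiction pr (λ ()) }
      search (suc X) with search X
      ... | inj₁ found = inj₁ found
      ... | inj₂ none with prime? (suc X) | coprime? D (suc X)
      ...   | no ¬pr | _ = inj₂ λ pr le c → last le (none pr) (λ { refl → contradiction pr ¬pr }) c
      ...   | yes _ | no ¬c = inj₂ λ pr le c → last le (none pr) (λ { refl → ⊥-elim (¬c c) }) c
      ...   | yes pr₀ | yes c₀ = decide (Chf.unit c₀) (Chg.unit c₀) refl refl
        where
        decide : ∀ {a b} → Sign a → Sign b → f (suc X) ≡ a → g (suc X) ≡ b → -1-prime ⊎ NoClash (suc X)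
        decide neg neg ef eg = inj₁ (suc X , pr₀ , c₀ , ef , eg)
        decide pos _   ef eg = inj₂ λ pr le c → last le (none pr) (λ { refl → inj₁ ef }) c
        decide neg pos ef eg = inj₂ λ pr le c → last le (none pr) (λ { refl → inj₂ eg }) c

      module Contradiction (H : NoClash X) where
        F≡∣F∣ : ∀ n → n ℕ.≤ X → F n ≡ + ∣ F n ∣
        F≡∣F∣ n n≤X with coprime? D n | n ℕ.≟ 0
        ... | yes co | no n≢0 = abs (F-nonneg H n n≢0 n≤X co)
          where
          abs : (Σ ℕ λ v → F n ≡ + v × (Good n → 1 ℕ.≤ v)) → F n ≡ + ∣ F n ∣
          abs (v , e , _) = trans e (cong (λ z → + ∣ z ∣) (sym e))
        ... | yes co | yes refl = contradiction (Coprimality.0-coprimeTo-m⇒m≡1 (Coprimality.sym co)) D≢1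
        ... | no ¬co | _ = trans z (cong (λ z → + ∣ z ∣) (sym z))
          where
          z : F n ≡ 0ℤ
          z = trans (cong (_* A (suc n) n) (Chg.nonunit ¬co)) (ℤ.*-zeroˡ (A (suc n) n))

        upper : ∑ⁿ (suc X) (λ n → ∣ F n ∣) ℕ.≤ Y ℕ.* P ℕ.+ suc Y ℕ.* (P ℕ.+ P)
        upper = ℕ.≤-trans (ℕ.≤-reflexive (cong ∣_∣ (sym (∑-∣∣ (suc X) F (λ n n≤X → F≡∣F∣ n (ℕ.≤-pred n≤X)))))) (∣∑F∣≤ Y)

        w : ℕ → ℕ
        w j = D ℕ.^ suc j

        -- Here u ≡ 1 modulo D and w is a positive power of D, so u² + c w² is coprime to D and its
        -- primes do not divide w. By `link` the two characters agree at those primes, and without a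
        -- clash the common value is 1.
        value-≥1 : ∀ i j → i ℕ.< L → j ℕ.< J → let u = suc (D ℕ.* (U ℕ.+ i)) in 1 ℕ.≤ ∣ F (u ℕ.* u ℕ.+ c ℕ.* (w j ℕ.* w j)) ∣
        value-≥1 i j i<L j<J = pos′ (F-nonneg H n (λ e → ℕ.1+n≢0 e) n≤X co)
          where
          u = suc (D ℕ.* (U ℕ.+ i))
          n = u ℕ.* u ℕ.+ c ℕ.* (w j ℕ.* w j)
          v≤u : c ℕ.* (w j ℕ.* w j) ℕ.≤ u
          v≤u = ℕ.≤-trans (ℕ.*-monoʳ-≤ c (ℕ.*-mono-≤ (ℕ.^-monoʳ-≤ D j<J) (ℕ.^-monoʳ-≤ D j<J)))
            (ℕ.≤-trans (ℕ.m≤m+n U i) (ℕ.≤-trans (ℕ.m≤n*m (U ℕ.+ i) D) (ℕ.n≤1+n _)))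
          u<Y : u ℕ.< Y
          u<Y = s≤s (ℕ.*-monoʳ-< D (ℕ.+-monoʳ-< U i<L))
          n≤X : n ℕ.≤ X
          n≤X = ℕ.≤-trans (ℕ.+-monoʳ-≤ (u ℕ.* u) (ℕ.≤-trans v≤u (ℕ.m≤n+m u (suc u))))
            (ℕ.≤-trans (ℕ.≤-reflexive (l u)) (ℕ.*-mono-≤ u<Y u<Y))
            where
            l : ∀ u → u ℕ.* u ℕ.+ (suc u ℕ.+ u) ≡ suc u ℕ.* suc u
            l = ℕR.solve-∀
          D∣w : D ℕ.∣ w j
          D∣w = ℕ.m∣m*n (D ℕ.^ j)
          u≋1 : + u ≋ 1ℤ [ D ]
          u≋1 = quot (+ (U ℕ.+ i)) (trans (ℤ.pos-+ 1 (D ℕ.* (U ℕ.+ i))) (cong (λ z → 1ℤ + z) (trans (cong +_ (ℕ.*-comm D (U ℕ.+ i))) (ℤ.pos-* (U ℕ.+ i) D))))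
          n≋1 : + n ≋ 1ℤ [ D ]
          n≋1 = ≋-trans (≋-reflexive (trans (ℤ.pos-+ (u ℕ.* u) _) (cong (λ z → z + + (c ℕ.* (w j ℕ.* w j))) (ℤ.pos-* u u))))
            (≋-+ (≋-* u≋1 u≋1) (∣⇒≋0 (ℕ.∣n⇒∣m*n c (ℕ.∣m⇒∣m*n (w j) D∣w))))
          co : Coprime D n
          co = Coprimality.sym (inverse⇒coprime (1ℤ , ≋-trans (≋-reflexive (ℤ.*-identityʳ (+ n))) n≋1))
          good : Good n
          good {p} pr p∣n = both (link {p} {u} {w j} pr cp p∣n p∤w) (H pr (ℕ.≤-trans (ℕ.∣⇒≤ p∣n) n≤X) cp)
            where
            cp : Coprime D p
            cp = coprime-dvdʳ p∣n co
            p∤w : ¬ p ℕ.∣ w j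
            p∤w = coprime⇒prime∤ pr (coprime-^ʳ (suc j) (Coprimality.sym cp)) ℕ.∣-refl
            both : f p ≡ g p → f p ≡ 1ℤ ⊎ g p ≡ 1ℤ → f p ≡ 1ℤ × g p ≡ 1ℤ
            both e (inj₁ x) = x , trans (sym e) x
            both e (inj₂ y) = trans e y , y
          pos′ : (Σ ℕ λ v → F n ≡ + v × (Good n → 1 ℕ.≤ v)) → 1 ℕ.≤ ∣ F n ∣
          pos′ (v , e , h) = subst (λ z → 1 ℕ.≤ ∣ z ∣) (sym e) (h good)

        block : ∀ i → i ℕ.< L → let u = suc (D ℕ.* (U ℕ.+ i)) in J ℕ.≤ ∑ⁿ (suc (u ℕ.+ u)) (λ v → ∣ F (u ℕ.* u ℕ.+ v) ∣)
        block i i<L = ℕ.≤-trans (ℕ.≤-reflexive (sym (ℕ.*-identityʳ J)))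
          (∑ⁿ-points (λ v → ∣ F (u ℕ.* u ℕ.+ v) ∣) (suc (u ℕ.+ u)) 1 J (λ j → c ℕ.* (w j ℕ.* w j))
            (λ j → ℕ.*-monoʳ-< c (ℕ.*-mono-< (w-< j) (w-< j)))
            (λ j j<J → s≤s (ℕ.≤-trans (ℕ.≤-trans (ℕ.*-monoʳ-≤ c (ℕ.*-mono-≤ (ℕ.^-monoʳ-≤ D j<J) (ℕ.^-monoʳ-≤ D j<J)))
              (ℕ.≤-trans (ℕ.m≤m+n U i) (ℕ.≤-trans (ℕ.m≤n*m (U ℕ.+ i) D) (ℕ.n≤1+n _)))) (ℕ.m≤m+n u u)) , value-≥1 i j i<L j<J))
          where
          u = suc (D ℕ.* (U ℕ.+ i))
          w-< : ∀ j → w j ℕ.< w (suc j)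
          w-< j = ℕ.^-monoʳ-< D 1<D {suc j} {suc (suc j)} ℕ.≤-refl

        lower : L ℕ.* J ℕ.≤ ∑ⁿ (suc X) (λ n → ∣ F n ∣)
        lower = ℕ.≤-trans (∑ⁿ-points (λ u → ∑ⁿ (suc (u ℕ.+ u)) (λ v → ∣ F (u ℕ.* u ℕ.+ v) ∣)) Y J L (λ i → suc (D ℕ.* (U ℕ.+ i)))
            (λ i → s≤s (ℕ.*-monoʳ-< D (ℕ.+-monoʳ-< U (ℕ.n<1+n i))))
            (λ i i<L → s≤s (ℕ.*-monoʳ-< D (ℕ.+-monoʳ-< U i<L)) , block i i<L))
          (ℕ.≤-trans (ℕ.≤-reflexive (sym (∑ⁿ-squares Y (λ n → ∣ F n ∣)))) (∑ⁿ-mono (λ n → ∣ F n ∣) (ℕ.n≤1+n X)))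

        impossible : ⊥
        impossible = ℕ.<⇒≱ (ℕ.≤-trans (s≤s (ℕ.m≤m+n _ P)) (ℕ.≤-reflexive (arith P D U (3 ℕ.* P ℕ.* (2 ℕ.+ D ℕ.* U)) refl))) (ℕ.≤-trans lower upper)
          where
          arith : ∀ P D U K → K ≡ 3 ℕ.* P ℕ.* (2 ℕ.+ D ℕ.* U) →
            suc (suc (D ℕ.* (U ℕ.+ suc K)) ℕ.* P ℕ.+ suc (suc (D ℕ.* (U ℕ.+ suc K))) ℕ.* (P ℕ.+ P) ℕ.+ P) ≡ suc K ℕ.* suc (3 ℕ.* P ℕ.* D)
          arith P D U K e = trans (l₁ P D U K) (trans (cong (λ z → suc (z ℕ.+ 3 ℕ.* P ℕ.* D ℕ.* suc K)) (sym e)) (l₂ P D K))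
            where
            l₁ : ∀ P D U K → suc (suc (D ℕ.* (U ℕ.+ suc K)) ℕ.* P ℕ.+ suc (suc (D ℕ.* (U ℕ.+ suc K))) ℕ.* (P ℕ.+ P) ℕ.+ P)
              ≡ suc (3 ℕ.* P ℕ.* (2 ℕ.+ D ℕ.* U) ℕ.+ 3 ℕ.* P ℕ.* D ℕ.* suc K)
            l₁ = ℕR.solve-∀
            l₂ : ∀ P D K → suc (K ℕ.+ 3 ℕ.* P ℕ.* D ℕ.* suc K) ≡ suc K ℕ.* suc (3 ℕ.* P ℕ.* D)
            l₂ = ℕR.solve-∀

    common-minus-prime : Σ ℕ λ p → Prime p × Coprime D p × f p ≡ -1ℤ × g p ≡ -1ℤ
    common-minus-prime with search X
    ... | inj₁ found = found
    ... | inj₂ none = ⊥-elim (Contradiction.impossible none)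

-- Characters from symbols on units; the character modulo 4.

module PeriodicCharacters where

  open Congruences
  open BigOperators
  open Counting using (∑; ∑-*ˡ; ∑-cong; ∑-permute)
  open Characters using (Character)
  open JacobiSymbol
  open Nonresidues using (parity)

  module Extend (D P : ℕ) .{{_ : NonZero P}} (D∣P : D ℕ.∣ P) (φ : ℕ → ℤ)
    (sgn : ∀ {n} → Coprime D n → Sign (φ n))
    (mul : ∀ {m n} → Coprime D m → Coprime D n → φ (m ℕ.* n) ≡ φ m * φ n)
    (per : ∀ {m n} → + m ≋ + n [ P ] → φ m ≡ φ n)
    (n₀ : ℕ) (c₀ : Coprime P n₀) (φn₀ : φ n₀ ≡ -1ℤ) where

    f : ℕ → ℤ
    f n = if does (coprime? D n) then φ n else 0ℤ

    f-unit : ∀ {n} → Coprime D n → f n ≡ φ n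
    f-unit {n} c = cong (λ b → if b then φ n else 0ℤ) (dec-true (coprime? D n) c)

    f-nonunit : ∀ {n} → ¬ Coprime D n → f n ≡ 0ℤ
    f-nonunit {n} ¬c = cong (λ b → if b then φ n else 0ℤ) (dec-false (coprime? D n) ¬c)

    coprime-≋ : ∀ {m n} → + m ≋ + n [ P ] → Coprime D m → Coprime D n
    coprime-≋ {m} {n} e c with coprime⇒inverse (Coprimality.sym c)
    ... | i , p = Coprimality.sym (inverse⇒coprime (i , ≋-trans (≋-*ʳ i (≋-sym (≋-dvd D∣P e))) p))

    f-≋ : ∀ {m n} → + m ≋ + n [ P ] → f m ≡ f n
    f-≋ {m} {n} e with coprime? D m
    ... | yes c = trans (f-unit c) (trans (per e) (sym (f-unit (coprime-≋ e c))))
    ... | no ¬c = trans (f-nonunit ¬c) (sym (f-nonunit (λ c → ¬c (coprime-≋ (≋-sym e) c))))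

    f-* : ∀ m n → f (m ℕ.* n) ≡ f m * f n
    f-* m n with coprime? D m | coprime? D n
    ... | yes c | yes c′ = trans (f-unit (coprime-*ʳ c c′)) (trans (mul c c′) (sym (cong₂ _*_ (f-unit c) (f-unit c′))))
    ... | yes c | no ¬c′ = trans (f-nonunit (λ d → ¬c′ (coprime-dvdʳ (ℕ.n∣m*n m) d))) (sym (trans (cong (f m *_) (f-nonunit ¬c′)) (ℤ.*-zeroʳ (f m))))
    ... | no ¬c | _      = trans (f-nonunit (λ d → ¬c (coprime-dvdʳ (ℕ.m∣m*n n) d))) (sym (trans (cong (_* f n) (f-nonunit ¬c)) (ℤ.*-zeroˡ (f n))))

    private
      f-n₀ : f n₀ ≡ -1ℤ
      f-n₀ = trans (f-unit (coprime-dvdˡ D∣P c₀)) φn₀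

      neg-self : ∀ x → x ≡ -1ℤ * x → x ≡ 0ℤ
      neg-self (+ zero) _ = refl
      neg-self (+ suc n) ()
      neg-self -[1+ n ] ()

      inverse : Σ ℕ λ b → + n₀ * + b ≋ 1ℤ [ P ]
      inverse with coprime⇒inverse (Coprimality.sym c₀)
      ... | i , p with residue P i
      ... | b , _ , e = b , ≋-trans (≋-*ˡ (+ n₀) e) p

      ≋-% : ∀ a → + (a % P) ≋ + a [ P ]
      ≋-% a = %≡⇒≋ (a % P) a (m%n%n≡m%n a P)

      rotate : ∀ a b → + a * + b ≋ 1ℤ [ P ] → ∀ {i} → i ℕ.< P → (b ℕ.* ((a ℕ.* i) % P)) % P ≡ i
      rotate a b e {i} i<P = ≋-small (m%n<n (b ℕ.* ((a ℕ.* i) % P)) P) i<P (begin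
        + ((b ℕ.* ((a ℕ.* i) % P)) % P)  ≈⟨ ≋-% (b ℕ.* ((a ℕ.* i) % P)) ⟩
        + (b ℕ.* ((a ℕ.* i) % P))        ≡⟨ ℤ.pos-* b _ ⟩
        + b * + ((a ℕ.* i) % P)          ≈⟨ ≋-*ˡ (+ b) (≋-% (a ℕ.* i)) ⟩
        + b * + (a ℕ.* i)                ≡⟨ cong (λ z → + b * z) (ℤ.pos-* a i) ⟩
        + b * (+ a * + i)                ≡⟨ l (+ b) (+ a) (+ i) ⟩
        + a * + b * + i                  ≈⟨ ≋-*ʳ (+ i) e ⟩
        1ℤ * + i                         ≡⟨ ℤ.*-identityˡ (+ i) ⟩
        + i ∎)
        where
        open ≋-Reasoning P
        l : ∀ b a i → b * (a * i) ≡ a * b * i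
        l = solve-∀

      -- Multiplication by n₀ permutes the residues modulo P and, as f n₀ = -1, reverses the sign of
      -- the sum.
      mean : ∑ P f ≡ 0ℤ
      mean = neg-self (∑ P f) (begin
        ∑ P f                          ≡⟨ ∑-permute P f bij ⟨
        ∑ P (λ i → f ((n₀ ℕ.* i) % P)) ≡⟨ ∑-cong P (λ i _ → trans (f-≋ (≋-% (n₀ ℕ.* i))) (trans (f-* n₀ i) (cong (_* f i) f-n₀))) ⟩
        ∑ P (λ i → -1ℤ * f i)          ≡⟨ ∑-*ˡ P -1ℤ f ⟩
        -1ℤ * ∑ P f ∎)
        where
        open ≡-Reasoning
        b = proj₁ inverse
        bij : Bijective< P (λ i → (n₀ ℕ.* i) % P) (λ i → (b ℕ.* i) % P)
        bij = record
          { σ< = λ {i} _ → m%n<n (n₀ ℕ.* i) P ; τ< = λ {i} _ → m%n<n (b ℕ.* i) P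
          ; τ∘σ = rotate n₀ b (proj₂ inverse)
          ; σ∘τ = rotate b n₀ (≋-trans (≋-reflexive (ℤ.*-comm (+ b) (+ n₀))) (proj₂ inverse)) }

    character : Character P D f
    character = record
      { periodic = λ n → f-≋ (≋-trans (≋-reflexive (ℤ.pos-+ P n)) (≋-trans (≋-+ʳ (+ n) modulus≋0) (≋-reflexive (ℤ.+-identityˡ (+ n)))))
      ; multiplicative = f-*
      ; unit = λ c → subst Sign (sym (f-unit c)) (sgn c)
      ; nonunit = f-nonunit
      ; mean-zero = mean }

  -- Even residues get the default -1, so that every value is a sign; `Extend` puts 0 on all numbers
  -- not coprime to its even D.
  χ₄ : ℕ → ℤ
  χ₄ 1 = 1ℤ
  χ₄ _ = -1ℤ

  χ : ℕ → ℤ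
  χ n = χ₄ (n % 4)

  Sign-χ₄ : ∀ n → Sign (χ₄ n)
  Sign-χ₄ 0 = neg
  Sign-χ₄ 1 = pos
  Sign-χ₄ (suc (suc _)) = neg

  even%4 : ∀ n r → n % 4 ≡ 2 ℕ.* r → 2 ℕ.∣ n
  even%4 n r e = ℕ.divides (r ℕ.+ n / 4 ℕ.* 2) (trans (m≡m%n+[m/n]*n n 4) (trans (cong (ℕ._+ n / 4 ℕ.* 4) e) (l r (n / 4))))
    where
    l : ∀ r k → 2 ℕ.* r ℕ.+ k ℕ.* 4 ≡ (r ℕ.+ k ℕ.* 2) ℕ.* 2
    l = ℕR.solve-∀

  odd%4 : ∀ n → ¬ 2 ℕ.∣ n → n % 4 ≡ 1 ⊎ n % 4 ≡ 3
  odd%4 n odd with n % 4 in eq | m%n<n n 4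
  ... | 1 | _ = inj₁ refl
  ... | 3 | _ = inj₂ refl
  ... | 0 | _ = contradiction (even%4 n 0 eq) odd
  ... | 2 | _ = contradiction (even%4 n 1 eq) odd
  ... | suc (suc (suc (suc _))) | s≤s (s≤s (s≤s (s≤s ())))

  χ-* : ∀ m n → ¬ 2 ℕ.∣ m → ¬ 2 ℕ.∣ n → χ (m ℕ.* n) ≡ χ m * χ n
  χ-* m n odd-m odd-n with odd%4 m odd-m | odd%4 n odd-n
  ... | inj₁ e | inj₁ e′ = trans (cong χ₄ (trans (%-distribˡ-* m n 4) (cong₂ (λ a b → (a ℕ.* b) % 4) e e′))) (sym (cong₂ (λ a b → χ₄ a * χ₄ b) e e′))
  ... | inj₁ e | inj₂ e′ = trans (cong χ₄ (trans (%-distribˡ-* m n 4) (cong₂ (λ a b → (a ℕ.* b) % 4) e e′))) (sym (cong₂ (λ a b → χ₄ a * χ₄ b) e e′))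
  ... | inj₂ e | inj₁ e′ = trans (cong χ₄ (trans (%-distribˡ-* m n 4) (cong₂ (λ a b → (a ℕ.* b) % 4) e e′))) (sym (cong₂ (λ a b → χ₄ a * χ₄ b) e e′))
  ... | inj₂ e | inj₂ e′ = trans (cong χ₄ (trans (%-distribˡ-* m n 4) (cong₂ (λ a b → (a ℕ.* b) % 4) e e′))) (sym (cong₂ (λ a b → χ₄ a * χ₄ b) e e′))

  half%4 : ∀ h → (suc (h ℕ.+ h) % 4 ≡ 1 × par h ≡ 1ℤ) ⊎ (suc (h ℕ.+ h) % 4 ≡ 3 × par h ≡ -1ℤ)
  half%4 h with parity h
  ... | k , inj₁ refl = inj₁ (trans (cong (_% 4) (l k)) ([m+kn]%n≡m%n 1 k 4) , par-double k)
    where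
    l : ∀ k → suc ((k ℕ.+ k) ℕ.+ (k ℕ.+ k)) ≡ 1 ℕ.+ k ℕ.* 4
    l = ℕR.solve-∀
  ... | k , inj₂ refl = inj₂ (trans (cong (_% 4) (l k)) ([m+kn]%n≡m%n 3 k 4) , cong (-1ℤ *_) (par-double k))
    where
    l : ∀ k → suc (suc (k ℕ.+ k) ℕ.+ suc (k ℕ.+ k)) ≡ 3 ℕ.+ k ℕ.* 4
    l = ℕR.solve-∀

  χ-par : ∀ h {n} → n ≡ suc (h ℕ.+ h) → χ n ≡ par h
  χ-par h refl with half%4 h
  ... | inj₁ (e , e′) = trans (cong χ₄ e) (sym e′)
  ... | inj₂ (e , e′) = trans (cong χ₄ e) (sym e′)

  pred≋-1 : ∀ n .{{_ : NonZero n}} → + ℕ.pred n ≋ -1ℤ [ n ]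
  pred≋-1 (suc n) = quot 1ℤ (l (+ n))
    where
    l : ∀ n → n ≡ -1ℤ + 1ℤ * (1ℤ + n)
    l = solve-∀

  ≋-1⇒coprime : ∀ {n a} → + a ≋ -1ℤ [ n ] → Coprime n a
  ≋-1⇒coprime e = Coprimality.sym (inverse⇒coprime (-1ℤ , ≋-*ʳ -1ℤ e))

  odd-prime : ∀ {D p} → 2 ℕ.∣ D → Prime p → Coprime D p → Σ ℕ λ h → p ≡ suc (h ℕ.+ h)
  odd-prime {p = p} 2∣D pr c with parity p
  ... | h , inj₂ e = h , e
  ... | h , inj₁ refl = contradiction (ℕ.divides h (l h)) (coprime⇒prime∤ prime[2] c 2∣D)
    where
    l : ∀ h → h ℕ.+ h ≡ h ℕ.* 2
    l = ℕR.solve-∀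

  -- For a square z² ≡ −a b² modulo p, the sign of a is that of −1.
  J-of-minus-square : ∀ h p .{{_ : NonZero p}} (p≡ : p ≡ suc (h ℕ.+ h)) {a z} → Coprime p a → Coprime p z →
    + z * + z ≋ - (+ a) [ p ] → Gauss.J h p p≡ a ≡ par h
  J-of-minus-square h p p≡ {a} {z} ca cz e = sym (Sign-*≡1 (Sign-par h) (Sign-J a) (begin
    par h * J a                  ≡⟨ cong (_* J a) (sym (J--1 (≋-1⇒coprime (pred≋-1 p)) (pred≋-1 p))) ⟩
    J (ℕ.pred p) * J a           ≡⟨ J-* (≋-1⇒coprime (pred≋-1 p)) ca ⟨
    J (ℕ.pred p ℕ.* a)           ≡⟨ J-≋ (≋-trans (≋-reflexive (ℤ.pos-* (ℕ.pred p) a)) (≋-trans (≋-*ʳ (+ a) (pred≋-1 p)) (≋-trans (≋-reflexive (l (+ a))) (≋-trans (≋-sym e) (≋-reflexive (sym (ℤ.pos-* z z))))))) ⟩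
    J (z ℕ.* z)                  ≡⟨ J-square cz ⟩
    1ℤ ∎))
    where
    open ≡-Reasoning
    open Gauss h p p≡
    l : ∀ a → -1ℤ * a ≡ - a
    l = solve-∀

-- Congruences on X that keep (X² + g) / A out of 𝐄 for nonsquare g.

module NonsquareKilling where

  open Congruences
  open CharacterClash using (common-minus-prime)
  open JacobiSymbol
  open Nonresidues
  open PeriodicCharacters
  open import Data.Integer using (_^_)

  -- A prime ℓ ≡ 3 (mod 4) away from D such that some y² + g is divisible by ℓ. Such ℓ can divide a
  -- sum of two squares only to an even power.
  record Killer (g D : ℕ) : Set where
    field
      ℓ       : ℕ
      prime   : Prime ℓ
      ℓ%4≡3   : ℓ % 4 ≡ 3
      coprime : Coprime D ℓ
      y       : ℤ
      root    : y * y + + g ≋ 0ℤ [ ℓ ]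

  -- A prime p with χ₄(p) = (p/g) = -1 is ≡ 3 (mod 4) and, by reciprocity with g ≡ 1 (mod 4), has
  -- (g/p) = -1; hence (-g/p) = 1.
  killer-1mod4 : ∀ t g → g ≡ suc ((t ℕ.+ t) ℕ.+ (t ℕ.+ t)) → ¬ Square g → ∀ D → D ≢ 0 → Killer g D
  killer-1mod4 t g g≡ ¬sq D₀ D₀≢0 = result (common-minus-prime D≢0 D≢1 Chi.character Jac.character g (ℕ.≢-nonZero⁻¹ g) (λ {p} {u} {w} → link {p} {u} {w}))
    where
    instance
      nzg : NonZero g
      nzg = ℕ.≢-nonZero λ e → ℕ.0≢1+n (trans (sym e) g≡)
    -- D is even so that units are odd, and P = 2D is a multiple of both 4 and g, hence a period of
    -- both characters.
    D = 2 ℕ.* (g ℕ.* D₀)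
    P = 2 ℕ.* D
    instance
      nzD : NonZero D
      nzD = ℕ.m*n≢0 2 (g ℕ.* D₀) {{_}} {{ℕ.m*n≢0 g D₀ {{nzg}} {{ℕ.≢-nonZero D₀≢0}}}}
      nzP : NonZero P
      nzP = ℕ.m*n≢0 2 D {{_}} {{nzD}}
    D≢0 : D ≢ 0
    D≢0 = ℕ.≢-nonZero⁻¹ D
    2∣D : 2 ℕ.∣ D
    2∣D = ℕ.m∣m*n (g ℕ.* D₀)
    D≢1 : D ≢ 1
    D≢1 e = contradiction (ℕ.∣1⇒≡1 (subst (2 ℕ.∣_) e 2∣D)) (λ ())
    D∣P : D ℕ.∣ P
    D∣P = ℕ.n∣m*n 2
    4∣P : 4 ℕ.∣ P
    4∣P = ℕ.*-pres-∣ {2} {2} {2} {D} ℕ.∣-refl 2∣D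
    g∣D : g ℕ.∣ D
    g∣D = ℕ.∣n⇒∣m*n 2 (ℕ.m∣m*n D₀)
    odd : ∀ {n} → Coprime D n → ¬ 2 ℕ.∣ n
    odd c 2∣n = contradiction (c (2∣D , 2∣n)) (λ ())
    module G = Gauss (t ℕ.+ t) g g≡
    module Chi = Extend D P D∣P χ (λ {n} _ → Sign-χ₄ (n % 4)) (λ {m} {n} c c′ → χ-* m n (odd c) (odd c′))
      (λ {m} {n} e → cong χ₄ (≋⇒%≡ m n (≋-dvd 4∣P e))) (ℕ.pred P) (≋-1⇒coprime (pred≋-1 P))
      (cong χ₄ (≋⇒%≡ (ℕ.pred P) 3 (≋-trans (≋-dvd 4∣P (pred≋-1 P)) (quot -1ℤ refl))))
    nr = nonresidue t g g≡ ¬sq P (ℕ.≢-nonZero⁻¹ P)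
    module Jac = Extend D P D∣P G.J (λ {n} _ → G.Sign-J n) (λ c c′ → G.J-* (coprime-dvdˡ g∣D c) (coprime-dvdˡ g∣D c′))
      (λ e → G.J-≋ (≋-dvd (ℕ.∣-trans g∣D D∣P) e)) (proj₁ nr) (proj₁ (proj₂ nr)) (proj₂ (proj₂ (proj₂ nr)))

    flip : ∀ {p} → Prime p → Coprime D p → (h : ℕ) (p≡ : p ≡ suc (h ℕ.+ h)) .{{_ : NonZero p}} → Gauss.J h p p≡ g ≡ G.J p
    flip {p} pr c h p≡ = J-swap h p p≡ t g g≡ (Coprimality.sym (coprime-dvdˡ g∣D c))

    -- Dividing u by w gives a square root of -g modulo p, so (g/p) = (-1/p) = χ₄(p), and (g/p) =
    -- (p/g).
    link : ∀ {p u w} → Prime p → Coprime D p → p ℕ.∣ u ℕ.* u ℕ.+ g ℕ.* (w ℕ.* w) → ¬ p ℕ.∣ w → Chi.f p ≡ Jac.f p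
    link {p} {u} {w} pr c p∣ p∤w = trans (Chi.f-unit c) (trans χ≡J (sym (Jac.f-unit c)))
      where
      instance
        nzp : NonZero p
        nzp = prime⇒nonZero pr
      half = odd-prime 2∣D pr c
      h = proj₁ half
      p≡ = proj₂ half
      cg : Coprime p g
      cg = Coprimality.sym (coprime-dvdˡ g∣D c)
      inv = coprime⇒inverse (Coprimality.sym (prime∤⇒coprime pr p∤w))
      i = Coprimeᶻ.inverse inv
      res = residue p (+ u * i)
      z = proj₁ res
      z≋ : + z ≋ + u * i [ p ]
      z≋ = proj₂ (proj₂ res)
      sum≋0 : + u * + u + + g * (+ w * + w) ≋ 0ℤ [ p ]
      sum≋0 = ≋-trans (≋-reflexive (sym (trans (ℤ.pos-+ (u ℕ.* u) _) (cong₂ _+_ (ℤ.pos-* u u) (trans (ℤ.pos-* g (w ℕ.* w)) (cong (λ x → + g * x) (ℤ.pos-* w w))))))) (∣⇒≋0 p∣)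
      z²≋-g : + z * + z ≋ - (+ g) [ p ]
      z²≋-g = begin
        + z * + z                                                        ≈⟨ ≋-* z≋ z≋ ⟩
        (+ u * i) * (+ u * i)                                            ≡⟨ l (+ u) i (+ g) (+ w) ⟩
        (i * i) * (+ u * + u + + g * (+ w * + w)) - + g * ((+ w * i) * (+ w * i)) ≈⟨ ≋-- (≋-*ˡ (i * i) sum≋0) (≋-*ˡ (+ g) (≋-* w*i w*i)) ⟩
        (i * i) * 0ℤ - + g * (1ℤ * 1ℤ)                                   ≡⟨ l′ (i * i) (+ g) ⟩
        - (+ g) ∎
        where
        open ≋-Reasoning p
        w*i = Coprimeᶻ.inverse-≋ inv
        l : ∀ u i g w → (u * i) * (u * i) ≡ (i * i) * (u * u + g * (w * w)) - g * ((w * i) * (w * i))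
        l = solve-∀
        l′ : ∀ a g → a * 0ℤ - g * (1ℤ * 1ℤ) ≡ - g
        l′ = solve-∀
      cz : Coprime p z
      cz = prime∤⇒coprime pr λ p∣z → coprime⇒prime∤ pr cg ℕ.∣-refl (≋0⇒∣ {p} {+ g} (begin
        + g         ≡⟨ ℤ.neg-involutive (+ g) ⟨
        - - (+ g)   ≈⟨ ≋-neg (≋-sym z²≋-g) ⟩
        - (+ z * + z) ≈⟨ ≋-neg (≋-*ʳ (+ z) (∣⇒≋0 p∣z)) ⟩
        - (0ℤ * + z)  ≡⟨ cong -_ (ℤ.*-zeroˡ (+ z)) ⟩
        0ℤ ∎))
        where open ≋-Reasoning p
      χ≡J : χ p ≡ G.J p
      χ≡J = trans (χ-par h p≡) (trans (sym (J-of-minus-square h p p≡ cg cz z²≋-g)) (flip pr c h p≡))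

    result : (Σ ℕ λ p → Prime p × Coprime D p × Chi.f p ≡ -1ℤ × Jac.f p ≡ -1ℤ) → Killer g D₀
    result (p , pr , c , fχ , fJ) = record
      { ℓ = p ; prime = pr ; ℓ%4≡3 = [ (λ e → contradiction (trans (sym (cong χ₄ e)) χ≡-1) (λ ())) , (λ e → e) ]′ (odd%4 p (odd c))
      ; coprime = coprime-dvdˡ (ℕ.∣n⇒∣m*n 2 (ℕ.n∣m*n g)) c ; y = (+ g) ^ e ; root = root }
      where
      instance
        nzp : NonZero p
        nzp = prime⇒nonZero pr
      χ≡-1 : χ p ≡ -1ℤ
      χ≡-1 = trans (sym (Chi.f-unit c)) fχ
      half = odd-prime 2∣D pr c
      h = proj₁ half
      p≡ = proj₂ half
      -- For p = 2h + 1 ≡ 3 (mod 4) the number h + 1 = 2e is even, and Euler's criterion gives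
      -- (g^e)² = g · g^h ≡ -g: an explicit root.
      evenness : Σ ℕ λ e → suc h ≡ e ℕ.+ e
      evenness with parity h
      ... | k , inj₂ h≡ = suc k , trans (cong suc h≡) (cong suc (sym (ℕ.+-suc k k)))
      ... | k , inj₁ h≡ = contradiction (trans (sym (trans (χ-par h p≡) (trans (cong par h≡) (par-double k)))) χ≡-1) (λ ())
      e = proj₁ evenness
      J≡-1 : Gauss.J h p p≡ g ≡ -1ℤ
      J≡-1 = trans (flip pr c h p≡) (trans (sym (Jac.f-unit c)) fJ)
      root : (+ g) ^ e * (+ g) ^ e + + g ≋ 0ℤ [ p ]
      root = begin
        (+ g) ^ e * (+ g) ^ e + + g   ≡⟨ cong (λ x → x + + g) (ℤ.^-distribˡ-+-* (+ g) e e) ⟨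
        (+ g) ^ (e ℕ.+ e) + + g       ≡⟨ cong (λ x → (+ g) ^ x + + g) (proj₂ evenness) ⟨
        + g * (+ g) ^ h + + g         ≈⟨ ≋-+ʳ (+ g) (≋-*ˡ (+ g) (≋-trans (Gauss.euler h p p≡ pr (Coprimality.sym (coprime-dvdˡ g∣D c))) (≋-reflexive J≡-1))) ⟩
        + g * -1ℤ + + g               ≡⟨ l (+ g) ⟩
        0ℤ ∎
        where
        open ≋-Reasoning p
        l : ∀ g → g * -1ℤ + g ≡ 0ℤ
        l = solve-∀

  two∤ : ∀ r → ¬ 2 ℕ.∣ suc (r ℕ.+ r)
  two∤ r d with dvd-odd d (r , refl)
  ... | zero , ()
  ... | suc a , e = contradiction (cong ℕ.pred (cong ℕ.pred e)) (λ e₃ → ℕ.0≢1+n (trans e₃ (ℕ.+-suc a a)))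

  odd-3mod4 : ∀ n → n % 4 ≡ 3 → ¬ 2 ℕ.∣ n
  odd-3mod4 n e d = two∤ (1 ℕ.+ n / 4 ℕ.* 2) (subst (2 ℕ.∣_) (trans (m≡m%n+[m/n]*n n 4) (trans (cong (ℕ._+ n / 4 ℕ.* 4) e) (l (n / 4)))) d)
    where
    l : ∀ k → 3 ℕ.+ k ℕ.* 4 ≡ suc ((1 ℕ.+ k ℕ.* 2) ℕ.+ (1 ℕ.+ k ℕ.* 2))
    l = ℕR.solve-∀

  prime-3mod4 : ∀ n → n % 4 ≡ 3 → Σ ℕ λ ℓ → Prime ℓ × ℓ ℕ.∣ n × ℓ % 4 ≡ 3
  prime-3mod4 = <-rec Goal go
    where
    Goal : ℕ → Set
    Goal n = n % 4 ≡ 3 → Σ ℕ λ ℓ → Prime ℓ × ℓ ℕ.∣ n × ℓ % 4 ≡ 3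
    go : ∀ n → (∀ {m} → m ℕ.< n → Goal m) → Goal n
    go n rec n%4 with prime-divisor n (λ { refl → contradiction n%4 (λ ()) }) (λ { refl → contradiction n%4 (λ ()) })
    ... | p , pr , p∣n@(ℕ.divides k n≡) with odd%4 p (λ 2∣p → odd-3mod4 n n%4 (ℕ.∣-trans 2∣p p∣n))
    ...   | inj₂ e = p , pr , p∣n , e
    ...   | inj₁ e with rec {k} k<n k%4
      where
      k≢0 : k ≢ 0
      k≢0 refl = contradiction (trans (cong (_% 4) (sym n≡)) n%4) (λ ())
      k<n : k ℕ.< n
      k<n = subst (k ℕ.<_) (sym n≡) (ℕ.m<m*n k p {{ℕ.≢-nonZero k≢0}} (ℕ.nonTrivial⇒n>1 p {{prime⇒nonTrivial pr}}))
      k%4 : k % 4 ≡ 3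
      k%4 = trans (sym (trans (%-distribˡ-* k p 4) (trans (cong (λ z → ((k % 4) ℕ.* z) % 4) e) (trans (cong (_% 4) (ℕ.*-identityʳ (k % 4))) (m%n%n≡m%n k 4))))) (trans (cong (_% 4) (sym n≡)) n%4)
    ...     | ℓ , prℓ , ℓ∣k , ℓ%4 = ℓ , prℓ , ℕ.∣-trans ℓ∣k (ℕ.divides p (trans n≡ (ℕ.*-comm k p))) , ℓ%4

  -- Common factors with g are divided out of D until none is left; a prime lost on the way divides
  -- g.
  coprime-part : ∀ g → g ≢ 0 → ∀ D → D ≢ 0 → Σ ℕ λ D′ → Coprime D′ g × (∀ {p} → Prime p → p ℕ.∣ D → p ℕ.∣ g ⊎ p ℕ.∣ D′)
  coprime-part g g≢0 = <-rec Goal go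
    where
    Goal : ℕ → Set
    Goal D = D ≢ 0 → Σ ℕ λ D′ → Coprime D′ g × (∀ {p} → Prime p → p ℕ.∣ D → p ℕ.∣ g ⊎ p ℕ.∣ D′)
    go : ∀ D → (∀ {D₁} → D₁ ℕ.< D → Goal D₁) → Goal D
    go D rec D≢0 with gcd D g ℕ.≟ 1 | gcd[m,n]∣m D g
    ... | yes e | _ = D , gcd≡1⇒coprime e , λ _ d → inj₂ d
    ... | no ≢1 | ℕ.divides D₁ D≡ with rec {D₁} D₁<D D₁≢0
      where
      D₁≢0 : D₁ ≢ 0
      D₁≢0 refl = D≢0 D≡
      1<gcd : 1 ℕ.< gcd D g
      1<gcd = ℕ.≤∧≢⇒< (ℕ.n≢0⇒n>0 (λ e → D≢0 (trans D≡ (trans (cong (D₁ ℕ.*_) e) (ℕ.*-zeroʳ D₁))))) (λ e → ≢1 (sym e))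
      D₁<D : D₁ ℕ.< D
      D₁<D = subst (D₁ ℕ.<_) (sym D≡) (ℕ.m<m*n D₁ (gcd D g) {{ℕ.≢-nonZero D₁≢0}} 1<gcd)
    ...   | D′ , c , h = D′ , c , λ pr d → pick pr (euclidsLemma D₁ (gcd D g) pr (subst (_ ℕ.∣_) D≡ d))
      where
      pick : ∀ {p} → Prime p → p ℕ.∣ D₁ ⊎ p ℕ.∣ gcd D g → p ℕ.∣ g ⊎ p ℕ.∣ D′
      pick pr (inj₁ d) = h pr d
      pick pr (inj₂ d) = inj₁ (ℕ.∣-trans d (gcd[m,n]∣n D g))

  -- Take y to be the part of 2 D coprime to g. Each prime of 2 D divides exactly one of y and g, so
  -- none divides y² + g; the prime 2 makes the parities of y and g opposite.
  killer-3 : ∀ g → g ≢ 0 → ∀ D → D ≢ 0 → (∀ y → (2 ℕ.∣ g → ¬ 2 ℕ.∣ y) → (¬ 2 ℕ.∣ g → 2 ℕ.∣ y) → (y ℕ.* y ℕ.+ g) % 4 ≡ 3) → Killer g D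
  killer-3 g g≢0 D D≢0 h with coprime-part g g≢0 (2 ℕ.* D) (λ e → ℕ.≢-nonZero⁻¹ (2 ℕ.* D) {{ℕ.m*n≢0 2 D {{_}} {{ℕ.≢-nonZero D≢0}}}} e)
  ... | y , c , cover = finish (prime-3mod4 (y ℕ.* y ℕ.+ g) (h y (λ 2∣g 2∣y → coprime⇒prime∤ prime[2] c 2∣y 2∣g) even))
    where
    even : ¬ 2 ℕ.∣ g → 2 ℕ.∣ y
    even 2∤g with cover prime[2] (ℕ.m∣m*n D)
    ... | inj₁ d = contradiction d 2∤g
    ... | inj₂ d = d
    finish : (Σ ℕ λ ℓ → Prime ℓ × ℓ ℕ.∣ y ℕ.* y ℕ.+ g × ℓ % 4 ≡ 3) → Killer g D
    finish (ℓ , pr , ℓ∣ , ℓ%4) = record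
      { ℓ = ℓ ; prime = pr ; ℓ%4≡3 = ℓ%4 ; coprime = Coprimality.sym (prime∤⇒coprime pr ℓ∤D) ; y = + y
      ; root = ≋-trans (≋-reflexive (sym (trans (ℤ.pos-+ (y ℕ.* y) g) (cong (λ z → z + + g) (ℤ.pos-* y y))))) (∣⇒≋0 ℓ∣) }
      where
      ℓ∤D : ¬ ℓ ℕ.∣ D
      ℓ∤D d with cover pr (ℕ.∣n⇒∣m*n 2 d)
      ... | inj₂ ℓ∣y = coprime⇒prime∤ pr c ℓ∣y (ℕ.∣m+n∣m⇒∣n ℓ∣ (ℕ.∣m⇒∣m*n y ℓ∣y))
      ... | inj₁ ℓ∣g with euclidsLemma y y pr (ℕ.∣m+n∣m⇒∣n (subst (ℓ ℕ.∣_) (ℕ.+-comm (y ℕ.* y) g) ℓ∣) ℓ∣g)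
      ...   | inj₁ ℓ∣y = coprime⇒prime∤ pr c ℓ∣y ℓ∣g
      ...   | inj₂ ℓ∣y = coprime⇒prime∤ pr c ℓ∣y ℓ∣g

  killer : ∀ g → g ≢ 0 → ¬ Square g → ∀ D → D ≢ 0 → Killer g D
  killer = <-rec Goal go
    where
    Goal : ℕ → Set
    Goal g = g ≢ 0 → ¬ Square g → ∀ D → D ≢ 0 → Killer g D
    go : ∀ g → (∀ {g′} → g′ ℕ.< g → Goal g′) → Goal g
    go g rec g≢0 ¬sq D D≢0 with g % 4 in eq | m%n<n g 4 | m≡m%n+[m/n]*n g 4
    ... | 0 | _ | g≡ = lift (rec {k} k<g k≢0 ¬sqk D D≢0)
      where
      k = g / 4
      g≡4k : g ≡ k ℕ.* 4
      g≡4k = g≡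
      k≢0 : k ≢ 0
      k≢0 e = g≢0 (trans g≡4k (cong (ℕ._* 4) e))
      k<g : k ℕ.< g
      k<g = subst (k ℕ.<_) (sym g≡4k) (ℕ.m<m*n k 4 {{ℕ.≢-nonZero k≢0}} (s≤s (s≤s z≤n)))
      ¬sqk : ¬ Square k
      ¬sqk (x , e) = ¬sq (2 ℕ.* x , trans (l x) (trans (cong (ℕ._* 4) e) (sym g≡4k)))
        where
        l : ∀ x → (2 ℕ.* x) ℕ.* (2 ℕ.* x) ≡ x ℕ.* x ℕ.* 4
        l = ℕR.solve-∀
      lift : Killer k D → Killer g D
      lift κ = record
        { ℓ = ℓ ; prime = prime ; ℓ%4≡3 = ℓ%4≡3 ; coprime = coprime ; y = + 2 * y
        ; root = ≋-trans (≋-reflexive (trans (cong (λ z → (+ 2 * y) * (+ 2 * y) + z) (trans (cong +_ g≡4k) (ℤ.pos-* k 4))) (l y (+ k)))) (≋-trans (≋-*ʳ (+ 4) root) (≋-reflexive refl)) }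
        where
        open Killer κ
        l : ∀ y k → (+ 2 * y) * (+ 2 * y) + k * + 4 ≡ (y * y + k) * + 4
        l = solve-∀
    ... | 1 | _ | g≡ = killer-1mod4 (g / 4) g (trans g≡ (l (g / 4))) ¬sq D D≢0
      where
      l : ∀ t → 1 ℕ.+ t ℕ.* 4 ≡ suc ((t ℕ.+ t) ℕ.+ (t ℕ.+ t))
      l = ℕR.solve-∀
    ... | 2 | _ | g≡ = killer-3 g g≢0 D D≢0 λ y oddy _ → check y (oddy (even%4 g 1 eq))
      where
      check : ∀ y → ¬ 2 ℕ.∣ y → (y ℕ.* y ℕ.+ g) % 4 ≡ 3
      check y 2∤y with parity y
      ... | a , inj₁ refl = contradiction (ℕ.divides a (l a)) 2∤y
        where
        l : ∀ a → a ℕ.+ a ≡ a ℕ.* 2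
        l = ℕR.solve-∀
      ... | a , inj₂ refl = trans (cong (λ z → (suc (a ℕ.+ a) ℕ.* suc (a ℕ.+ a) ℕ.+ z) % 4) g≡)
          (trans (cong (_% 4) (l a (g / 4))) ([m+kn]%n≡m%n 3 (a ℕ.* a ℕ.+ a ℕ.+ g / 4) 4))
        where
        l : ∀ a k → suc (a ℕ.+ a) ℕ.* suc (a ℕ.+ a) ℕ.+ (2 ℕ.+ k ℕ.* 4) ≡ 3 ℕ.+ (a ℕ.* a ℕ.+ a ℕ.+ k) ℕ.* 4
        l = ℕR.solve-∀
    ... | 3 | _ | g≡ = killer-3 g g≢0 D D≢0 λ y _ eveny → check y (eveny (odd-3mod4 g eq))
      where
      g≡3+ : g ≡ 3 ℕ.+ g / 4 ℕ.* 4
      g≡3+ = g≡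
      check : ∀ y → 2 ℕ.∣ y → (y ℕ.* y ℕ.+ g) % 4 ≡ 3
      check y (ℕ.divides a refl) = trans (cong (λ z → ((a ℕ.* 2) ℕ.* (a ℕ.* 2) ℕ.+ z) % 4) g≡3+)
          (trans (cong (_% 4) (l a (g / 4))) ([m+kn]%n≡m%n 3 (a ℕ.* a ℕ.+ g / 4) 4))
        where
        l : ∀ a k → (a ℕ.* 2) ℕ.* (a ℕ.* 2) ℕ.+ (3 ℕ.+ k ℕ.* 4) ≡ 3 ℕ.+ (a ℕ.* a ℕ.+ k) ℕ.* 4
        l = ℕR.solve-∀
    ... | suc (suc (suc (suc _))) | s≤s (s≤s (s≤s (s≤s ()))) | _

  3mod4⇒half : ∀ n → n % 4 ≡ 3 → Σ ℕ λ h → n ≡ suc (h ℕ.+ h) × par h ≡ -1ℤ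
  3mod4⇒half n e with parity n
  ... | h , inj₁ refl = contradiction (ℕ.divides h (l h)) (odd-3mod4 n e)
    where
    l : ∀ a → a ℕ.+ a ≡ a ℕ.* 2
    l = ℕR.solve-∀
  ... | h , inj₂ refl = h , refl , trans (sym (χ-par h refl)) (cong χ₄ e)

  -- Otherwise v is a unit too, and v² ≡ -u² forces the square u² to have the symbol of -1, which is
  -- -1.
  3mod4-∣-squares : ∀ {ℓ} → Prime ℓ → ℓ % 4 ≡ 3 → ∀ u v → ℓ ℕ.∣ u ℕ.* u ℕ.+ v ℕ.* v → ℓ ℕ.∣ u
  3mod4-∣-squares {ℓ} pr ℓ%4 u v ℓ∣ with ℓ ℕ.∣? u
  ... | yes d = d
  ... | no ℓ∤u = absurd (3mod4⇒half ℓ ℓ%4)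
    where
    instance
      nzℓ : NonZero ℓ
      nzℓ = prime⇒nonZero pr
    ℓ∤v : ¬ ℓ ℕ.∣ v
    ℓ∤v d with euclidsLemma u u pr (ℕ.∣m+n∣m⇒∣n (subst (ℓ ℕ.∣_) (ℕ.+-comm (u ℕ.* u) (v ℕ.* v)) ℓ∣) (ℕ.∣m⇒∣m*n v d))
    ... | inj₁ x = ℓ∤u x
    ... | inj₂ x = ℓ∤u x
    cu = prime∤⇒coprime pr ℓ∤u
    e : + v * + v ≋ - (+ (u ℕ.* u)) [ ℓ ]
    e = ≋-trans (≋-reflexive (trans (sym (ℤ.pos-* v v)) (l (+ (u ℕ.* u)) (+ (v ℕ.* v))))) (≋-trans (≋-- (≋-trans (≋-reflexive (sym (ℤ.pos-+ (u ℕ.* u) (v ℕ.* v)))) (∣⇒≋0 ℓ∣)) (≋-refl {a = + (u ℕ.* u)})) (≋-reflexive (ℤ.+-identityˡ (- (+ (u ℕ.* u))))))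
      where
      l : ∀ a b → b ≡ a + b - a
      l = solve-∀
    absurd : (Σ ℕ λ h → ℓ ≡ suc (h ℕ.+ h) × par h ≡ -1ℤ) → ℓ ℕ.∣ u
    absurd (h , ℓ≡ , ph) = contradiction (trans (sym (Gauss.J-square h ℓ ℓ≡ cu)) (trans (J-of-minus-square h ℓ ℓ≡ (coprime-*ʳ cu cu) (prime∤⇒coprime pr ℓ∤v) e) ph)) (λ ())

  -- If ℓ² divides y² + g, pass to y + ℓ: the value changes by ℓ (2y + ℓ), which ℓ divides only once
  -- because 2y is a unit.
  exact-root : ∀ {ℓ} → Prime ℓ → ¬ 2 ℕ.∣ ℓ → ∀ {g} → ¬ ℓ ℕ.∣ g → ∀ y → y * y + + g ≋ 0ℤ [ ℓ ] →
    Σ ℤ λ y → y * y + + g ≋ 0ℤ [ ℓ ] × ¬ y * y + + g ≋ 0ℤ [ ℓ ℕ.* ℓ ]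
  exact-root {ℓ} pr odd {g} ℓ∤g y r with ≋0? (ℓ ℕ.* ℓ) (y * y + + g)
  ... | no ¬z = y , r , ¬z
  ... | yes z = y + + ℓ , ≋-trans (≋-reflexive (l y (+ g) (+ ℓ))) (≋-+ r (≋-*ʳ (+ 2 * y + + ℓ) modulus≋0)) , λ z′ →
      no-double (descend (≋-trans (≋-reflexive (l′ y (+ g) (+ ℓ))) (≋-- z′ z)))
    where
    instance
      nzℓ : NonZero ℓ
      nzℓ = prime⇒nonZero pr
    l : ∀ y g ℓ → (y + ℓ) * (y + ℓ) + g ≡ (y * y + g) + ℓ * (+ 2 * y + ℓ)
    l = solve-∀
    l′ : ∀ y g ℓ → ℓ * (+ 2 * y + ℓ) ≡ ((y + ℓ) * (y + ℓ) + g) - (y * y + g)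
    l′ = solve-∀
    descend : ∀ {x} → + ℓ * x ≋ 0ℤ [ ℓ ℕ.* ℓ ] → x ≋ 0ℤ [ ℓ ]
    descend {x} (quot q e) = quot q (ℤ.*-cancelˡ-≡ (+ ℓ) x (0ℤ + q * + ℓ) (trans e (trans (cong (λ z → 0ℤ + q * z) (ℤ.pos-* ℓ ℓ)) (k q (+ ℓ)))))
      where
      k : ∀ q ℓ → 0ℤ + q * (ℓ * ℓ) ≡ ℓ * (0ℤ + q * ℓ)
      k = solve-∀
    no-double : ¬ + 2 * y + + ℓ ≋ 0ℤ [ ℓ ]
    no-double d with prime-≋0 pr (+ 2) y (≋-trans (≋-reflexive (k (+ 2 * y) (+ ℓ))) (≋-- d modulus≋0))
      where
      k : ∀ a ℓ → a ≡ a + ℓ - ℓ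
      k = solve-∀
    ... | inj₁ two with prime⇒irreducible prime[2] (≋0⇒∣ two)
    ...   | inj₁ refl = ¬prime[1] pr
    ...   | inj₂ refl = odd ℕ.∣-refl
    no-double d | inj₂ y≋0 = ℓ∤g (≋0⇒∣ {ℓ} {+ g} (≋-trans (≋-reflexive (k (y * y) (+ g))) (≋-- r (≋-*ʳ y y≋0))))
      where
      k : ∀ a g → g ≡ a + g - a
      k = solve-∀

  square? : ∀ n → Dec (Square n)
  square? n = bounded n λ (x , e) → ℕ.≤-trans (m≤m² x) (ℕ.≤-reflexive e)
    where
    m≤m² : ∀ m → m ℕ.≤ m ℕ.* m
    m≤m² zero    = z≤n
    m≤m² (suc m) = ℕ.m≤m+n (suc m) _
    bounded : ∀ b → ((s : Square n) → proj₁ s ℕ.≤ b) → Dec (Square n)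
    bounded zero h with 0 ℕ.≟ n
    ... | yes e = yes (0 , e)
    ... | no ¬e = no λ s → ¬e (trans (cong (λ z → z ℕ.* z) (sym (ℕ.n≤0⇒n≡0 (h s)))) (proj₂ s))
    bounded (suc b) h with suc b ℕ.* suc b ℕ.≟ n
    ... | yes e = yes (suc b , e)
    ... | no ¬e = bounded b λ s → ℕ.≤-pred (ℕ.≤∧≢⇒< (h s) (λ x≡ → ¬e (trans (cong (λ z → z ℕ.* z) (sym x≡)) (proj₂ s))))

  -- If x² + g = A v with v a sum of two squares, then ℓ divides v and therefore both bases, so ℓ²
  -- divides v and x² + g.
  killed : ∀ {ℓ} → Prime ℓ → ℓ % 4 ≡ 3 → ∀ {x g} → x * x + + g ≋ 0ℤ [ ℓ ] → ¬ x * x + + g ≋ 0ℤ [ ℓ ℕ.* ℓ ] →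
    ∀ {A v} → ¬ ℓ ℕ.∣ A → InE v → x * x + + g ≢ + A * + v
  killed {ℓ} pr ℓ%4 {x} {g} z ¬z {A} {v} ℓ∤A (s , t , refl) e = ¬z (≋-trans (≋-reflexive e) (≋-trans (≋-*ˡ (+ A) (∣⇒≋0 ℓ²∣v)) (≋-reflexive (ℤ.*-zeroʳ (+ A)))))
    where
    ℓ∣v : ℓ ℕ.∣ v
    ℓ∣v with euclidsLemma A v pr (≋0⇒∣ {ℓ} {+ (A ℕ.* v)} (≋-trans (≋-reflexive (trans (ℤ.pos-* A v) (sym e))) z))
    ... | inj₁ d = contradiction d ℓ∤A
    ... | inj₂ d = d
    ℓ∣s = 3mod4-∣-squares pr ℓ%4 s t ℓ∣v
    ℓ∣t = 3mod4-∣-squares pr ℓ%4 t s (subst (ℓ ℕ.∣_) (ℕ.+-comm (s ℕ.* s) (t ℕ.* t)) ℓ∣v)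
    ℓ²∣v : ℓ ℕ.* ℓ ℕ.∣ v
    ℓ²∣v = ℕ.∣m∣n⇒∣m+n (ℕ.*-pres-∣ ℓ∣s ℓ∣s) (ℕ.*-pres-∣ ℓ∣t ℓ∣t)

  -- One prime per nonsquare g, each chosen coprime to D, to the modulus built so far and to g
  -- itself, so that the conditions modulo the ℓ² combine.
  kill-nonsquares : ∀ G D → D ≢ 0 → Σ ℕ λ M → M ≢ 0 × Coprime D M × Σ ℤ λ x₀ →
    ∀ {x} → x ≋ x₀ [ M ] → ∀ {g} → g ℕ.≤ G → ¬ Square g → ∀ {A v} → A ℕ.∣ D → InE v → x * x + + g ≢ + A * + v
  kill-nonsquares zero D D≢0 = 1 , (λ ()) , Coprimality.sym (Coprimality.1-coprimeTo D) , 0ℤ , λ { _ z≤n ¬sq → ⊥-elim (¬sq (0 , refl)) }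
  kill-nonsquares (suc G) D D≢0 with kill-nonsquares G D D≢0 | square? (suc G)
  ... | M , M≢0 , c , x₀ , h | yes sq = M , M≢0 , c , x₀ , λ e le ¬sq → h e (below le ¬sq) ¬sq
    where
    below : ∀ {g} → g ℕ.≤ suc G → ¬ Square g → g ℕ.≤ G
    below le ¬sq = ℕ.≤-pred (ℕ.≤∧≢⇒< le λ { refl → ¬sq sq })
  ... | M , M≢0 , c , x₀ , h | no ¬sqG = extend (killer (suc G) (λ ()) ¬sqG DMG DMG≢0)
    where
    DMG = D ℕ.* (M ℕ.* suc G)
    DMG≢0 : DMG ≢ 0
    DMG≢0 e = ℕ.≢-nonZero⁻¹ DMG {{ℕ.m*n≢0 D (M ℕ.* suc G) {{ℕ.≢-nonZero D≢0}} {{ℕ.m*n≢0 M (suc G) {{ℕ.≢-nonZero M≢0}}}}}} e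
    extend : Killer (suc G) DMG → Σ ℕ λ M → M ≢ 0 × Coprime D M × Σ ℤ λ x₀ →
      ∀ {x} → x ≋ x₀ [ M ] → ∀ {g} → g ℕ.≤ suc G → ¬ Square g → ∀ {A v} → A ℕ.∣ D → InE v → x * x + + g ≢ + A * + v
    extend κ = M ℕ.* (ℓ ℕ.* ℓ) , M′≢0 , coprime-*ʳ c (coprime-*ʳ cD cD) , proj₁ x₁ , main
      where
      open Killer κ
      instance
        nzℓ : NonZero ℓ
        nzℓ = prime⇒nonZero prime
      cD : Coprime D ℓ
      cD = coprime-dvdˡ (ℕ.m∣m*n (M ℕ.* suc G)) coprime
      cM : Coprime M ℓ
      cM = coprime-dvdˡ (ℕ.∣n⇒∣m*n D (ℕ.m∣m*n (suc G))) coprime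
      cG : Coprime (suc G) ℓ
      cG = coprime-dvdˡ (ℕ.∣n⇒∣m*n D (ℕ.n∣m*n M)) coprime
      M′≢0 : M ℕ.* (ℓ ℕ.* ℓ) ≢ 0
      M′≢0 e = ℕ.≢-nonZero⁻¹ (M ℕ.* (ℓ ℕ.* ℓ)) {{ℕ.m*n≢0 M (ℓ ℕ.* ℓ) {{ℕ.≢-nonZero M≢0}} {{ℕ.m*n≢0 ℓ ℓ}}}} e
      ex = exact-root prime (odd-3mod4 ℓ ℓ%4≡3) (coprime⇒prime∤ prime (Coprimality.sym cG) ℕ.∣-refl) y root
      y₁ = proj₁ ex
      x₁ = crt {M} {ℓ ℕ.* ℓ} (coprime-*ʳ cM cM) x₀ y₁
      main : ∀ {x} → x ≋ proj₁ x₁ [ M ℕ.* (ℓ ℕ.* ℓ) ] → ∀ {g} → g ℕ.≤ suc G → ¬ Square g → ∀ {A v} → A ℕ.∣ D → InE v → x * x + + g ≢ + A * + v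
      main {x} e {g} le ¬sq {A} A∣D v∈ with ℕ.m≤n⇒m<n∨m≡n le
      ... | inj₁ (s≤s g≤G) = h (≋-trans (≋-dvd (ℕ.m∣m*n (ℓ ℕ.* ℓ)) e) (proj₁ (proj₂ x₁))) g≤G ¬sq A∣D v∈
      ... | inj₂ refl = killed prime ℓ%4≡3 {x} (≋-trans (≋-dvd (ℕ.m∣m*n ℓ) x≋) (proj₁ (proj₂ ex))) (λ z → proj₂ (proj₂ ex) (≋-trans (≋-sym x≋) z))
          (coprime⇒prime∤ prime (Coprimality.sym (coprime-dvdˡ A∣D cD)) ℕ.∣-refl) v∈
        where
        x≋y : x ≋ y₁ [ ℓ ℕ.* ℓ ]
        x≋y = ≋-trans (≋-dvd (ℕ.n∣m*n M) e) (proj₂ (proj₂ x₁))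
        x≋ : x * x + + suc G ≋ y₁ * y₁ + + suc G [ ℓ ℕ.* ℓ ]
        x≋ = ≋-+ʳ (+ suc G) (≋-* x≋y x≋y)

-- Two prescribed norms with a common coordinate modulo q.

module LocalSolutions where

  open Congruences
  open Nonresidues using (prime-divisor; split-power)
  open SumsOfTwoSquares using (prime-dvd-square)

  -1-Square : ℕ → Set
  -1-Square n = Σ ℤ λ ι → ι * ι + 1ℤ ≋ 0ℤ [ n ]

  -- Newton's iteration ι ↦ (ι³ + 3ι)/2 for the equation ι² = -1.
  -1-square-double : ∀ {n} → Coprime 2 n → -1-Square n → -1-Square (n ℕ.* n)
  -1-square-double {n} c (ι , quot q e) with coprime⇒inverse {2} {n ℕ.* n} (coprime-*ʳ c c)
  ... | h , 2h = j , cancel {+ 4} (h * h , ≋-trans (≋-reflexive (l₀ h)) (≋-* 2h 2h)) (begin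
    + 4 * (j * j + 1ℤ)                          ≡⟨ l₁ ι h ⟩
    κ * κ * ((+ 2 * h) * (+ 2 * h)) + + 4       ≈⟨ ≋-+ʳ (+ 4) (≋-*ˡ (κ * κ) (≋-* 2h 2h)) ⟩
    κ * κ * (1ℤ * 1ℤ) + + 4                     ≡⟨ l₂ ι ⟩
    (ι * ι + 1ℤ) * (ι * ι + 1ℤ) * (ι * ι + + 4) ≡⟨ cong (λ z → z * z * (ι * ι + + 4)) e ⟩
    (0ℤ + q * + n) * (0ℤ + q * + n) * (ι * ι + + 4) ≡⟨ l₃ q (+ n) (ι * ι + + 4) ⟩
    (q * q * (ι * ι + + 4)) * (+ n * + n)       ≡⟨ cong (λ z → (q * q * (ι * ι + + 4)) * z) (ℤ.pos-* n n) ⟨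
    (q * q * (ι * ι + + 4)) * + (n ℕ.* n)       ≈⟨ ≋-*ˡ (q * q * (ι * ι + + 4)) modulus≋0 ⟩
    (q * q * (ι * ι + + 4)) * 0ℤ                ≡⟨ ℤ.*-zeroʳ (q * q * (ι * ι + + 4)) ⟩
    + 4 * 0ℤ ∎)
    where
    open ≋-Reasoning (n ℕ.* n)
    κ = ι * ι * ι + + 3 * ι
    j = κ * h
    l₀ : ∀ h → + 4 * (h * h) ≡ (+ 2 * h) * (+ 2 * h)
    l₀ = solve-∀
    l₁ : ∀ ι h → + 4 * ((ι * ι * ι + + 3 * ι) * h * ((ι * ι * ι + + 3 * ι) * h) + 1ℤ)
      ≡ (ι * ι * ι + + 3 * ι) * (ι * ι * ι + + 3 * ι) * ((+ 2 * h) * (+ 2 * h)) + + 4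
    l₁ = solve-∀
    l₂ : ∀ ι → (ι * ι * ι + + 3 * ι) * (ι * ι * ι + + 3 * ι) * (1ℤ * 1ℤ) + + 4 ≡ (ι * ι + 1ℤ) * (ι * ι + 1ℤ) * (ι * ι + + 4)
    l₂ = solve-∀
    l₃ : ∀ q n r → (0ℤ + q * n) * (0ℤ + q * n) * r ≡ (q * q * r) * (n * n)
    l₃ = solve-∀

  -1-square-dvd : ∀ {m n} → m ℕ.∣ n → -1-Square n → -1-Square m
  -1-square-dvd d (ι , p) = ι , ≋-dvd d p

  -1-square-^ : ∀ {n} → Coprime 2 n → -1-Square n → ∀ e → -1-Square (n ℕ.^ e)
  -1-square-^ {n} c s zero = 0ℤ , quot 1ℤ refl
  -1-square-^ {n} c s (suc e) = -1-square-dvd (dvd e) (-1-square-double (coprime-^ʳ (suc e) c) (iter e))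
    where
    iter : ∀ e → -1-Square (n ℕ.^ suc e)
    iter zero    = -1-square-dvd (ℕ.∣-reflexive (ℕ.*-identityʳ n)) s
    iter (suc e) = -1-square-dvd (dvd₂ e) (-1-square-double (coprime-^ʳ (suc e) c) (iter e))
      where
      dvd₂ : ∀ e → n ℕ.^ suc (suc e) ℕ.∣ n ℕ.^ suc e ℕ.* n ℕ.^ suc e
      dvd₂ e = ℕ.*-monoˡ-∣ {n} {n ℕ.^ suc e} (n ℕ.^ suc e) (ℕ.m∣m*n (n ℕ.^ e))
    dvd : ∀ e → n ℕ.^ suc e ℕ.∣ n ℕ.^ suc e ℕ.* n ℕ.^ suc e
    dvd e = ℕ.m∣m*n (n ℕ.^ suc e)

  -1-square-* : ∀ {m n} → Coprime m n → -1-Square m → -1-Square n → -1-Square (m ℕ.* n)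
  -1-square-* {m} {n} c (ι , p) (ι′ , p′) = combine (crt c ι ι′)
    where
    combine : (Σ ℤ λ x → x ≋ ι [ m ] × x ≋ ι′ [ n ]) → -1-Square (m ℕ.* n)
    combine (x , e , e′) = x , ≋-coprime c (≋-trans (≋-+ʳ 1ℤ (≋-* e e)) p) (≋-trans (≋-+ʳ 1ℤ (≋-* e′ e′)) p′)

  unit-∣∣ : ∀ z {n} → Coprime ∣ z ∣ n → Coprimeᶻ z n
  unit-∣∣ (+ a) c = coprime⇒inverse c
  unit-∣∣ -[1+ a ] c with coprime⇒inverse c
  ... | i , p = - i , ≋-trans (≋-reflexive (l (+ suc a) i)) p
    where
    l : ∀ a i → - a * - i ≡ a * i
    l = solve-∀

  prime-unit : ∀ {ℓ} → Prime ℓ → ∀ e {z} → ¬ z ≋ 0ℤ [ ℓ ] → Coprimeᶻ z (ℓ ℕ.^ e)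
  prime-unit pr e {z} ¬z = unit-∣∣ z (coprime-^ʳ e (Coprimality.sym (prime∤⇒coprime pr (λ d → ¬z (∣∣⇒≋0 z d)))))

  ≋-scale : ∀ {a b n} c → a ≋ b [ n ] → + c * a ≋ + c * b [ c ℕ.* n ]
  ≋-scale {b = b} {n} c (quot q refl) = quot q (trans (l (+ c) b q (+ n)) (cong (λ z → + c * b + q * z) (sym (ℤ.pos-* c n))))
    where
    l : ∀ c b q n → c * (b + q * n) ≡ c * b + q * (c * n)
    l = solve-∀

  -- The form of the problem for a = u² + v² and b = s² + t². The factor m² + 1 stands for A up to
  -- squares, x for X, and k, k′ for the centres of the two clusters; x is common because both
  -- clusters use the same X.
  record Local (q : ℕ) (u v s t : ℤ) : Set where
    field
      m x k k′ : ℤ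
      unit     : Coprimeᶻ (m * m + 1ℤ) q
      left     : x * x + k * k ≋ (u * u + v * v) * (m * m + 1ℤ) [ q ]
      right    : x * x + k′ * k′ ≋ (s * s + t * t) * (m * m + 1ℤ) [ q ]

  unit-≋ : ∀ {a b n} → a ≋ b [ n ] → Coprimeᶻ b n → Coprimeᶻ a n
  unit-≋ e (i , p) = i , ≋-trans (≋-*ʳ i e) p

  local-* : ∀ {q r u v s t} → Coprime q r → Local q u v s t → Local r u v s t → Local (q ℕ.* r) u v s t
  local-* {q} {r} {u} {v} {s} {t} c L R = record
    { m = m₀ ; x = proj₁ X ; k = proj₁ K ; k′ = proj₁ K′
    ; unit = inv (unit-≋ (norm mq) L.unit) (unit-≋ (norm mr) R.unit)
    ; left = ≋-coprime c (both {x₁ = L.x} {k₁ = L.k} {m₁ = L.m} {a = u * u + v * v} (proj₁ (proj₂ X)) (proj₁ (proj₂ K)) mq L.left) (both {x₁ = R.x} {k₁ = R.k} {m₁ = R.m} {a = u * u + v * v} (proj₂ (proj₂ X)) (proj₂ (proj₂ K)) mr R.left)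
    ; right = ≋-coprime c (both {x₁ = L.x} {k₁ = L.k′} {m₁ = L.m} {a = s * s + t * t} (proj₁ (proj₂ X)) (proj₁ (proj₂ K′)) mq L.right) (both {x₁ = R.x} {k₁ = R.k′} {m₁ = R.m} {a = s * s + t * t} (proj₂ (proj₂ X)) (proj₂ (proj₂ K′)) mr R.right) }
    where
    module L = Local L
    module R = Local R
    M = crt c L.m R.m
    X = crt c L.x R.x
    K = crt c L.k R.k
    K′ = crt c L.k′ R.k′
    m₀ = proj₁ M
    mq = proj₁ (proj₂ M)
    mr = proj₂ (proj₂ M)
    norm : ∀ {n a b} → a ≋ b [ n ] → a * a + 1ℤ ≋ b * b + 1ℤ [ n ]
    norm e = ≋-+ʳ 1ℤ (≋-* e e)
    inv : ∀ {z} → Coprimeᶻ z q → Coprimeᶻ z r → Coprimeᶻ z (q ℕ.* r)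
    inv {z} (i , p) (j , p′) = combine (crt c i j)
      where
      combine : (Σ ℤ λ y → y ≋ i [ q ] × y ≋ j [ r ]) → Coprimeᶻ z (q ℕ.* r)
      combine (y , e , e′) = y , ≋-coprime c (≋-trans (≋-*ˡ z e) p) (≋-trans (≋-*ˡ z e′) p′)
    both : ∀ {n x₀ k₀ x₁ k₁ m₁ a} → x₀ ≋ x₁ [ n ] → k₀ ≋ k₁ [ n ] → m₀ ≋ m₁ [ n ] →
      x₁ * x₁ + k₁ * k₁ ≋ a * (m₁ * m₁ + 1ℤ) [ n ] → x₀ * x₀ + k₀ * k₀ ≋ a * (m₀ * m₀ + 1ℤ) [ n ]
    both {a = a} ex ek em e = ≋-trans (≋-+ (≋-* ex ex) (≋-* ek ek)) (≋-trans e (≋-*ˡ a (≋-sym (norm em))))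

  trivial : ∀ {u v s t} → Local 1 u v s t
  trivial = record { m = 0ℤ ; x = 0ℤ ; k = 0ℤ ; k′ = 0ℤ ; unit = 1ℤ , ≋-refl ; left = any ; right = any }
    where
    any : ∀ {a b} → a ≋ b [ 1 ]
    any {a} {b} = quot (a - b) (l a b)
      where
      l : ∀ a b → a ≡ b + (a - b) * 1ℤ
      l = solve-∀

  module PrimePower {ℓ : ℕ} (pr : Prime ℓ) (odd : ¬ 2 ℕ.∣ ℓ) where

    ≋0-2* : ∀ {z} → + 2 * z ≋ 0ℤ [ ℓ ] → z ≋ 0ℤ [ ℓ ]
    ≋0-2* {z} e with prime-≋0 pr (+ 2) z e
    ... | inj₂ z≋0 = z≋0
    ... | inj₁ two with prime⇒irreducible prime[2] (≋0⇒∣ two)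
    ...   | inj₁ refl = contradiction pr ¬prime[1]
    ...   | inj₂ refl = contradiction ℕ.∣-refl odd

    module _ (e : ℕ) where

      -- Division by β₂ turns the factor β₁² + β₂² into the shape m² + 1.
      normalise₂ : ∀ {u v s t} x k k′ β₁ β₂ → ¬ β₁ * β₁ + β₂ * β₂ ≋ 0ℤ [ ℓ ] → ¬ β₂ ≋ 0ℤ [ ℓ ] →
        x * x + k * k ≋ (u * u + v * v) * (β₁ * β₁ + β₂ * β₂) [ ℓ ℕ.^ e ] →
        x * x + k′ * k′ ≋ (s * s + t * t) * (β₁ * β₁ + β₂ * β₂) [ ℓ ℕ.^ e ] → Local (ℓ ℕ.^ e) u v s t
      normalise₂ {u} {v} {s} {t} x k k′ β₁ β₂ ¬B ¬β₂ p p′ with prime-unit pr e ¬β₂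
      ... | i , β₂i = record
        { m = β₁ * i ; x = x * i ; k = k * i ; k′ = k′ * i
        ; unit = unit-≋ (≋-sym norm) (B-unit (prime-unit pr e ¬B))
        ; left = scaled {u * u + v * v} {k} p ; right = scaled {s * s + t * t} {k′} p′ }
        where
        B = β₁ * β₁ + β₂ * β₂
        l : ∀ β₁ β₂ i → (β₁ * β₁ + β₂ * β₂) * (i * i) ≡ (β₁ * i) * (β₁ * i) + (β₂ * i) * (β₂ * i)
        l = solve-∀
        norm : B * (i * i) ≋ (β₁ * i) * (β₁ * i) + 1ℤ [ ℓ ℕ.^ e ]
        norm = ≋-trans (≋-reflexive (l β₁ β₂ i)) (≋-+ˡ ((β₁ * i) * (β₁ * i)) (≋-* β₂i β₂i))
        B-unit : Coprimeᶻ B (ℓ ℕ.^ e) → Coprimeᶻ (B * (i * i)) (ℓ ℕ.^ e)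
        B-unit (b , pb) = b * (β₂ * β₂) , ≋-trans (≋-reflexive (l′ B i b β₂)) (≋-* (≋-* pb β₂i) β₂i)
          where
          l′ : ∀ B i b β → B * (i * i) * (b * (β * β)) ≡ B * b * (β * i) * (β * i)
          l′ = solve-∀
        scaled : ∀ {a k} → x * x + k * k ≋ a * B [ ℓ ℕ.^ e ] → (x * i) * (x * i) + (k * i) * (k * i) ≋ a * ((β₁ * i) * (β₁ * i) + 1ℤ) [ ℓ ℕ.^ e ]
        scaled {a} {k} p = ≋-trans (≋-reflexive (l′ x k i)) (≋-trans (≋-*ʳ (i * i) p) (≋-trans (≋-reflexive (ℤ.*-assoc a B (i * i))) (≋-*ˡ a norm)))
          where
          l′ : ∀ x k i → (x * i) * (x * i) + (k * i) * (k * i) ≡ (x * x + k * k) * (i * i)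
          l′ = solve-∀

      normalise : ∀ {u v s t} x k k′ β₁ β₂ → ¬ β₁ * β₁ + β₂ * β₂ ≋ 0ℤ [ ℓ ] →
        x * x + k * k ≋ (u * u + v * v) * (β₁ * β₁ + β₂ * β₂) [ ℓ ℕ.^ e ] →
        x * x + k′ * k′ ≋ (s * s + t * t) * (β₁ * β₁ + β₂ * β₂) [ ℓ ℕ.^ e ] → Local (ℓ ℕ.^ e) u v s t
      normalise {u} {v} {s} {t} x k k′ β₁ β₂ ¬B p p′ with ≋0? ℓ β₂
      ... | no ¬β₂ = normalise₂ x k k′ β₁ β₂ ¬B ¬β₂ p p′
      ... | yes β₂≋0 = normalise₂ x k k′ β₂ β₁ (λ z → ¬B (≋-trans (≋-reflexive comm) z))
          (λ z → ¬B (≋-+ (≋-* z z) (≋-* β₂≋0 β₂≋0)))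
          (≋-trans p (≋-reflexive (cong (λ z → (u * u + v * v) * z) comm)))
          (≋-trans p′ (≋-reflexive (cong (λ z → (s * s + t * t) * z) comm)))
        where
        comm = ℤ.+-comm (β₁ * β₁) (β₂ * β₂)

      -- For z = (u, v) and ζ = (s, t), multiplying by i times the conjugate of w = ζ - z
      -- gives both numbers the same real part.
      separate : ∀ {u v s t} u′ v′ → u′ * u′ + v′ * v′ ≡ u * u + v * v →
        ¬ (s - u′) * (s - u′) + (t - v′) * (t - v′) ≋ 0ℤ [ ℓ ] → Local (ℓ ℕ.^ e) u v s t
      separate {u} {v} {s} {t} u′ v′ same ¬B = normalise (u′ * t - s * v′) ((s - u′) * u′ + (t - v′) * v′) ((s - u′) * s + (t - v′) * t) (s - u′) (t - v′) ¬B
        (≋-reflexive (trans (l₁ u′ v′ s t) (cong (λ z → z * ((s - u′) * (s - u′) + (t - v′) * (t - v′))) same))) (≋-reflexive (l₂ u′ v′ s t))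
        where
        l₁ : ∀ u v s t → (u * t - s * v) * (u * t - s * v) + ((s - u) * u + (t - v) * v) * ((s - u) * u + (t - v) * v)
          ≡ (u * u + v * v) * ((s - u) * (s - u) + (t - v) * (t - v))
        l₁ = solve-∀
        l₂ : ∀ u v s t → (u * t - s * v) * (u * t - s * v) + ((s - u) * s + (t - v) * t) * ((s - u) * s + (t - v) * t)
          ≡ (s * s + t * t) * ((s - u) * (s - u) + (t - v) * (t - v))
        l₂ = solve-∀

      -- Both norms vanish modulo ℓ and i := ι is available: in the split coordinates the numbers
      -- (1, a) and (b, 1) have norms a and b and an invertible difference.
      split-case : ∀ {u v s t} → -1-Square (ℓ ℕ.^ suc e) → u * u + v * v ≋ 0ℤ [ ℓ ] → s * s + t * t ≋ 0ℤ [ ℓ ] → Local (ℓ ℕ.^ e) u v s t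
      split-case {u} {v} {s} {t} (ι , ι²) a≋0 b≋0 = normalise (u₁ * t₁ - s₁ * v₁) ((s₁ - u₁) * u₁ + (t₁ - v₁) * v₁) ((s₁ - u₁) * s₁ + (t₁ - v₁) * t₁)
          (+ 2 * (s₁ - u₁)) (+ 2 * (t₁ - v₁)) ¬B
          (≋-trans (≋-reflexive (l₁ u₁ v₁ s₁ t₁)) (≋-trans (≋-*ʳ W (normed a)) (≋-reflexive (l₃ a (s₁ - u₁) (t₁ - v₁)))))
          (≋-trans (≋-reflexive (l₂ u₁ v₁ s₁ t₁)) (≋-trans (≋-*ʳ W (≋-trans (≋-reflexive (l₄ b ι)) (normed b))) (≋-reflexive (l₃ b (s₁ - u₁) (t₁ - v₁)))))
        where
        a = u * u + v * v
        b = s * s + t * t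
        u₁ = a + 1ℤ
        v₁ = ι * (a - 1ℤ)
        s₁ = b + 1ℤ
        t₁ = - (ι * (b - 1ℤ))
        W = (s₁ - u₁) * (s₁ - u₁) + (t₁ - v₁) * (t₁ - v₁)
        l₁ : ∀ u v s t → (u * t - s * v) * (u * t - s * v) + ((s - u) * u + (t - v) * v) * ((s - u) * u + (t - v) * v)
          ≡ (u * u + v * v) * ((s - u) * (s - u) + (t - v) * (t - v))
        l₁ = solve-∀
        l₂ : ∀ u v s t → (u * t - s * v) * (u * t - s * v) + ((s - u) * s + (t - v) * t) * ((s - u) * s + (t - v) * t)
          ≡ (s * s + t * t) * ((s - u) * (s - u) + (t - v) * (t - v))
        l₂ = solve-∀
        l₃ : ∀ a x y → + 4 * a * (x * x + y * y) ≡ a * ((+ 2 * x) * (+ 2 * x) + (+ 2 * y) * (+ 2 * y))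
        l₃ = solve-∀
        l₄ : ∀ b ι → (b + 1ℤ) * (b + 1ℤ) + - (ι * (b - 1ℤ)) * - (ι * (b - 1ℤ)) ≡ (b + 1ℤ) * (b + 1ℤ) + (ι * (b - 1ℤ)) * (ι * (b - 1ℤ))
        l₄ = solve-∀
        l₅ : ∀ a ι → (a + 1ℤ) * (a + 1ℤ) + (ι * (a - 1ℤ)) * (ι * (a - 1ℤ)) ≡ + 4 * a + (ι * ι + 1ℤ) * ((a - 1ℤ) * (a - 1ℤ))
        l₅ = solve-∀
        l₆ : ∀ a z → + 4 * a + 0ℤ * z ≡ + 4 * a
        l₆ = solve-∀
        normed : ∀ a → (a + 1ℤ) * (a + 1ℤ) + (ι * (a - 1ℤ)) * (ι * (a - 1ℤ)) ≋ + 4 * a [ ℓ ℕ.^ e ]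
        normed a = ≋-trans (≋-reflexive (l₅ a ι)) (≋-trans (≋-+ˡ (+ 4 * a) (≋-*ʳ ((a - 1ℤ) * (a - 1ℤ)) (≋-dvd (ℕ.n∣m*n ℓ) ι²))) (≋-reflexive (l₆ a ((a - 1ℤ) * (a - 1ℤ)))))
        l₇ : ∀ a b ι → (+ 2 * (b + 1ℤ - (a + 1ℤ))) * (+ 2 * (b + 1ℤ - (a + 1ℤ))) + (+ 2 * (- (ι * (b - 1ℤ)) - ι * (a - 1ℤ))) * (+ 2 * (- (ι * (b - 1ℤ)) - ι * (a - 1ℤ)))
          ≡ (ι * ι + 1ℤ) * (+ 4 * ((a + b - + 2) * (a + b - + 2))) + a * (+ 16 - + 16 * b) + b * + 16 - + 2 * (+ 2 * (+ 2 * (+ 2 * 1ℤ)))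
        l₇ = solve-∀
        l₉ : ∀ p q → q ≡ p - (p - q)
        l₉ = solve-∀
        ¬B : ¬ (+ 2 * (s₁ - u₁)) * (+ 2 * (s₁ - u₁)) + (+ 2 * (t₁ - v₁)) * (+ 2 * (t₁ - v₁)) ≋ 0ℤ [ ℓ ]
        ¬B z = ¬one (≋0-2* (≋0-2* (≋0-2* (≋0-2* (≋-trans (≋-reflexive (l₉ rest sixteen))
            (≋-- (≋-trans (≋-+ (≋-+ (≋-*ʳ (+ 4 * ((a + b - + 2) * (a + b - + 2))) (≋-dvd (ℕ.m∣m*n (ℓ ℕ.^ e)) ι²)) (≋-*ʳ (+ 16 - + 16 * b) a≋0)) (≋-*ʳ (+ 16) b≋0)) (≋-reflexive (l₁₀ (+ 4 * ((a + b - + 2) * (a + b - + 2))) (+ 16 - + 16 * b))))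
                 (≋-trans (≋-reflexive (sym (l₇ a b ι))) z)))))))
          where
          sixteen = + 2 * (+ 2 * (+ 2 * (+ 2 * 1ℤ)))
          rest = (ι * ι + 1ℤ) * (+ 4 * ((a + b - + 2) * (a + b - + 2))) + a * (+ 16 - + 16 * b) + b * + 16
          l₁₀ : ∀ x y → 0ℤ * x + 0ℤ * y + 0ℤ * + 16 ≡ 0ℤ
          l₁₀ = solve-∀
          ¬one : ¬ 1ℤ ≋ 0ℤ [ ℓ ]
          ¬one d = ¬prime[1] (subst Prime (ℕ.∣1⇒≡1 (≋0⇒∣ d)) pr)

    root-of-ratio : ∀ {u v} → u * u + v * v ≋ 0ℤ [ ℓ ] → ¬ u ≋ 0ℤ [ ℓ ] → -1-Square ℓ
    root-of-ratio {u} {v} z ¬u with prime-unit pr 1 ¬u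
    ... | i , ui = v * i , ≋-trans (≋-+ˡ ((v * i) * (v * i)) (≋-sym (≋-* ui′ ui′))) (≋-trans (≋-reflexive (l u v i)) (≋-trans (≋-*ˡ (i * i) z) (≋-reflexive (ℤ.*-zeroʳ (i * i)))))
      where
      ui′ : u * i ≋ 1ℤ [ ℓ ]
      ui′ = ≋-dvd (ℕ.m∣m*n 1) ui
      l : ∀ u v i → (v * i) * (v * i) + (u * i) * (u * i) ≡ (i * i) * (u * u + v * v)
      l = solve-∀

    other-zero : ∀ {u v} → u * u + v * v ≋ 0ℤ [ ℓ ] → u ≋ 0ℤ [ ℓ ] → v ≋ 0ℤ [ ℓ ]
    other-zero {u} {v} z u≋0 = prime-dvd-square pr (≋-trans (≋-reflexive (l u v)) (≋-- z (≋-*ʳ u u≋0)))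
      where
      l : ∀ u v → v * v ≡ u * u + v * v - u * u
      l = solve-∀

    odd-coprime : Coprime 2 ℓ
    odd-coprime = prime∤⇒coprime prime[2] odd

    -- The four associates of z = (u, v) have the same norm, so `separate` has four chances. If all
    -- fail, a + b and a b vanish modulo ℓ, hence both norms a and b do. A coordinate prime to ℓ
    -- then yields a square root of -1 and the split case; otherwise all coordinates are divisible
    -- by ℓ.
    local-prime-power : ∀ e u v s t → Local (ℓ ℕ.^ e) u v s t
    local-prime-power zero u v s t = trivial
    local-prime-power (suc e) u v s t = try (≋0? ℓ (B u v)) (≋0? ℓ (B (- u) (- v))) (≋0? ℓ (B (- v) u)) (≋0? ℓ (B v (- u)))
      where
      B : ℤ → ℤ → ℤ
      B u v = (s - u) * (s - u) + (t - v) * (t - v)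
      a = u * u + v * v
      b = s * s + t * t
      R = u * s + v * t
      I = u * t - v * s
      s₁ : ∀ u v → - u * - u + - v * - v ≡ u * u + v * v
      s₁ = solve-∀
      s₂ : ∀ u v → - v * - v + u * u ≡ u * u + v * v
      s₂ = solve-∀
      s₃ : ∀ u v → v * v + - u * - u ≡ u * u + v * v
      s₃ = solve-∀
      degenerate : a ≋ 0ℤ [ ℓ ] → b ≋ 0ℤ [ ℓ ] → Local (ℓ ℕ.^ suc e) u v s t
      degenerate a≋0 b≋0 with ≋0? ℓ u | ≋0? ℓ s
      ... | no ¬u | _ = split-case (suc e) {u} {v} {s} {t} (-1-square-^ odd-coprime (root-of-ratio {u} {v} a≋0 ¬u) (suc (suc e))) a≋0 b≋0
      ... | yes _ | no ¬s = split-case (suc e) {u} {v} {s} {t} (-1-square-^ odd-coprime (root-of-ratio {s} {t} b≋0 ¬s) (suc (suc e))) a≋0 b≋0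
      ... | yes u≋0 | yes s≋0 = divide e u≋0 (other-zero {u} {v} a≋0 u≋0) s≋0 (other-zero {s} {t} b≋0 s≋0)
        where
        divide : ∀ e {u v s t} → u ≋ 0ℤ [ ℓ ] → v ≋ 0ℤ [ ℓ ] → s ≋ 0ℤ [ ℓ ] → t ≋ 0ℤ [ ℓ ] → Local (ℓ ℕ.^ suc e) u v s t
        divide zero {u} {v} {s} {t} u≋ v≋ s≋ t≋ = record
          { m = 0ℤ ; x = 0ℤ ; k = 0ℤ ; k′ = 0ℤ ; unit = 1ℤ , ≋-refl ; left = zeros u≋ v≋ ; right = zeros s≋ t≋ }
          where
          zeros : ∀ {u v} → u ≋ 0ℤ [ ℓ ] → v ≋ 0ℤ [ ℓ ] → 0ℤ ≋ (u * u + v * v) * 1ℤ [ ℓ ℕ.^ 1 ]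
          zeros p q = ≋-sym (≋-dvd (ℕ.∣-reflexive (ℕ.*-identityʳ ℓ)) (≋-*ʳ 1ℤ (≋-+ (≋-* p p) (≋-* q q))))
        divide (suc zero) {u} {v} {s} {t} u≋ v≋ s≋ t≋ = record
          { m = 0ℤ ; x = 0ℤ ; k = 0ℤ ; k′ = 0ℤ ; unit = 1ℤ , ≋-refl ; left = zeros u≋ v≋ ; right = zeros s≋ t≋ }
          where
          square≋0 : ∀ {u} → u ≋ 0ℤ [ ℓ ] → u * u ≋ 0ℤ [ ℓ ℕ.* (ℓ ℕ.* 1) ]
          square≋0 (quot q refl) = ≋-trans (≋-reflexive (l q (+ ℓ))) (≋-trans (≋-scale ℓ (≋-scale {q * q * 1ℤ} {0ℤ} ℓ (quot (q * q) (l′ (q * q))))) (≋-reflexive (l″ (+ ℓ))))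
            where
            l : ∀ q L → (0ℤ + q * L) * (0ℤ + q * L) ≡ L * (L * (q * q * 1ℤ))
            l = solve-∀
            l′ : ∀ q → q * 1ℤ ≡ 0ℤ + q * 1ℤ
            l′ = solve-∀
            l″ : ∀ L → L * (L * 0ℤ) ≡ 0ℤ
            l″ = solve-∀
          zeros : ∀ {u v} → u ≋ 0ℤ [ ℓ ] → v ≋ 0ℤ [ ℓ ] → 0ℤ ≋ (u * u + v * v) * 1ℤ [ ℓ ℕ.^ 2 ]
          zeros p q = ≋-sym (≋-*ʳ 1ℤ (≋-+ (square≋0 p) (square≋0 q)))
        -- Removing a factor ℓ from all four coordinates removes ℓ² from both norms, so the exponent
        -- of the modulus drops by 2; exponents 1 and 2 are solved by zeros.
        divide (suc (suc e)) (quot u′ refl) (quot v′ refl) (quot s′ refl) (quot t′ refl) = scale (local-prime-power (suc e) u′ v′ s′ t′)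
          where
          L = + ℓ
          scale : Local (ℓ ℕ.^ suc e) u′ v′ s′ t′ → Local (ℓ ℕ.^ suc (suc (suc e))) (0ℤ + u′ * L) (0ℤ + v′ * L) (0ℤ + s′ * L) (0ℤ + t′ * L)
          scale ρ = record { m = m ; x = L * x ; k = L * k ; k′ = L * k′ ; unit = prime-unit pr (suc (suc (suc e))) (nonzero unit) ; left = go {k} {u′} {v′} left ; right = go {k′} {s′} {t′} right }
            where
            open Local ρ
            nonzero : ∀ {z} → Coprimeᶻ z (ℓ ℕ.^ suc e) → ¬ z ≋ 0ℤ [ ℓ ]
            nonzero (i , p) z≋0 = ¬prime[1] (subst Prime (ℕ.∣1⇒≡1 (≋0⇒∣ (≋-trans (≋-sym (≋-dvd (ℕ.m∣m*n (ℓ ℕ.^ e)) p)) (≋-trans (≋-*ʳ i z≋0) (≋-reflexive (ℤ.*-zeroˡ i)))))) pr)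
            go : ∀ {k u v} → x * x + k * k ≋ (u * u + v * v) * (m * m + 1ℤ) [ ℓ ℕ.^ suc e ] →
              (L * x) * (L * x) + (L * k) * (L * k) ≋ ((0ℤ + u * L) * (0ℤ + u * L) + (0ℤ + v * L) * (0ℤ + v * L)) * (m * m + 1ℤ) [ ℓ ℕ.^ suc (suc (suc e)) ]
            go {k} {u} {v} p = ≋-trans (≋-reflexive (l₁ L x k)) (≋-trans (≋-scale ℓ (≋-scale ℓ p)) (≋-reflexive (l₂ L u v m)))
              where
              l₁ : ∀ L x k → (L * x) * (L * x) + (L * k) * (L * k) ≡ L * (L * (x * x + k * k))
              l₁ = solve-∀
              l₂ : ∀ L u v m → L * (L * ((u * u + v * v) * (m * m + 1ℤ))) ≡ ((0ℤ + u * L) * (0ℤ + u * L) + (0ℤ + v * L) * (0ℤ + v * L)) * (m * m + 1ℤ)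
              l₂ = solve-∀
      all-zero : B u v ≋ 0ℤ [ ℓ ] → B (- u) (- v) ≋ 0ℤ [ ℓ ] → B (- v) u ≋ 0ℤ [ ℓ ] → B v (- u) ≋ 0ℤ [ ℓ ] → Local (ℓ ℕ.^ suc e) u v s t
      all-zero z₁ z₂ z₃ z₄ = finish (prime-≋0 pr a b ab≋0)
        where
        R≋0 : R ≋ 0ℤ [ ℓ ]
        R≋0 = ≋0-2* (≋0-2* (≋-trans (≋-reflexive (l u v s t)) (≋-- z₂ z₁)))
          where
          l : ∀ u v s t → + 2 * (+ 2 * (u * s + v * t)) ≡ ((s - - u) * (s - - u) + (t - - v) * (t - - v)) - ((s - u) * (s - u) + (t - v) * (t - v))
          l = solve-∀
        I≋0 : I ≋ 0ℤ [ ℓ ]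
        I≋0 = ≋0-2* (≋0-2* (≋-trans (≋-reflexive (l u v s t)) (≋-- z₄ z₃)))
          where
          l : ∀ u v s t → + 2 * (+ 2 * (u * t - v * s)) ≡ ((s - v) * (s - v) + (t - - u) * (t - - u)) - ((s - - v) * (s - - v) + (t - u) * (t - u))
          l = solve-∀
        sum≋0 : a + b ≋ 0ℤ [ ℓ ]
        sum≋0 = ≋0-2* (≋-trans (≋-reflexive (l u v s t)) (≋-+ z₁ z₂))
          where
          l : ∀ u v s t → + 2 * (u * u + v * v + (s * s + t * t)) ≡ ((s - u) * (s - u) + (t - v) * (t - v)) + ((s - - u) * (s - - u) + (t - - v) * (t - - v))
          l = solve-∀
        ab≋0 : a * b ≋ 0ℤ [ ℓ ]
        ab≋0 = ≋-trans (≋-reflexive (l u v s t)) (≋-+ (≋-* R≋0 R≋0) (≋-* I≋0 I≋0))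
          where
          l : ∀ u v s t → (u * u + v * v) * (s * s + t * t) ≡ (u * s + v * t) * (u * s + v * t) + (u * t - v * s) * (u * t - v * s)
          l = solve-∀
        l₁ : ∀ a b → b ≡ a + b - a
        l₁ = solve-∀
        l₂ : ∀ a b → a ≡ a + b - b
        l₂ = solve-∀
        finish : a ≋ 0ℤ [ ℓ ] ⊎ b ≋ 0ℤ [ ℓ ] → Local (ℓ ℕ.^ suc e) u v s t
        finish (inj₁ a≋0) = degenerate a≋0 (≋-trans (≋-reflexive (l₁ a b)) (≋-- sum≋0 a≋0))
        finish (inj₂ b≋0) = degenerate (≋-trans (≋-reflexive (l₂ a b)) (≋-- sum≋0 b≋0)) b≋0
      try : Dec (B u v ≋ 0ℤ [ ℓ ]) → Dec (B (- u) (- v) ≋ 0ℤ [ ℓ ]) → Dec (B (- v) u ≋ 0ℤ [ ℓ ]) → Dec (B v (- u) ≋ 0ℤ [ ℓ ]) → Local (ℓ ℕ.^ suc e) u v s t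
      try (no ¬B) _ _ _ = separate (suc e) u v refl ¬B
      try (yes _) (no ¬B) _ _ = separate (suc e) (- u) (- v) (s₁ u v) ¬B
      try (yes _) (yes _) (no ¬B) _ = separate (suc e) (- v) u (s₂ u v) ¬B
      try (yes _) (yes _) (yes _) (no ¬B) = separate (suc e) v (- u) (s₃ u v) ¬B
      try (yes z₁) (yes z₂) (yes z₃) (yes z₄) = all-zero z₁ z₂ z₃ z₄

  local : ∀ q → q ≢ 0 → ¬ 2 ℕ.∣ q → ∀ u v s t → Local q u v s t
  local = <-rec Goal go
    where
    Goal : ℕ → Set
    Goal q = q ≢ 0 → ¬ 2 ℕ.∣ q → ∀ u v s t → Local q u v s t
    go : ∀ q → (∀ {r} → r ℕ.< q → Goal r) → Goal q
    go q rec q≢0 odd u v s t with q ℕ.≟ 1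
    ... | yes refl = trivial
    ... | no q≢1 with prime-divisor q q≢0 q≢1
    ... | ℓ , pr , ℓ∣q with split-power pr q q≢0
    ... | e , m , refl , ℓ∤m = local-* (coprime-^ˡ e (prime∤⇒coprime pr ℓ∤m))
        (PrimePower.local-prime-power pr (λ d → odd (ℕ.∣-trans d ℓ∣q)) e u v s t)
        (rec m<q m≢0 (λ d → odd (ℕ.∣n⇒∣m*n (ℓ ℕ.^ e) d)) u v s t)
      where
      m≢0 : m ≢ 0
      m≢0 refl = q≢0 (ℕ.*-zeroʳ (ℓ ℕ.^ e))
      m<q : m ℕ.< ℓ ℕ.^ e ℕ.* m
      m<q = ℕ.≤∧≢⇒< (ℕ.m≤n*m m (ℓ ℕ.^ e) {{ℕ.m^n≢0 ℓ e {{prime⇒nonZero pr}}}}) (λ eq → ℓ∤m (subst (ℓ ℕ.∣_) (sym eq) ℓ∣q))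

-- Square roots of R² modulo Π as signed sums.

module SignedSums where

  open Congruences
  open SumsOfTwoSquares using (quotient-InE; -1-square⇒InE; InE-fromℤ)
  open LocalSolutions using (-1-Square; -1-square-^; -1-square-*; prime-unit)

  -- Moduli D Π R s: Π is a product of s powers Q of distinct primes not dividing D, and R is the sum
  -- of the numbers c Π / Q.
  data Moduli (D : ℕ) : ℕ → ℕ → ℕ → Set where
    []   : Moduli D 1 0 0
    cons : ∀ {Π R s} p e c → Prime p → -1-Square p → Coprime D p → Coprime p c → Moduli (D ℕ.* p) Π R s →
           Moduli D (p ℕ.^ e ℕ.* Π) (c ℕ.* Π ℕ.+ p ℕ.^ e ℕ.* R) (suc s)

  -- The numbers Σ ± c Π / Q, one sign for each prime power.
  data Signed : ∀ {D Π R s} → Moduli D Π R s → ℤ → Set where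
    nil   : ∀ {D} → Signed ([] {D}) 0ℤ
    plus  : ∀ {D Π R s p e c pr ι} {cD : Coprime D p} {cp : Coprime p c} {σ} {t : Moduli (D ℕ.* p) Π R s} → Signed t σ →
            Signed (cons p e c pr ι cD cp t) (+ (c ℕ.* Π) + + (p ℕ.^ e) * σ)
    minus : ∀ {D Π R s p e c pr ι} {cD : Coprime D p} {cp : Coprime p c} {σ} {t : Moduli (D ℕ.* p) Π R s} → Signed t σ →
            Signed (cons p e c pr ι cD cp t) (- (+ (c ℕ.* Π)) + + (p ℕ.^ e) * σ)

  moduli-coprime : ∀ {D Π R s} → Moduli D Π R s → Coprime D Π
  moduli-coprime [] = Coprimality.sym (Coprimality.1-coprimeTo _)
  moduli-coprime (cons p e c _ _ cD _ t) = coprime-*ʳ (coprime-^ʳ e cD) (coprime-dvdˡ (ℕ.m∣m*n p) (moduli-coprime t))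

  moduli-≢0 : ∀ {D Π R s} → Moduli D Π R s → NonZero Π
  moduli-≢0 [] = _
  moduli-≢0 (cons {Π} p e c pr _ _ _ t) = ℕ.m*n≢0 (p ℕ.^ e) Π {{ℕ.m^n≢0 p e {{prime⇒nonZero pr}}}} {{moduli-≢0 t}}

  -1-square-moduli : ∀ {D Π R s} → 2 ℕ.∣ D → Moduli D Π R s → -1-Square Π
  -1-square-moduli _ [] = 0ℤ , quot 1ℤ refl
  -1-square-moduli {D} 2∣D (cons p e c pr ι cD _ t) =
    -1-square-* (coprime-^ˡ e (coprime-dvdˡ (ℕ.n∣m*n D) (moduli-coprime t))) (-1-square-^ (coprime-dvdˡ 2∣D cD) ι e)
      (-1-square-moduli (ℕ.∣-trans 2∣D (ℕ.m∣m*n p)) t)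

  QuotientsInE : ℕ → Set
  QuotientsInE n = ∀ {v} X K → X * X + K * K ≡ + n * + v → InE v

  -- Dividing by m leaves n v in 𝐄, a new sum of two squares to which the division by n applies.
  quotients-* : ∀ m n → QuotientsInE m → QuotientsInE n → QuotientsInE (m ℕ.* n)
  quotients-* m n hm hn {v} X K e = outer (hm {n ℕ.* v} X K (trans e (trans (cong (_* + v) (ℤ.pos-* m n)) (trans (ℤ.*-assoc (+ m) (+ n) (+ v)) (cong (λ z → + m * z) (sym (ℤ.pos-* n v)))))))
    where
    outer : InE (n ℕ.* v) → InE v
    outer (a , b , e′) = hn {v} (+ a) (+ b) (trans (sym (trans (ℤ.pos-+ (a ℕ.* a) _) (cong₂ _+_ (ℤ.pos-* a a) (ℤ.pos-* b b)))) (trans (cong +_ e′) (ℤ.pos-* n v)))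

  quotients-1 : QuotientsInE 1
  quotients-1 {v} X K e = InE-fromℤ X K (sym (trans e (ℤ.*-identityˡ (+ v))))

  quotients-^ : ∀ {p} → Prime p → -1-Square p → ∀ e → QuotientsInE (p ℕ.^ e)
  quotients-^ pr ι zero = quotients-1
  quotients-^ {p} pr ι (suc e) = quotients-* p (p ℕ.^ e)
    (quotient-InE pr (-1-square⇒InE {{prime⇒nonZero pr}} (proj₁ ι) (proj₂ ι))) (quotients-^ pr ι e)

  quotients-moduli : ∀ {D Π R s} → Moduli D Π R s → QuotientsInE Π
  quotients-moduli [] = quotients-1
  quotients-moduli (cons {Π} p e c pr ι _ _ t) = quotients-* (p ℕ.^ e) Π (quotients-^ pr ι e) (quotients-moduli t)

  -- Since 2a is a unit, p cannot divide both k - a and k + a; one of them is a unit and the other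
  -- takes the whole power p^e.
  prime-power-roots : ∀ {p} → Prime p → ¬ 2 ℕ.∣ p → ∀ e {a} → ¬ a ≋ 0ℤ [ p ] → ∀ k → k * k ≋ a * a [ p ℕ.^ e ] →
    k ≋ a [ p ℕ.^ e ] ⊎ k ≋ - a [ p ℕ.^ e ]
  prime-power-roots {p} pr odd e {a} ¬a k eq = go (≋0? p (k - a))
    where
    factored : (k - a) * (k + a) ≋ 0ℤ [ p ℕ.^ e ]
    factored = ≋-trans (≋-reflexive (l k a)) (≋-sub eq)
      where
      l : ∀ k a → (k - a) * (k + a) ≡ k * k - a * a
      l = solve-∀
    kill : ∀ {x y} → Coprimeᶻ x (p ℕ.^ e) → x * y ≋ 0ℤ [ p ℕ.^ e ] → y ≋ 0ℤ [ p ℕ.^ e ]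
    kill {x} u z = cancel u (≋-trans z (≋-reflexive (sym (ℤ.*-zeroʳ x))))
    go : Dec (k - a ≋ 0ℤ [ p ]) → k ≋ a [ p ℕ.^ e ] ⊎ k ≋ - a [ p ℕ.^ e ]
    go (no ¬z) = inj₂ (≋-sub⁻ (≋-trans (≋-reflexive (l k a)) (kill (prime-unit pr e ¬z) factored)))
      where
      l : ∀ k a → k - - a ≡ k + a
      l = solve-∀
    go (yes z) = inj₁ (≋-sub⁻ (kill (prime-unit pr e ¬sum) (≋-trans (≋-reflexive (ℤ.*-comm (k + a) (k - a))) factored)))
      where
      l : ∀ k a → + 2 * a ≡ k + a - (k - a)
      l = solve-∀
      ¬sum : ¬ k + a ≋ 0ℤ [ p ]
      ¬sum z′ with prime-≋0 pr (+ 2) a (≋-trans (≋-reflexive (l k a)) (≋-- z′ z))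
      ... | inj₂ a≋0 = ¬a a≋0
      ... | inj₁ two with prime⇒irreducible prime[2] (≋0⇒∣ two)
      ...   | inj₁ refl = ¬prime[1] pr
      ...   | inj₂ refl = odd ℕ.∣-refl

  module _ {Q Π c R : ℕ} where

    pos-R : + (c ℕ.* Π ℕ.+ Q ℕ.* R) ≡ + (c ℕ.* Π) + + Q * + R
    pos-R = trans (ℤ.pos-+ (c ℕ.* Π) (Q ℕ.* R)) (cong (λ z → + (c ℕ.* Π) + z) (ℤ.pos-* Q R))

    drop-Q : ∀ x σ → x + + Q * σ ≋ x [ Q ]
    drop-Q x σ = ≋-trans (≋-+ˡ x (≋-trans (≋-*ʳ σ modulus≋0) (≋-reflexive (ℤ.*-zeroˡ σ)))) (≋-reflexive (ℤ.+-identityʳ x))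

    cΠ≋0 : + (c ℕ.* Π) ≋ 0ℤ [ Π ]
    cΠ≋0 = ∣⇒≋0 (ℕ.n∣m*n c)

    drop-Π : ∀ {x} → x ≋ 0ℤ [ Π ] → ∀ y → x + y ≋ y [ Π ]
    drop-Π e y = ≋-trans (≋-+ʳ y e) (≋-reflexive (ℤ.+-identityˡ y))

  -- Modulo Q only the summand c Π survives, which leaves a choice of sign. Modulo Π only Q R
  -- survives, and its factor Q is removed by an inverse before the remaining primes are treated.
  signed-roots : ∀ {D Π R s} → 2 ℕ.∣ D → (L : Moduli D Π R s) → ∀ k → k * k ≋ + R * + R [ Π ] → Σ ℤ λ σ → Signed L σ × k ≋ σ [ Π ]
  signed-roots _ [] k _ = 0ℤ , nil , quot k (l k)
    where
    l : ∀ k → k ≡ 0ℤ + k * 1ℤ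
    l = solve-∀
  signed-roots {D} 2∣D (cons {Π} {R} p e c pr ι cD cp t) k eq = combine
      (prime-power-roots pr (λ 2∣p → contradiction (cD (2∣D , 2∣p)) (λ ())) e ¬cΠ k rootQ)
      (signed-roots (ℕ.∣-trans 2∣D (ℕ.m∣m*n p)) t (k * i) rootΠ)
    where
    Q = p ℕ.^ e
    cpΠ : Coprime p Π
    cpΠ = coprime-dvdˡ (ℕ.n∣m*n D) (moduli-coprime t)
    cQΠ : Coprime Q Π
    cQΠ = coprime-^ˡ e cpΠ
    inv = coprime⇒inverse cQΠ
    i = Coprimeᶻ.inverse inv
    Qi = Coprimeᶻ.inverse-≋ inv
    ¬cΠ : ¬ + (c ℕ.* Π) ≋ 0ℤ [ p ]
    ¬cΠ z = coprime⇒prime∤ pr (coprime-*ʳ cp cpΠ) ℕ.∣-refl (≋0⇒∣ z)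
    R′ = + (c ℕ.* Π) + + Q * + R
    eq′ : k * k ≋ R′ * R′ [ Q ℕ.* Π ]
    eq′ = ≋-trans eq (≋-reflexive (cong (λ z → z * z) (pos-R {Q} {Π} {c} {R})))
    rootQ : k * k ≋ + (c ℕ.* Π) * + (c ℕ.* Π) [ Q ]
    rootQ = ≋-trans (≋-dvd (ℕ.m∣m*n Π) eq′) (≋-* (drop-Q {Q} {Π} {c} {R} (+ (c ℕ.* Π)) (+ R)) (drop-Q {Q} {Π} {c} {R} (+ (c ℕ.* Π)) (+ R)))
    R′≋ : R′ ≋ + Q * + R [ Π ]
    R′≋ = drop-Π {Q} {Π} {c} {R} (cΠ≋0 {Q} {Π} {c} {R}) (+ Q * + R)
    rootΠ : (k * i) * (k * i) ≋ + R * + R [ Π ]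
    rootΠ = begin
      (k * i) * (k * i)                     ≡⟨ l₁ k i ⟩
      (k * k) * (i * i)                     ≈⟨ ≋-*ʳ (i * i) (≋-trans (≋-dvd (ℕ.n∣m*n Q) eq′) (≋-* R′≋ R′≋)) ⟩
      (+ Q * + R) * (+ Q * + R) * (i * i)   ≡⟨ l₂ (+ Q) (+ R) i ⟩
      (+ Q * i) * (+ Q * i) * (+ R * + R)   ≈⟨ ≋-*ʳ (+ R * + R) (≋-* Qi Qi) ⟩
      1ℤ * 1ℤ * (+ R * + R)                 ≡⟨ ℤ.*-identityˡ (+ R * + R) ⟩
      + R * + R ∎
      where
      open ≋-Reasoning Π
      l₁ : ∀ k i → (k * i) * (k * i) ≡ (k * k) * (i * i)
      l₁ = solve-∀
      l₂ : ∀ Q R i → (Q * R) * (Q * R) * (i * i) ≡ (Q * i) * (Q * i) * (R * R)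
      l₂ = solve-∀
    back : ∀ {σ} → k * i ≋ σ [ Π ] → k ≋ + Q * σ [ Π ]
    back {σ} h = ≋-sym (≋-trans (≋-*ˡ (+ Q) (≋-sym h)) (≋-trans (≋-reflexive (l (+ Q) k i)) (≋-trans (≋-*ʳ k Qi) (≋-reflexive (ℤ.*-identityˡ k)))))
      where
      l : ∀ Q k i → Q * (k * i) ≡ Q * i * k
      l = solve-∀
    glue : ∀ {x σ} → x ≋ 0ℤ [ Π ] → k ≋ x [ Q ] → k * i ≋ σ [ Π ] → k ≋ x + + Q * σ [ Q ℕ.* Π ]
    glue {x} {σ} x≋0 h h′ = ≋-coprime cQΠ (≋-trans h (≋-sym (drop-Q {Q} {Π} {c} {R} x σ))) (≋-trans (back h′) (≋-sym (drop-Π {Q} {Π} {c} {R} x≋0 (+ Q * σ))))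
    combine : k ≋ + (c ℕ.* Π) [ Q ] ⊎ k ≋ - (+ (c ℕ.* Π)) [ Q ] → (Σ ℤ λ σ → Signed t σ × k * i ≋ σ [ Π ]) →
      Σ ℤ λ σ → Signed (cons p e c pr ι cD cp t) σ × k ≋ σ [ Q ℕ.* Π ]
    combine (inj₁ h) (σ , sg , h′) = + (c ℕ.* Π) + + Q * σ , plus sg , glue (cΠ≋0 {Q} {Π} {c} {R}) h h′
    combine (inj₂ h) (σ , sg , h′) = - (+ (c ℕ.* Π)) + + Q * σ , minus sg , glue (≋-neg (cΠ≋0 {Q} {Π} {c} {R})) h h′

  signed-square : ∀ {D Π R s} {L : Moduli D Π R s} {σ} → Signed L σ → σ * σ ≋ + R * + R [ Π ]
  signed-square nil = ≋-refl
  signed-square {D = D} {Π = Π′} {R = R′} {L = cons {Π} {R} p e c pr ι cD cp t} sg = go sg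
    where
    Q = p ℕ.^ e
    C = + (c ℕ.* Π)
    cQΠ : Coprime Q Π
    cQΠ = coprime-^ˡ e (coprime-dvdˡ (ℕ.n∣m*n D) (moduli-coprime t))
    squares : ∀ {x σ} → x ≋ 0ℤ [ Π ] → x * x ≡ C * C → σ * σ ≋ + R * + R [ Π ] →
      (x + + Q * σ) * (x + + Q * σ) ≋ (C + + Q * + R) * (C + + Q * + R) [ Q ℕ.* Π ]
    squares {x} {σ} x≋0 same ih = ≋-coprime cQΠ
      (≋-trans (≋-* (drop-Q {Q} {Π} {c} {R} x σ) (drop-Q {Q} {Π} {c} {R} x σ)) (≋-trans (≋-reflexive same) (≋-sym (≋-* (drop-Q {Q} {Π} {c} {R} C (+ R)) (drop-Q {Q} {Π} {c} {R} C (+ R))))))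
      (≋-trans (≋-* (drop-Π {Q} {Π} {c} {R} x≋0 (+ Q * σ)) (drop-Π {Q} {Π} {c} {R} x≋0 (+ Q * σ)))
        (≋-trans (≋-trans (≋-reflexive (l (+ Q) σ)) (≋-trans (≋-*ˡ (+ Q * + Q) ih) (≋-reflexive (sym (l (+ Q) (+ R))))))
          (≋-sym (≋-* (drop-Π {Q} {Π} {c} {R} (cΠ≋0 {Q} {Π} {c} {R}) (+ Q * + R)) (drop-Π {Q} {Π} {c} {R} (cΠ≋0 {Q} {Π} {c} {R}) (+ Q * + R))))))
      where
      l : ∀ Q σ → (Q * σ) * (Q * σ) ≡ (Q * Q) * (σ * σ)
      l = solve-∀
    target : (C + + Q * + R) * (C + + Q * + R) ≡ + R′ * + R′
    target = cong (λ z → z * z) (sym (pos-R {Q} {Π} {c} {R}))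
    go : ∀ {σ} → Signed (cons p e c pr ι cD cp t) σ → σ * σ ≋ + R′ * + R′ [ Π′ ]
    go (plus sg)  = ≋-trans (squares (cΠ≋0 {Q} {Π} {c} {R}) refl (signed-square sg)) (≋-reflexive target)
    go (minus sg) = ≋-trans (squares (≋-neg (cΠ≋0 {Q} {Π} {c} {R})) (l C) (signed-square sg)) (≋-reflexive target)
      where
      l : ∀ C → - C * - C ≡ C * C
      l = solve-∀

-- Size and order of signed sums, and the supply of primes.

module SignedSumBounds where

  open Congruences
  open SignedSums
  open Nonresidues using (prime-divisor; split-power)
  open LocalSolutions using (-1-Square)
  open import Data.Integer using (_≤_; _<_)

  signed-bound : ∀ {D Π R s} {L : Moduli D Π R s} {σ} → Signed L σ → ∣ σ ∣ ℕ.≤ R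
  signed-bound nil = z≤n
  signed-bound {L = cons {Π} {R} p e c _ _ _ _ t} sg = go sg
    where
    Q = p ℕ.^ e
    tail : ∀ {σ} → Signed t σ → ∣ + Q * σ ∣ ℕ.≤ Q ℕ.* R
    tail {σ} sg = ℕ.≤-trans (ℕ.≤-reflexive (ℤ.∣i*j∣≡∣i∣*∣j∣ (+ Q) σ)) (ℕ.*-monoʳ-≤ Q (signed-bound sg))
    go : ∀ {σ} → Signed (cons p e c _ _ _ _ t) σ → ∣ σ ∣ ℕ.≤ c ℕ.* Π ℕ.+ Q ℕ.* R
    go (plus {σ = σ} sg) = ℕ.≤-trans (ℤ.∣i+j∣≤∣i∣+∣j∣ (+ (c ℕ.* Π)) (+ Q * σ)) (ℕ.+-monoʳ-≤ (c ℕ.* Π) (tail sg))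
    go (minus {σ = σ} sg) = ℕ.≤-trans (ℤ.∣i+j∣≤∣i∣+∣j∣ (- (+ (c ℕ.* Π))) (+ Q * σ))
      (ℕ.+-mono-≤ (ℕ.≤-reflexive (ℤ.∣-i∣≡∣i∣ (+ (c ℕ.* Π)))) (tail sg))

  -- Turning the minus signs into plus signs one at a time gives s + 1 increasing signed sums, from
  -- the least to the greatest. They determine the length of a run.
  record Chain {D Π R s} (L : Moduli D Π R s) : Set where
    field
      at     : ℕ → ℤ
      signed : ∀ k → Signed L (at k)
      <-suc  : ∀ k → k ℕ.< s → at k < at (suc k)
      bottom : at 0 ≡ - (+ R)
      top    : at s ≡ + R

  chain : ∀ {D Π R s} (L : Moduli D Π R s) → Chain L
  chain [] = record { at = λ _ → 0ℤ ; signed = λ _ → nil ; <-suc = λ _ () ; bottom = refl ; top = refl }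
  chain (cons {Π} {R} {s} p e c pr ι cD cp t) = record
    { at = at′ ; signed = signed′ ; <-suc = increasing
    ; bottom = trans (at-low {0} z≤n) (trans (cong (λ z → - C + + Q * z) bottom) (trans (l C (+ Q) (+ R)) (cong -_ (sym (pos-R {Q} {Π} {c} {R})))))
    ; top = trans (at-high {suc s} ℕ.≤-refl) (trans (cong (λ z → C + + Q * z) top) (sym (pos-R {Q} {Π} {c} {R}))) }
    where
    open Chain (chain t)
    Q = p ℕ.^ e
    C = + (c ℕ.* Π)
    l : ∀ C Q R → - C + Q * - R ≡ - (C + Q * R)
    l = solve-∀
    choose : ∀ {k} → Dec (k ℕ.≤ s) → ℤ
    choose {k} (yes _) = - C + + Q * at k
    choose {k} (no _)  = C + + Q * at s
    at′ : ℕ → ℤ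
    at′ k = choose {k} (k ℕ.≤? s)
    at-low : ∀ {k} → k ℕ.≤ s → at′ k ≡ - C + + Q * at k
    at-low {k} k≤s = go (k ℕ.≤? s)
      where
      go : (d : Dec (k ℕ.≤ s)) → choose {k} d ≡ - C + + Q * at k
      go (yes _) = refl
      go (no ¬p) = contradiction k≤s ¬p
    at-high : ∀ {k} → s ℕ.< k → at′ k ≡ C + + Q * at s
    at-high {k} s<k = go (k ℕ.≤? s)
      where
      go : (d : Dec (k ℕ.≤ s)) → choose {k} d ≡ C + + Q * at s
      go (no _) = refl
      go (yes p) = contradiction p (ℕ.<⇒≱ s<k)
    signed′ : ∀ k → Signed (cons p e c pr ι cD cp t) (at′ k)
    signed′ k = go (k ℕ.≤? s)
      where
      go : (d : Dec (k ℕ.≤ s)) → Signed (cons p e c pr ι cD cp t) (choose {k} d)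
      go (yes _) = minus (signed k)
      go (no _)  = plus (signed s)
    instance
      nzQ : NonZero Q
      nzQ = ℕ.m^n≢0 p e {{prime⇒nonZero pr}}
    0<C : 0ℤ < C
    0<C = Data.Integer.+<+ (ℕ.>-nonZero⁻¹ (c ℕ.* Π) {{ℕ.m*n≢0 c Π {{ℕ.≢-nonZero c≢0}} {{moduli-≢0 t}}}})
      where
      c≢0 : c ≢ 0
      c≢0 refl = ¬prime[1] (subst Prime (Coprimality.0-coprimeTo-m⇒m≡1 (Coprimality.sym cp)) pr)
    increasing : ∀ k → k ℕ.< suc s → at′ k < at′ (suc k)
    increasing k (s≤s k≤s) with ℕ.m≤n⇒m<n∨m≡n k≤s
    ... | inj₁ k<s = subst (_< at′ (suc k)) (sym (at-low k≤s)) (subst (- C + + Q * at k <_) (sym (at-low k<s))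
          (ℤ.+-monoʳ-< (- C) (ℤ.*-monoˡ-<-pos (+ Q) {{ℤ-pos Q}} (<-suc k k<s))))
      where
      ℤ-pos : ∀ n .{{_ : NonZero n}} → Data.Integer.Positive (+ n)
      ℤ-pos (suc n) = _
    ... | inj₂ refl = subst (_< at′ (suc s)) (sym (at-low {s} ℕ.≤-refl)) (subst (- C + + Q * at s <_) (sym (at-high {suc s} ℕ.≤-refl))
          (ℤ.+-monoˡ-< (+ Q * at s) (ℤ.<-trans (ℤ.neg-mono-< 0<C) 0<C)))

  AllC : ∀ {D Π R s} → ℕ → Moduli D Π R s → Set
  AllC q [] = ⊤
  AllC q (cons p e c _ _ _ _ t) = c ≡ q × AllC q t

  AllBig : ∀ {D Π R s} → ℕ → Moduli D Π R s → Set
  AllBig B [] = ⊤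
  AllBig B (cons p e c _ _ _ _ t) = B ℕ.≤ p ℕ.^ e × AllBig B t

  signed-≋0 : ∀ {D Π R s q} {L : Moduli D Π R s} → AllC q L → ∀ {σ} → Signed L σ → σ ≋ 0ℤ [ q ]
  signed-≋0 _ nil = ≋-refl
  signed-≋0 {q = q} (refl , allc) (plus {Π = Π} {p = p} {e = e} {σ = σ} sg) = ≋-+ (∣⇒≋0 (ℕ.m∣m*n Π)) (≋-trans (≋-*ˡ (+ (p ℕ.^ e)) (signed-≋0 allc sg)) (≋-reflexive (ℤ.*-zeroʳ (+ (p ℕ.^ e)))))
  signed-≋0 {q = q} (refl , allc) (minus {Π = Π} {p = p} {e = e} {σ = σ} sg) = ≋-+ (≋-neg (∣⇒≋0 (ℕ.m∣m*n Π))) (≋-trans (≋-*ˡ (+ (p ℕ.^ e)) (signed-≋0 allc sg)) (≋-reflexive (ℤ.*-zeroʳ (+ (p ℕ.^ e)))))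

  -- R / Π is the sum of s terms q / Q, each at most q / B.
  radius-small : ∀ {D Π R s q B} (L : Moduli D Π R s) → AllC q L → AllBig B L → B ℕ.* R ℕ.≤ s ℕ.* q ℕ.* Π
  radius-small {B = B} [] _ _ = ℕ.≤-reflexive (ℕ.*-zeroʳ B)
  radius-small {q = q} {B} (cons {Π} {R} {s} p e c _ _ _ _ t) (refl , allc) (big , bigs) = begin
    B ℕ.* (q ℕ.* Π ℕ.+ Q ℕ.* R)          ≡⟨ l₁ B (q ℕ.* Π) Q R ⟩
    B ℕ.* (q ℕ.* Π) ℕ.+ Q ℕ.* (B ℕ.* R)  ≤⟨ ℕ.+-mono-≤ (ℕ.*-monoˡ-≤ (q ℕ.* Π) big) (ℕ.*-monoʳ-≤ Q (radius-small t allc bigs)) ⟩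
    Q ℕ.* (q ℕ.* Π) ℕ.+ Q ℕ.* (s ℕ.* q ℕ.* Π) ≡⟨ l₂ Q q Π s ⟩
    suc s ℕ.* q ℕ.* (Q ℕ.* Π) ∎
    where
    open ℕ.≤-Reasoning
    Q = p ℕ.^ e
    l₁ : ∀ B x Q R → B ℕ.* (x ℕ.+ Q ℕ.* R) ≡ B ℕ.* x ℕ.+ Q ℕ.* (B ℕ.* R)
    l₁ = ℕR.solve-∀
    l₂ : ∀ Q q Π s → Q ℕ.* (q ℕ.* Π) ℕ.+ Q ℕ.* (s ℕ.* q ℕ.* Π) ≡ suc s ℕ.* q ℕ.* (Q ℕ.* Π)
    l₂ = ℕR.solve-∀

  -- A factorisation in which exponents may be 0, so that a list can be padded with further primes.
  data PrimeList (D : ℕ) : ℕ → ℕ → Set where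
    []   : PrimeList D 1 0
    cons : ∀ {n s} p v → Prime p → -1-Square p → Coprime D p → PrimeList (D ℕ.* p) n s → PrimeList D (p ℕ.^ v ℕ.* n) (suc s)

  -- A prime factor of D² + 1: it cannot divide D, and D itself is a square root of -1.
  new-prime : ∀ D → D ≢ 0 → Σ ℕ λ p → Prime p × -1-Square p × Coprime D p
  new-prime D D≢0 = check (prime-divisor (suc (D ℕ.* D)) (λ ()) (λ e → D≢0 (square-0 D (cong ℕ.pred e))))
    where
    square-0 : ∀ D → D ℕ.* D ≡ 0 → D ≡ 0
    square-0 zero _ = refl
    check : (Σ ℕ λ p → Prime p × p ℕ.∣ suc (D ℕ.* D)) → Σ ℕ λ p → Prime p × -1-Square p × Coprime D p
    check (p , pr , p∣) = p , pr , (+ D , ≋-trans (≋-reflexive eq) (∣⇒≋0 p∣)) ,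
      Coprimality.sym (prime∤⇒coprime pr (λ p∣D → ¬prime[1] (subst Prime (ℕ.∣1⇒≡1 (ℕ.∣m+n∣m⇒∣n (subst (p ℕ.∣_) (ℕ.+-comm 1 (D ℕ.* D)) p∣) (ℕ.∣m⇒∣m*n D p∣D))) pr)))
      where
      eq : + D * + D + 1ℤ ≡ + suc (D ℕ.* D)
      eq = trans (cong (λ z → z + 1ℤ) (sym (ℤ.pos-* D D))) (cong +_ (ℕ.+-comm (D ℕ.* D) 1))

  ≢0-* : ∀ {m n} → m ≢ 0 → n ≢ 0 → m ℕ.* n ≢ 0
  ≢0-* {m} {n} m≢0 n≢0 e = ℕ.≢-nonZero⁻¹ (m ℕ.* n) {{ℕ.m*n≢0 m n {{ℕ.≢-nonZero m≢0}} {{ℕ.≢-nonZero n≢0}}}} e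

  prime≢0 : ∀ {p} → Prime p → p ≢ 0
  prime≢0 {p} pr = ℕ.≢-nonZero⁻¹ p {{prime⇒nonZero pr}}

  extra-primes : ∀ D → D ≢ 0 → ∀ r → PrimeList D 1 r
  extra-primes D D≢0 zero = []
  extra-primes D D≢0 (suc r) with new-prime D D≢0
  ... | p , pr , ι , c = cons p 0 pr ι c (extra-primes (D ℕ.* p) (≢0-* D≢0 (prime≢0 pr)) r)

  prime-list : ∀ r n → n ≢ 0 → ∀ D → D ≢ 0 → Coprime D n → -1-Square n → Σ ℕ λ s → r ℕ.≤ s × PrimeList D n s
  prime-list r = <-rec Goal go
    where
    Goal : ℕ → Set
    Goal n = n ≢ 0 → ∀ D → D ≢ 0 → Coprime D n → -1-Square n → Σ ℕ λ s → r ℕ.≤ s × PrimeList D n s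
    go : ∀ n → (∀ {m} → m ℕ.< n → Goal m) → Goal n
    go n rec n≢0 D D≢0 c ι with n ℕ.≟ 1
    ... | yes refl = r , ℕ.≤-refl , extra-primes D D≢0 r
    ... | no n≢1 with prime-divisor n n≢0 n≢1
    ... | p , pr , p∣n with split-power pr n n≢0
    ... | v , m , refl , p∤m = add (rec m<n m≢0 (D ℕ.* p) (≢0-* D≢0 (prime≢0 pr))
          (coprime-*ˡ (coprime-dvdʳ (ℕ.n∣m*n (p ℕ.^ v)) c) (prime∤⇒coprime pr p∤m)) (proj₁ ι , ≋-dvd (ℕ.n∣m*n (p ℕ.^ v)) (proj₂ ι)))
      where
      m≢0 : m ≢ 0
      m≢0 refl = p∤m (p ℕ.∣0)
      m<n : m ℕ.< p ℕ.^ v ℕ.* m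
      m<n = ℕ.≤∧≢⇒< (ℕ.m≤n*m m (p ℕ.^ v) {{ℕ.m^n≢0 p v {{prime⇒nonZero pr}}}}) (λ eq → p∤m (subst (p ℕ.∣_) (sym eq) p∣n))
      add : (Σ ℕ λ s → r ℕ.≤ s × PrimeList (D ℕ.* p) m s) → Σ ℕ λ s → r ℕ.≤ s × PrimeList D (p ℕ.^ v ℕ.* m) s
      add (s , r≤s , t) = suc s , ℕ.m≤n⇒m≤1+n r≤s , cons p v pr (proj₁ ι , ≋-dvd p∣n (proj₂ ι)) (coprime-dvdʳ p∣n c) t

  -- The exponents of n are raised by even amounts: every prime power becomes at least E while n
  -- changes only by a square, so the solution modulo q prepared for n survives by scaling.
  record Expansion (q E D n s : ℕ) : Set where
    field
      {Π R}   : ℕ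
      moduli  : Moduli D Π R s
      allC    : AllC q moduli
      allBig  : AllBig E moduli
      root    : ℕ
      Π≡      : Π ≡ n ℕ.* (root ℕ.* root)

  n≤2^n : ∀ n → n ℕ.≤ 2 ℕ.^ n
  n≤2^n zero    = z≤n
  n≤2^n (suc n) = ℕ.≤-trans (ℕ.+-mono-≤ (ℕ.m^n>0 2 n) (n≤2^n n)) (ℕ.≤-reflexive (cong (2 ℕ.^ n ℕ.+_) (sym (ℕ.+-identityʳ (2 ℕ.^ n)))))

  expand : ∀ {q D} E → q ℕ.∣ D → ∀ {n s} → PrimeList D n s → Expansion q E D n s
  expand E q∣D [] = record { moduli = [] ; allC = tt ; allBig = tt ; root = 1 ; Π≡ = refl }
  expand {q} {D} E q∣D (cons {n} p v pr ι cD t) = record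
    { moduli = cons p (v ℕ.+ (E ℕ.+ E)) q pr ι cD (Coprimality.sym (coprime-dvdˡ q∣D cD)) moduli
    ; allC = refl , allC
    ; allBig = big , allBig
    ; root = p ℕ.^ E ℕ.* root
    ; Π≡ = trans (cong₂ ℕ._*_ (trans (ℕ.^-distribˡ-+-* p v (E ℕ.+ E)) (cong (p ℕ.^ v ℕ.*_) (ℕ.^-distribˡ-+-* p E E))) Π≡) (l (p ℕ.^ v) (p ℕ.^ E) n root) }
    where
    open Expansion (expand E (ℕ.∣-trans q∣D (ℕ.m∣m*n p)) t)
    l : ∀ a b n r → a ℕ.* (b ℕ.* b) ℕ.* (n ℕ.* (r ℕ.* r)) ≡ a ℕ.* n ℕ.* (b ℕ.* r ℕ.* (b ℕ.* r))
    l = ℕR.solve-∀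
    big : E ℕ.≤ p ℕ.^ (v ℕ.+ (E ℕ.+ E))
    big = ℕ.≤-trans (n≤2^n E) (ℕ.≤-trans (ℕ.^-monoˡ-≤ E (ℕ.nonTrivial⇒n>1 p {{prime⇒nonTrivial pr}}))
      (ℕ.^-monoʳ-≤ p {{prime⇒nonZero pr}} (ℕ.≤-trans (ℕ.m≤m+n E E) (ℕ.m≤n+m (E ℕ.+ E) v))))

-- Which roots fall into the window.

module Windows where

  open import Data.Integer using (_≤_; _<_; +≤+; -≤+)

  i≤∣i∣ : ∀ i → i ≤ + ∣ i ∣
  i≤∣i∣ (+ n)    = ℤ.≤-refl
  i≤∣i∣ -[1+ n ] = -≤+

  <-split : ∀ {i j} → i < j → Σ ℕ λ n → j ≡ i + + suc n
  <-split {i} {j} i<j = ∣ j - (1ℤ + i) ∣ , trans (l i j) (cong (λ z → i + (1ℤ + z)) (sym (ℤ.0≤i⇒+∣i∣≡i (ℤ.i≤j⇒0≤j-i (ℤ.i<j⇒suc[i]≤j i<j)))))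
    where
    l : ∀ i j → j ≡ i + (1ℤ + (j - (1ℤ + i)))
    l = solve-∀

  shift-≤ : ∀ {X Y} n {Z} → X ≤ Y → n + (Y - X) ≡ Z → n ≤ Z
  shift-≤ n le eq = ℤ.≤-trans (ℤ.≤-reflexive (sym (ℤ.+-identityʳ n))) (ℤ.≤-trans (ℤ.+-monoʳ-≤ n (ℤ.i≤j⇒0≤j-i le)) (ℤ.≤-reflexive eq))

  -- Roots have the form A (± c + Q m) + τ with |τ| ≤ r. The window runs from the left end of the
  -- plus cluster of index m₀ to the right end of the minus cluster of index m₀ + 1, whose centre is
  -- A (Q m₀ + d). Every other centre lies outside these two by at least A, and 2r < A prevents
  -- overlap.
  module WindowIndex (A r c d : ℕ) (m₀ : ℕ) (0<A : 0 ℕ.< A) (0<c : 0 ℕ.< c) (4r≤A : 4 ℕ.* r ℕ.≤ A) where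

    Q : ℤ
    Q = + c + + d

    lo hi : ℤ
    lo = + A * (+ c + Q * + m₀) - + r
    hi = + A * (Q * + m₀ + + d) + + r

    2r<A : r ℕ.+ r ℕ.< A
    2r<A = go r 4r≤A
      where
      l : ∀ r → suc (suc r ℕ.+ suc r) ℕ.+ (r ℕ.+ r ℕ.+ 1) ≡ 4 ℕ.* suc r
      l = ℕR.solve-∀
      go : ∀ r → 4 ℕ.* r ℕ.≤ A → r ℕ.+ r ℕ.< A
      go zero    _  = 0<A
      go (suc r) le = ℕ.≤-trans (ℕ.≤-trans (ℕ.m≤m+n _ (r ℕ.+ r ℕ.+ 1)) (ℕ.≤-reflexive (l r))) le

    private
      absurd : ∀ {N} τ → ∣ τ ∣ ℕ.≤ r → A ℕ.≤ N → + N ≤ τ + + r → ⊥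
      absurd {N} τ τ≤r A≤N le = ℕ.<⇒≱ 2r<A (ℕ.≤-trans A≤N (ℤ.drop‿+≤+ (ℤ.≤-trans le (ℤ.+-monoˡ-≤ (+ r) (ℤ.≤-trans (i≤∣i∣ τ) (+≤+ τ≤r))))))

      ∣-∣≤ : ∀ {τ} → ∣ τ ∣ ℕ.≤ r → ∣ - τ ∣ ℕ.≤ r
      ∣-∣≤ {τ} le = ℕ.≤-trans (ℕ.≤-reflexive (ℤ.∣-i∣≡∣i∣ τ)) le

      instance
        nzc : NonZero c
        nzc = ℕ.>-nonZero 0<c

      QA : ℕ → ℕ
      QA n = A ℕ.* ((c ℕ.+ d) ℕ.* suc n)

      CA : ℕ → ℕ
      CA n = A ℕ.* (c ℕ.+ c ℕ.+ (c ℕ.+ d) ℕ.* n)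

      +QA : ∀ n → + QA n ≡ + A * (Q * (1ℤ + + n))
      +QA n = trans (ℤ.pos-* A _) (cong (λ z → + A * z) (ℤ.pos-* (c ℕ.+ d) (suc n)))

      +CA : ∀ n → + CA n ≡ + A * (+ c + + c + Q * + n)
      +CA n = trans (ℤ.pos-* A _) (cong (λ z → + A * (+ (c ℕ.+ c) + z)) (ℤ.pos-* (c ℕ.+ d) n))

      A≤QA : ∀ n → A ℕ.≤ QA n
      A≤QA n = ℕ.m≤m*n A ((c ℕ.+ d) ℕ.* suc n) {{ℕ.m*n≢0 (c ℕ.+ d) (suc n) {{ℕ.>-nonZero (ℕ.<-≤-trans 0<c (ℕ.m≤m+n c d))}}}}

      A≤CA : ∀ n → A ℕ.≤ CA n
      A≤CA n = ℕ.m≤m*n A (c ℕ.+ c ℕ.+ (c ℕ.+ d) ℕ.* n) {{ℕ.>-nonZero (ℕ.<-≤-trans 0<c (ℕ.≤-trans (ℕ.m≤m+n c c) (ℕ.m≤m+n (c ℕ.+ c) _)))}}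

    plus-index : ∀ m τ → ∣ τ ∣ ℕ.≤ r → lo ≤ + A * (+ c + Q * m) + τ → + A * (+ c + Q * m) + τ ≤ hi → m ≡ + m₀
    plus-index m τ τ≤r lo≤ ≤hi with ℤ.<-cmp m (+ m₀)
    ... | tri≈ _ e _ = e
    ... | tri< m<m₀ _ _ = ⊥-elim (below (<-split m<m₀))
      where
      below : (Σ ℕ λ n → + m₀ ≡ m + + suc n) → ⊥
      below (n , e) = absurd τ τ≤r (A≤QA n) (shift-≤ (+ QA n) lo≤ (trans (cong₂ (λ N x → N + (+ A * (+ c + Q * m) + τ - (+ A * (+ c + Q * x) - + r))) (+QA n) e)
          (l (+ A) (+ c) Q m (+ n) τ (+ r))))
        where
        l : ∀ A c Q m n τ r → A * (Q * (1ℤ + n)) + (A * (c + Q * m) + τ - (A * (c + Q * (m + (1ℤ + n))) - r)) ≡ τ + r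
        l = solve-∀
    ... | tri> _ _ m₀<m = ⊥-elim (above (<-split m₀<m))
      where
      above : (Σ ℕ λ n → m ≡ + m₀ + + suc n) → ⊥
      above (n , refl) = absurd (- τ) (∣-∣≤ {τ} τ≤r) (A≤CA n) (shift-≤ (+ CA n) ≤hi (trans (cong (λ N → N + (hi - (+ A * (+ c + Q * (+ m₀ + + suc n)) + τ))) (+CA n))
          (l (+ A) (+ c) (+ d) (+ m₀) (+ n) τ (+ r))))
        where
        l : ∀ A c d m n τ r → A * (c + c + (c + d) * n) + (A * ((c + d) * m + d) + r - (A * (c + (c + d) * (m + (1ℤ + n))) + τ)) ≡ - τ + r
        l = solve-∀

    minus-index : ∀ m τ → ∣ τ ∣ ℕ.≤ r → lo ≤ + A * (- + c + Q * m) + τ → + A * (- + c + Q * m) + τ ≤ hi → m ≡ 1ℤ + + m₀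
    minus-index m τ τ≤r lo≤ ≤hi with ℤ.<-cmp m (1ℤ + + m₀)
    ... | tri≈ _ e _ = e
    ... | tri< m<m₀ _ _ = ⊥-elim (below (<-split m<m₀))
      where
      below : (Σ ℕ λ n → 1ℤ + + m₀ ≡ m + + suc n) → ⊥
      below (n , e) = absurd τ τ≤r (A≤CA n) (shift-≤ (+ CA n) lo≤ (trans (cong₂ (λ N x → N + (+ A * (- + c + Q * m) + τ - (+ A * (+ c + Q * x) - + r))) (+CA n) e′)
          (l (+ A) (+ c) Q m (+ n) τ (+ r))))
        where
        e′ : + m₀ ≡ m + + n
        e′ = trans (k (+ m₀)) (trans (cong (λ z → z - 1ℤ) e) (k′ m (+ n)))
          where
          k : ∀ x → x ≡ 1ℤ + x - 1ℤ
          k = solve-∀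
          k′ : ∀ m n → m + (1ℤ + n) - 1ℤ ≡ m + n
          k′ = solve-∀
        l : ∀ A c Q m n τ r → A * (c + c + Q * n) + (A * (- c + Q * m) + τ - (A * (c + Q * (m + n)) - r)) ≡ τ + r
        l = solve-∀
    ... | tri> _ _ m₀<m = ⊥-elim (above (<-split m₀<m))
      where
      above : (Σ ℕ λ n → m ≡ 1ℤ + + m₀ + + suc n) → ⊥
      above (n , refl) = absurd (- τ) (∣-∣≤ {τ} τ≤r) (A≤QA n) (shift-≤ (+ QA n) ≤hi (trans (cong (λ N → N + (hi - (+ A * (- + c + Q * (1ℤ + + m₀ + + suc n)) + τ))) (+QA n))
          (l (+ A) (+ c) (+ d) (+ m₀) (+ n) τ (+ r))))
        where
        l : ∀ A c d m n τ r → A * ((c + d) * (1ℤ + n)) + (A * ((c + d) * m + d) + r - (A * (- c + (c + d) * (1ℤ + m + (1ℤ + n))) + τ)) ≡ - τ + r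
        l = solve-∀

-- The two runs, and all elements of 𝐄 in their range.

module RunsOfValues where

  open Congruences
  open Nonresidues using (Square)
  open NonsquareKilling using (square?)
  open SumsOfTwoSquares using (square≡∣∣²)
  open LocalSolutions using (-1-Square)
  open SignedSums
  open SignedSumBounds
  open Patterns using (Run)
  open Windows using (module WindowIndex; i≤∣i∣)
  open import Data.Integer using (_≤_; _<_; +≤+; +<+)

  module Runs
    (q : ℕ) .{{nzq : NonZero q}} (D p₀ c d m₀ : ℕ) {A′ R s : ℕ}
    (2∣D : 2 ℕ.∣ D) (q∣D : q ℕ.∣ D) (pr : Prime p₀) (ι₀ : -1-Square p₀) (cD : Coprime D p₀) (cp : Coprime p₀ c)
    (L : Moduli (D ℕ.* p₀) A′ R s) (allC : AllC q L)
    (Q≡ : p₀ ℕ.^ 2 ≡ c ℕ.+ d) (0<c : 0 ℕ.< c) (c<d : c ℕ.< d) (small : 4 ℕ.* (p₀ ℕ.^ 2 ℕ.* R) ℕ.≤ A′)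
    where

    Q₀ = p₀ ℕ.^ 2
    A = Q₀ ℕ.* A′
    κ = c ℕ.* A′ ℕ.+ Q₀ ℕ.* R
    r = Q₀ ℕ.* R

    full : Moduli D A κ (suc s)
    full = cons p₀ 2 c pr ι₀ cD cp L

    instance
      nzA′ : NonZero A′
      nzA′ = moduli-≢0 L
      nzA : NonZero A
      nzA = moduli-≢0 full

    module W = WindowIndex A′ r c d m₀ (ℕ.>-nonZero⁻¹ A′) 0<c small
    open W using (Q; lo; hi)

    +Q₀ : + Q₀ ≡ Q
    +Q₀ = cong +_ Q≡

    +A : + A ≡ Q * + A′
    +A = trans (ℤ.pos-* Q₀ A′) (cong (_* + A′) +Q₀)

    -- Centres of the two clusters. Since A = Q A′, they are ≡ c A′ and ≡ - c A′ modulo A, the two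
    -- signs at p₀.
    leftC rightC : ℤ
    leftC  = + A′ * (+ c + Q * + m₀)
    rightC = + A′ * (Q * + m₀ + + d)

    IsRoot : ℤ → Set
    IsRoot k = k * k ≋ + κ * + κ [ A ]

    root-≋ : ∀ {k σ} → Signed full σ → k ≋ σ [ A ] → IsRoot k
    root-≋ sg e = ≋-trans (≋-* e e) (signed-square sg)

    left-root : ∀ {τ} → Signed L τ → IsRoot (leftC + + Q₀ * τ)
    left-root {τ} sg = root-≋ (plus sg) (quot (+ m₀) (trans (l (+ A′) (+ c) Q (+ m₀) (+ Q₀ * τ)) (cong₂ (λ x y → x + + Q₀ * τ + + m₀ * y) (sym (ℤ.pos-* c A′)) (sym +A))))
      where
      l : ∀ A c Q m t → A * (c + Q * m) + t ≡ c * A + t + m * (Q * A)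
      l = solve-∀

    right-root : ∀ {τ} → Signed L τ → IsRoot (rightC + + Q₀ * τ)
    right-root {τ} sg = root-≋ (minus sg) (quot (1ℤ + + m₀) (trans (l (+ A′) (+ c) (+ d) (+ m₀) (+ Q₀ * τ)) (cong₂ (λ x y → - x + + Q₀ * τ + (1ℤ + + m₀) * y) (sym (ℤ.pos-* c A′)) (sym +A))))
      where
      l : ∀ A c d m t → A * ((c + d) * m + d) + t ≡ - (c * A) + t + (1ℤ + m) * ((c + d) * A)
      l = solve-∀

    offset : ∀ {τ} → Signed L τ → ∣ + Q₀ * τ ∣ ℕ.≤ r
    offset {τ} sg = ℕ.≤-trans (ℕ.≤-reflexive (ℤ.∣i*j∣≡∣i∣*∣j∣ (+ Q₀) τ)) (ℕ.*-monoʳ-≤ Q₀ (signed-bound sg))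

    offset-≤ : ∀ {τ} → Signed L τ → + Q₀ * τ ≤ + r
    offset-≤ {τ} sg = ℤ.≤-trans (i≤∣i∣ (+ Q₀ * τ)) (+≤+ (offset sg))

    offset-≥ : ∀ {τ} → Signed L τ → - (+ r) ≤ + Q₀ * τ
    offset-≥ {τ} sg = ℤ.≤-trans (ℤ.neg-mono-≤ (ℤ.≤-trans (i≤∣i∣ (- (+ Q₀ * τ))) (+≤+ (ℕ.≤-trans (ℕ.≤-reflexive (ℤ.∣-i∣≡∣i∣ (+ Q₀ * τ))) (offset sg)))))
      (ℤ.≤-reflexive (ℤ.neg-involutive (+ Q₀ * τ)))

    -- All coefficients in L equal q; the coefficient c at p₀ is left free, so the two centres can
    -- lie in different classes.
    offset-≋0 : ∀ {τ} → Signed L τ → + Q₀ * τ ≋ 0ℤ [ q ]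
    offset-≋0 {τ} sg = ≋-trans (≋-*ˡ (+ Q₀) (signed-≋0 allC sg)) (≋-reflexive (ℤ.*-zeroʳ (+ Q₀)))

    centre-≋ : ∀ {k C τ} → Signed L τ → k ≡ C + + Q₀ * τ → k ≋ C [ q ]
    centre-≋ {C = C} sg refl = ≋-trans (≋-+ˡ C (offset-≋0 sg)) (≋-reflexive (ℤ.+-identityʳ C))

    0≤lo : 0ℤ ≤ lo
    0≤lo = ℤ.i≤j⇒0≤j-i (subst (+ r ≤_) (trans (ℤ.pos-* A′ _) (cong (λ z → + A′ * (+ c + z)) (ℤ.pos-* (c ℕ.+ d) m₀)))
      (+≤+ (ℕ.≤-trans (ℕ.≤-trans (ℕ.m≤n*m r 4) small) (ℕ.m≤m*n A′ (c ℕ.+ (c ℕ.+ d) ℕ.* m₀) {{ℕ.>-nonZero (ℕ.<-≤-trans 0<c (ℕ.m≤m+n c _))}}))))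

    left-≥lo : ∀ {τ} → Signed L τ → lo ≤ leftC + + Q₀ * τ
    left-≥lo sg = ℤ.+-monoʳ-≤ leftC (offset-≥ sg)

    -- The centres differ by A′ (d - c), at least A′ because c < d, and A′ exceeds the two radii
    -- together.
    gap : leftC + + r < rightC - + r
    gap = subst (leftC + + r <_) (sym eq) (subst (_< leftC + + r + + suc w) (ℤ.+-identityʳ (leftC + + r)) (ℤ.+-monoʳ-< (leftC + + r) (+<+ (s≤s z≤n))))
      where
      n = d ℕ.∸ suc c
      d≡ : d ≡ c ℕ.+ suc n
      d≡ = trans (sym (ℕ.m+[n∸m]≡n c<d)) (sym (ℕ.+-suc c n))
      2r<An : r ℕ.+ r ℕ.< A′ ℕ.* suc n
      2r<An = ℕ.<-≤-trans W.2r<A (ℕ.m≤m*n A′ (suc n))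
      w = A′ ℕ.* suc n ℕ.∸ suc (r ℕ.+ r)
      w≡ : + A′ * + suc n ≡ + r + + r + + suc w
      w≡ = trans (sym (ℤ.pos-* A′ (suc n))) (trans (cong +_ (trans (sym (ℕ.m+[n∸m]≡n 2r<An)) (sym (ℕ.+-suc (r ℕ.+ r) w)))) (ℤ.pos-+ (r ℕ.+ r) (suc w)))
      l₁ : ∀ A c Q m n r → A * (Q * m + (c + n)) - r ≡ A * (c + Q * m) + A * n - r
      l₁ = solve-∀
      l₂ : ∀ C r w → C + (r + r + w) - r ≡ C + r + w
      l₂ = solve-∀
      eq : rightC - + r ≡ leftC + + r + + suc w
      eq = trans (cong (λ z → + A′ * (Q * + m₀ + z) - + r) (trans (cong +_ d≡) (ℤ.pos-+ c (suc n)))) (trans (l₁ (+ A′) (+ c) Q (+ m₀) (+ suc n) (+ r)) (trans (cong (λ z → leftC + z - + r) w≡) (l₂ leftC (+ r) (+ suc w))))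

    right-≥ : ∀ {τ} → Signed L τ → rightC - + r ≤ rightC + + Q₀ * τ
    right-≥ sg = ℤ.+-monoʳ-≤ rightC (offset-≥ sg)

    left-≤ : ∀ {τ} → Signed L τ → leftC + + Q₀ * τ ≤ leftC + + r
    left-≤ sg = ℤ.+-monoʳ-≤ leftC (offset-≤ sg)

    0≤right : ∀ {τ} → Signed L τ → 0ℤ ≤ rightC + + Q₀ * τ
    0≤right sg = ℤ.≤-trans 0≤lo (ℤ.≤-trans (ℤ.+-monoʳ-≤ leftC (ℤ.neg-≤-pos {r} {r})) (ℤ.≤-trans (ℤ.<⇒≤ gap) (right-≥ sg)))

    module Values (X : ℕ) (X²≋ : + X * + X + + κ * + κ ≋ 0ℤ [ A ]) where

      record HasValue (v : ℕ) (k : ℤ) : Set where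
        constructor has
        field
          equation : + A * + v ≡ + X * + X + k * k

      value : ∀ k → IsRoot k → Σ ℕ λ v → HasValue v k × InE v
      value k rt = go (≋0⇒∣ {A} {+ (X ℕ.* X ℕ.+ ∣ k ∣ ℕ.* ∣ k ∣)} (≋-trans (≋-reflexive (sym n≡)) (≋-trans (≋-+ˡ (+ X * + X) rt) X²≋)))
        where
        n≡ : + X * + X + k * k ≡ + (X ℕ.* X ℕ.+ ∣ k ∣ ℕ.* ∣ k ∣)
        n≡ = trans (cong₂ _+_ (sym (ℤ.pos-* X X)) (square≡∣∣² k)) (sym (ℤ.pos-+ (X ℕ.* X) _))
        go : A ℕ.∣ X ℕ.* X ℕ.+ ∣ k ∣ ℕ.* ∣ k ∣ → Σ ℕ λ v → HasValue v k × InE v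
        go (ℕ.divides v e) = v , has eq , quotients-moduli full {v} (+ X) k (sym eq)
          where
          eq : + A * + v ≡ + X * + X + k * k
          eq = trans (sym (ℤ.pos-* A v)) (trans (cong +_ (trans (ℕ.*-comm A v) (sym e))) (sym n≡))

      value-< : ∀ {k k′ v v′} → 0ℤ ≤ k → k < k′ → HasValue v k → HasValue v′ k′ → v ℕ.< v′
      value-< {k} {k′} {v} {v′} 0≤k k<k′ (has hv) (has hv′) = ℕ.*-cancelˡ-< A v v′ (ℤ.drop‿+<+ (subst (_< + (A ℕ.* v′)) (sym (trans (ℤ.pos-* A v) hv)) (subst (+ X * + X + k * k <_) (sym (trans (ℤ.pos-* A v′) hv′)) (ℤ.+-monoʳ-< (+ X * + X) squares))))
        where
        abs : ∀ {z} → 0ℤ ≤ z → z ≡ + ∣ z ∣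
        abs le = sym (ℤ.0≤i⇒+∣i∣≡i le)
        0≤k′ = ℤ.<⇒≤ (ℤ.≤-<-trans 0≤k k<k′)
        a<b : ∣ k ∣ ℕ.< ∣ k′ ∣
        a<b = ℤ.drop‿+<+ (subst (_< + ∣ k′ ∣) (abs 0≤k) (subst (k <_) (abs 0≤k′) k<k′))
        squares : k * k < k′ * k′
        squares = subst (_< k′ * k′) (sym (square≡∣∣² k)) (subst (+ (∣ k ∣ ℕ.* ∣ k ∣) <_) (sym (square≡∣∣² k′)) (+<+ (ℕ.*-mono-< a<b a<b)))

      natural : ∀ {v k} → HasValue v k → A ℕ.* v ≡ X ℕ.* X ℕ.+ ∣ k ∣ ℕ.* ∣ k ∣
      natural {v} {k} (has hv) = ℤ.+-injective (trans (ℤ.pos-* A v) (trans hv (trans (cong₂ _+_ (sym (ℤ.pos-* X X)) (square≡∣∣² k)) (sym (ℤ.pos-+ (X ℕ.* X) _)))))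

      value-mono : ∀ {k k′ v v′} → 0ℤ ≤ k → k ≤ k′ → HasValue v k → HasValue v′ k′ → v ℕ.≤ v′
      value-mono {k} {k′} {v} {v′} 0≤k k≤k′ hv hv′ with k Data.Integer.≟ k′
      ... | yes refl = ℕ.≤-reflexive (ℕ.*-cancelˡ-≡ v v′ A (trans (natural {v} {k} hv) (sym (natural {v′} {k} hv′))))
      ... | no k≢k′ = ℕ.<⇒≤ (value-< 0≤k (ℤ.≤∧≢⇒< k≤k′ k≢k′) hv hv′)

      value-≤ : ∀ {k k′ v v′} → 0ℤ ≤ k′ → v ℕ.≤ v′ → HasValue v k → HasValue v′ k′ → k ≤ k′
      value-≤ 0≤k′ v≤v′ hv hv′ = ℤ.≮⇒≥ λ k′<k → ℕ.<⇒≱ (value-< 0≤k′ k′<k hv′ hv) v≤v′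

      run : (C : ℤ) → (∀ {τ} → Signed L τ → IsRoot (C + + Q₀ * τ)) → (∀ {τ} → Signed L τ → 0ℤ ≤ C + + Q₀ * τ) → Run s
      run C root nonneg = record
        { at = λ t → proj₁ (val t) ; member = λ t → proj₂ (proj₂ (val t))
        ; <-suc = λ t t<s → value-< (nonneg (signed t)) (ℤ.+-monoʳ-< C (ℤ.*-monoˡ-<-pos (+ Q₀) {{pos}} (<-suc t t<s))) (proj₁ (proj₂ (val t))) (proj₁ (proj₂ (val (suc t)))) }
        where
        open Chain (chain L)
        val : ∀ t → Σ ℕ λ v → HasValue v (C + + Q₀ * at t) × InE v
        val t = value (C + + Q₀ * at t) (root (signed t))
        ℤ-pos : ∀ n → .{{_ : NonZero n}} → Data.Integer.Positive (+ n)
        ℤ-pos (suc n) = _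
        pos : Data.Integer.Positive (+ Q₀)
        pos = ℤ-pos Q₀ {{ℕ.m^n≢0 p₀ 2 {{prime⇒nonZero pr}}}}

      module Ch = Chain (chain L)

      leftRun rightRun : Run s
      leftRun  = run leftC left-root (λ sg → ℤ.≤-trans 0≤lo (left-≥lo sg))
      rightRun = run rightC right-root 0≤right

      module e = Run leftRun
      module f = Run rightRun

      e-value : ∀ t → HasValue (e.at t) (leftC + + Q₀ * Ch.at t)
      e-value t = proj₁ (proj₂ (value (leftC + + Q₀ * Ch.at t) (left-root (Ch.signed t))))

      f-value : ∀ t → HasValue (f.at t) (rightC + + Q₀ * Ch.at t)
      f-value t = proj₁ (proj₂ (value (rightC + + Q₀ * Ch.at t) (right-root (Ch.signed t))))

      e-bottom : HasValue (e.at 0) lo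
      e-bottom = subst (HasValue (e.at 0)) (trans (cong (λ z → leftC + + Q₀ * z) Ch.bottom) (trans (l leftC (+ Q₀) (+ R)) (cong (λ z → leftC - z) (sym (ℤ.pos-* Q₀ R))))) (e-value 0)
        where
        l : ∀ C Q R → C + Q * - R ≡ C - Q * R
        l = solve-∀

      e-top : HasValue (e.at s) (leftC + + r)
      e-top = subst (HasValue (e.at s)) (trans (cong (λ z → leftC + + Q₀ * z) Ch.top) (cong (λ z → leftC + z) (sym (ℤ.pos-* Q₀ R)))) (e-value s)

      f-bottom : HasValue (f.at 0) (rightC - + r)
      f-bottom = subst (HasValue (f.at 0)) (trans (cong (λ z → rightC + + Q₀ * z) Ch.bottom) (trans (l rightC (+ Q₀) (+ R)) (cong (λ z → rightC - z) (sym (ℤ.pos-* Q₀ R))))) (f-value 0)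
        where
        l : ∀ C Q R → C + Q * - R ≡ C - Q * R
        l = solve-∀

      f-top : HasValue (f.at s) hi
      f-top = subst (HasValue (f.at s)) (trans (cong (λ z → rightC + + Q₀ * z) Ch.top) (cong (λ z → rightC + z) (sym (ℤ.pos-* Q₀ R)))) (f-value s)

      e-spread : e.at 0 ℕ.≤ e.at s
      e-spread = e.mono {0} {s} z≤n ℕ.≤-refl

      f-spread : f.at 0 ℕ.≤ f.at s
      f-spread = f.mono {0} {s} z≤n ℕ.≤-refl

      0≤leftTop : 0ℤ ≤ leftC + + r
      0≤leftTop = ℤ.≤-trans 0≤lo (ℤ.+-monoʳ-≤ leftC (ℤ.neg-≤-pos {r} {r}))

      e<f : e.at s ℕ.< f.at 0
      e<f = value-< 0≤leftTop gap e-top f-bottom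

      0≤hi : 0ℤ ≤ hi
      0≤hi = ℤ.≤-trans 0≤leftTop (ℤ.≤-trans (ℤ.<⇒≤ gap) (ℤ.+-monoʳ-≤ rightC (ℤ.neg-≤-pos {r} {r})))

      module Classify
        (killed : ∀ {g} → g ℕ.≤ ∣ hi ∣ ℕ.* ∣ hi ∣ → ¬ Square g → ∀ {v} → InE v → + X * + X + + g ≢ + A * + v) where

        -- In this range g = A v - X² is at most the square of the right end of the window, so it is
        -- among the g for which X was prepared; a nonsquare g is excluded.
        square-root : ∀ {v} → InE v → e.at 0 ℕ.≤ v → v ℕ.≤ f.at s → Σ ℕ λ k → HasValue v (+ k)
        square-root {v} v∈ e≤v v≤f = found (square? g)
          where
          n = A ℕ.* v
          lower : X ℕ.* X ℕ.≤ n
          lower = ℕ.≤-trans (ℕ.≤-trans (ℕ.m≤m+n (X ℕ.* X) _) (ℕ.≤-reflexive (sym (natural e-bottom)))) (ℕ.*-monoʳ-≤ A e≤v)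
          g = n ℕ.∸ X ℕ.* X
          n≡ : X ℕ.* X ℕ.+ g ≡ n
          n≡ = ℕ.m+[n∸m]≡n lower
          upper : n ℕ.≤ X ℕ.* X ℕ.+ ∣ hi ∣ ℕ.* ∣ hi ∣
          upper = ℕ.≤-trans (ℕ.*-monoʳ-≤ A v≤f) (ℕ.≤-reflexive (natural f-top))
          g≤ : g ℕ.≤ ∣ hi ∣ ℕ.* ∣ hi ∣
          g≤ = ℕ.+-cancelˡ-≤ (X ℕ.* X) g _ (ℕ.≤-trans (ℕ.≤-reflexive n≡) upper)
          eq : + X * + X + + g ≡ + A * + v
          eq = trans (cong (λ z → z + + g) (sym (ℤ.pos-* X X))) (trans (sym (ℤ.pos-+ (X ℕ.* X) g)) (trans (cong +_ n≡) (ℤ.pos-* A v)))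
          found : Dec (Square g) → Σ ℕ λ k → HasValue v (+ k)
          found (no ¬sq) = ⊥-elim (killed g≤ ¬sq v∈ eq)
          found (yes (k , e)) = k , has (sym (trans (cong (λ z → + X * + X + z) (trans (sym (ℤ.pos-* k k)) (cong +_ e))) eq))

        data Position (k : ℤ) : Set where
          on-left  : ∀ {τ} → Signed L τ → k ≡ leftC + + Q₀ * τ → Position k
          on-right : ∀ {τ} → Signed L τ → k ≡ rightC + + Q₀ * τ → Position k

        -- Integrality of (X² + k²) / A makes k² ≡ κ² modulo A, so k is a signed sum plus a multiple
        -- of A. The sign at p₀ selects the cluster, and the window fixes the multiple.
        position : ∀ {k v} → HasValue v k → lo ≤ k → k ≤ hi → Position k
        position {k} {v} (has hv) lo≤k k≤hi = locate (signed-roots 2∣D full k root)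
          where
          root : IsRoot k
          root = ≋-trans (≋-reflexive (l (+ X * + X) (k * k))) (≋-trans (≋-- (≋-trans (≋-reflexive (sym hv)) (≋-*ʳ (+ v) modulus≋0)) (X²≋-κ²)) (≋-reflexive (l′ (+ v) (+ κ * + κ))))
            where
            l : ∀ x k → k ≡ x + k - x
            l = solve-∀
            l′ : ∀ v y → 0ℤ * v - - y ≡ y
            l′ = solve-∀
            l″ : ∀ x y → x ≡ x + y - y
            l″ = solve-∀
            X²≋-κ² : + X * + X ≋ - (+ κ * + κ) [ A ]
            X²≋-κ² = ≋-trans (≋-reflexive (l″ (+ X * + X) (+ κ * + κ))) (≋-trans (≋-- X²≋ (≋-refl {a = + κ * + κ})) (≋-reflexive (ℤ.+-identityˡ _)))
          locate : (Σ ℤ λ σ → Signed full σ × k ≋ σ [ A ]) → Position k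
          locate (_ , plus {σ = τ} sg , quot m e) = on-left sg (trans k≡ (cong (λ z → + A′ * (+ c + Q * z) + + Q₀ * τ) m≡))
            where
            l : ∀ A c Q m t → c * A + t + m * (Q * A) ≡ A * (c + Q * m) + t
            l = solve-∀
            k≡ : k ≡ + A′ * (+ c + Q * m) + + Q₀ * τ
            k≡ = trans e (trans (cong₂ (λ x y → x + + Q₀ * τ + m * y) (ℤ.pos-* c A′) +A) (l (+ A′) (+ c) Q m (+ Q₀ * τ)))
            m≡ : m ≡ + m₀
            m≡ = W.plus-index m (+ Q₀ * τ) (offset sg) (subst (lo ≤_) k≡ lo≤k) (subst (_≤ hi) k≡ k≤hi)
          locate (_ , minus {σ = τ} sg , quot m e) = on-right sg (trans k≡ (trans (cong (λ z → + A′ * (- + c + Q * z) + + Q₀ * τ) m≡) (l′ (+ A′) (+ c) (+ d) (+ m₀) (+ Q₀ * τ))))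
            where
            l : ∀ A c Q m t → - (c * A) + t + m * (Q * A) ≡ A * (- c + Q * m) + t
            l = solve-∀
            l′ : ∀ A c d m t → A * (- c + (c + d) * (1ℤ + m)) + t ≡ A * ((c + d) * m + d) + t
            l′ = solve-∀
            k≡ : k ≡ + A′ * (- + c + Q * m) + + Q₀ * τ
            k≡ = trans e (trans (cong₂ (λ x y → - x + + Q₀ * τ + m * y) (ℤ.pos-* c A′) +A) (l (+ A′) (+ c) Q m (+ Q₀ * τ)))
            m≡ : m ≡ 1ℤ + + m₀
            m≡ = W.minus-index m (+ Q₀ * τ) (offset sg) (subst (lo ≤_) k≡ lo≤k) (subst (_≤ hi) k≡ k≤hi)

        unitA : Coprimeᶻ (+ A) q
        unitA = coprime⇒inverse (Coprimality.sym (coprime-dvdˡ q∣D (moduli-coprime full)))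

        -- A is a unit modulo q, so the class of v follows from those of X and of the centre.
        residue-of : ∀ {v k C X₀ a} → + X ≋ X₀ [ q ] → X₀ * X₀ + C * C ≋ + A * + a [ q ] → HasValue v k → k ≋ C [ q ] → v % q ≡ a % q
        residue-of {v} {k} {C} {X₀} {a} hX ha (has hv) hk = ≋⇒%≡ v a (cancel unitA (≋-trans (≋-reflexive hv) (≋-trans (≋-+ (≋-* hX hX) (≋-* hk hk)) ha)))

        module _ {X₀ a b} (hX : + X ≋ X₀ [ q ]) (ha : X₀ * X₀ + leftC * leftC ≋ + A * + a [ q ]) (hb : X₀ * X₀ + rightC * rightC ≋ + A * + b [ q ]) where

          left-residues : ∀ {v} → InE v → e.at 0 ℕ.≤ v → v ℕ.≤ e.at s → v % q ≡ a % q
          left-residues {v} v∈ e≤v v≤e = go (square-root v∈ e≤v (ℕ.≤-trans v≤e (ℕ.≤-trans (ℕ.<⇒≤ e<f) f-spread)))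
            where
            go : (Σ ℕ λ k → HasValue v (+ k)) → v % q ≡ a % q
            go (k , hv) = by (position hv (value-≤ (+≤+ z≤n) e≤v e-bottom hv) (ℤ.≤-trans k≤ (ℤ.≤-trans (ℤ.<⇒≤ gap) (ℤ.+-monoʳ-≤ rightC (ℤ.neg-≤-pos {r} {r})))))
              where
              k≤ : + k ≤ leftC + + r
              k≤ = value-≤ 0≤leftTop v≤e hv e-top
              by : Position (+ k) → v % q ≡ a % q
              by (on-left sg eq) = residue-of {v} {+ k} {leftC} {X₀} {a} hX ha hv (centre-≋ {+ k} {leftC} sg eq)
              by (on-right sg eq) = contradiction (ℤ.<-≤-trans gap (ℤ.≤-trans (right-≥ sg) (ℤ.≤-trans (ℤ.≤-reflexive (sym eq)) k≤))) (ℤ.<-irrefl refl)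

          right-residues : ∀ {v} → InE v → e.at s ℕ.< v → v ℕ.≤ f.at s → v % q ≡ b % q
          right-residues {v} v∈ e<v v≤f = go (square-root v∈ e≤v v≤f)
            where
            e≤v : e.at 0 ℕ.≤ v
            e≤v = ℕ.≤-trans e-spread (ℕ.<⇒≤ e<v)
            go : (Σ ℕ λ k → HasValue v (+ k)) → v % q ≡ b % q
            go (k , hv) = by (position hv lo≤k k≤hi)
              where
              lo≤k : lo ≤ + k
              lo≤k = value-≤ {lo} {+ k} {e.at 0} {v} (+≤+ z≤n) e≤v e-bottom hv
              k≤hi : + k ≤ hi
              k≤hi = value-≤ {+ k} {hi} {v} {f.at s} 0≤hi v≤f hv f-top
              by : Position (+ k) → v % q ≡ b % q
              by (on-right sg eq) = residue-of {v} {+ k} {rightC} {X₀} {b} hX hb hv (centre-≋ {+ k} {rightC} sg eq)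
              by (on-left sg eq) = contradiction (value-mono {+ k} {leftC + + r} {v} {e.at s} (+≤+ z≤n) (ℤ.≤-trans (ℤ.≤-reflexive eq) (left-≤ sg)) hv e-top) (ℕ.<⇒≱ e<v)

-- Choice of the parameters, and recurrence of the pattern.

module Recurrence where

  open import Defs
  open Congruences
  open Enumeration using (E-<; m≤m*m)
  open Nonresidues using (parity; Square)
  open NonsquareKilling using (kill-nonsquares; two∤)
  open LocalSolutions using (-1-Square; Local; local; unit-≋)
  open SignedSums
  open SignedSumBounds
  open Patterns using (E-mono; consecutive-runs)
  open RunsOfValues

  module Search
    (q : ℕ) .{{nzq : NonZero q}} (D p₀ c d m₀ : ℕ) {A′ R s : ℕ}
    (2∣D : 2 ℕ.∣ D) (q∣D : q ℕ.∣ D) (pr : Prime p₀) (ι₀ : -1-Square p₀) (cD : Coprime D p₀) (cp : Coprime p₀ c)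
    (L : Moduli (D ℕ.* p₀) A′ R s) (allC : AllC q L)
    (Q≡ : p₀ ℕ.^ 2 ≡ c ℕ.+ d) (0<c : 0 ℕ.< c) (c<d : c ℕ.< d) (small : 4 ℕ.* (p₀ ℕ.^ 2 ℕ.* R) ℕ.≤ A′)
    where

    open Runs q D p₀ c d m₀ 2∣D q∣D pr ι₀ cD cp L allC Q≡ 0<c c<d small

    module _ {X₀ : ℤ} {a b : ℕ} (ha : X₀ * X₀ + leftC * leftC ≋ + A * + a [ q ]) (hb : X₀ * X₀ + rightC * rightC ≋ + A * + b [ q ]) where

      Good : ℕ → ℕ → Set
      Good B X = B ℕ.≤ X × (+ X * + X + + κ * + κ ≋ 0ℤ [ A ]) × (+ X ≋ X₀ [ q ]) ×
        (∀ {g} → g ℕ.≤ ∣ W.hi ∣ ℕ.* ∣ W.hi ∣ → ¬ Square g → ∀ {v} → InE v → + X * + X + + g ≢ + A * + v)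

      -- The demands are X ≡ ι κ modulo A, where ι² ≡ -1, X ≡ X₀ modulo q, and X ≡ x₀ modulo M. The
      -- moduli are pairwise coprime because M was built coprime to A q, and multiples of their
      -- product push X past B.
      choose-X : ∀ B → Σ ℕ (Good B)
      choose-X B = build (-1-square-moduli 2∣D full) (kill-nonsquares (∣ W.hi ∣ ℕ.* ∣ W.hi ∣) (A ℕ.* q) (ℕ.≢-nonZero⁻¹ (A ℕ.* q) {{ℕ.m*n≢0 A q}}))
        where
        cAq : Coprime A q
        cAq = Coprimality.sym (coprime-dvdˡ q∣D (moduli-coprime full))
        build : -1-Square A → (Σ ℕ λ M → M ≢ 0 × Coprime (A ℕ.* q) M × Σ ℤ λ x₀ →
            ∀ {x} → x ≋ x₀ [ M ] → ∀ {g} → g ℕ.≤ ∣ W.hi ∣ ℕ.* ∣ W.hi ∣ → ¬ Square g → ∀ {A₁ v} → A₁ ℕ.∣ A ℕ.* q → InE v → x * x + + g ≢ + A₁ * + v) →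
          Σ ℕ (Good B)
        build (ι , ι²) (M , M≢0 , cM , x₀ , kills) = from (crt cAq (ι * + κ) X₀)
          where
          T = (A ℕ.* q) ℕ.* M
          instance
            nzT : NonZero T
            nzT = ℕ.m*n≢0 (A ℕ.* q) M {{ℕ.m*n≢0 A q}} {{ℕ.≢-nonZero M≢0}}
          from : (Σ ℤ λ y → y ≋ ι * + κ [ A ] × y ≋ X₀ [ q ]) → Σ ℕ (Good B)
          from (y , yA , yq) = from₂ (crt cM y x₀)
            where
            from₂ : (Σ ℤ λ z → z ≋ y [ A ℕ.* q ] × z ≋ x₀ [ M ]) → Σ ℕ (Good B)
            from₂ (z , zA , zM) = from₃ (residue T z)
              where
              from₃ : (Σ ℕ λ ρ → ρ ℕ.< T × + ρ ≋ z [ T ]) → Σ ℕ (Good B)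
              from₃ (ρ , _ , ρ≋z) = X , ℕ.≤-trans (ℕ.m≤m*n B T) (ℕ.m≤n+m (B ℕ.* T) ρ) , square≋0 , ≋-trans (≋-dvd (ℕ.n∣m*n A) X≋y) yq ,
                  λ {g} g≤ ¬sq {v} v∈ → kills {+ X} (≋-trans (≋-dvd (ℕ.n∣m*n (A ℕ.* q)) X≋z) zM) {g} g≤ ¬sq {A} {v} (ℕ.m∣m*n q) v∈
                where
                X = ρ ℕ.+ B ℕ.* T
                X≋z : + X ≋ z [ T ]
                X≋z = ≋-trans (quot (+ B) (trans (ℤ.pos-+ ρ (B ℕ.* T)) (cong (λ w → + ρ + w) (ℤ.pos-* B T)))) ρ≋z
                X≋y : + X ≋ y [ A ℕ.* q ]
                X≋y = ≋-trans (≋-dvd (ℕ.m∣m*n M) X≋z) zA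
                X≋ικ : + X ≋ ι * + κ [ A ]
                X≋ικ = ≋-trans (≋-dvd (ℕ.m∣m*n q) X≋y) yA
                l : ∀ ι κ → (ι * κ) * (ι * κ) + κ * κ ≡ (κ * κ) * (ι * ι + 1ℤ)
                l = solve-∀
                square≋0 : + X * + X + + κ * + κ ≋ 0ℤ [ A ]
                square≋0 = ≋-trans (≋-+ʳ (+ κ * + κ) (≋-* X≋ικ X≋ικ)) (≋-trans (≋-reflexive (l ι (+ κ))) (≋-trans (≋-*ˡ (+ κ * + κ) ι²) (≋-reflexive (ℤ.*-zeroʳ (+ κ * + κ)))))

      Occurs : ℕ → ℕ → ℕ → Set
      Occurs b₀ j n = b₀ ℕ.≤ n × (∀ i → i ℕ.≤ j → E (n ℕ.+ i) % q ≡ a % q) × (∀ i → j ℕ.< i → i ℕ.≤ j ℕ.+ suc s → E (n ℕ.+ i) % q ≡ b % q)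

      occurs-at : ∀ b₀ j → j ℕ.≤ s → Σ ℕ (Good (A ℕ.* E b₀)) → Σ ℕ (Occurs b₀ j)
      occurs-at b₀ j j≤s (X , big , X²≋ , hX , killed) = finish (consecutive-runs q (a % q) (b % q) s V.leftRun V.rightRun V.e<f
            (K.left-residues {X₀} {a} {b} hX ha hb) (K.right-residues {X₀} {a} {b} hX ha hb) j j≤s)
        where
        module V = Values X X²≋
        module K = V.Classify killed
        Eb₀≤ : E b₀ ℕ.≤ V.e.at 0
        -- A times the first value is X² + lo², which is at least X and hence at least A · E b₀.
        Eb₀≤ = ℕ.*-cancelˡ-≤ A (ℕ.≤-trans big (ℕ.≤-trans (m≤m*m X) (ℕ.≤-trans (ℕ.m≤m+n (X ℕ.* X) (∣ W.lo ∣ ℕ.* ∣ W.lo ∣)) (ℕ.≤-reflexive (sym (V.natural {V.e.at 0} {W.lo} V.e-bottom))))))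
        finish : (Σ ℕ λ n → V.e.at 0 ℕ.≤ E n × (∀ i → i ℕ.≤ j → E (n ℕ.+ i) % q ≡ a % q) × (∀ i → j ℕ.< i → i ℕ.≤ j ℕ.+ suc s → E (n ℕ.+ i) % q ≡ b % q)) →
          Σ ℕ (Occurs b₀ j)
        finish (n , e₀≤ , l , r) = n , ℕ.≮⇒≥ (λ n<b₀ → ℕ.<⇒≱ (ℕ.<-≤-trans (E-< n) (E-mono n<b₀)) (ℕ.≤-trans Eb₀≤ e₀≤)) , l , r

      find : ∀ b₀ j → j ℕ.≤ s → Σ ℕ (Occurs b₀ j)
      find b₀ j j≤s = occurs-at b₀ j j≤s (choose-X (A ℕ.* E b₀))

  -- Solves A′(c + Q₀ m₀) ≡ y and A′(Q₀(m₀ + 1) - c) ≡ y′ modulo q; the sum of the two congruences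
  -- determines m₀ because 2 is invertible.
  centres : ∀ q .{{_ : NonZero q}} (A′ Q₀ : ℕ) → Coprime A′ q → Coprime (2 ℕ.* (Q₀ ℕ.* A′)) q → ∀ y y′ →
    Σ ℕ λ m₀ → Σ ℕ λ c → 0 ℕ.< c × c ℕ.≤ q × (+ A′ * (+ c + + Q₀ * + m₀) ≋ y [ q ]) ×
      (∀ d → + Q₀ ≡ + c + + d → + A′ * (+ Q₀ * + m₀ + + d) ≋ y′ [ q ])
  centres q A′ Q₀ cA c2A y y′ = solve (coprime⇒inverse cA) (coprime⇒inverse c2A)
    where
    Result = Σ ℕ λ m₀ → Σ ℕ λ c → 0 ℕ.< c × c ℕ.≤ q × (+ A′ * (+ c + + Q₀ * + m₀) ≋ y [ q ]) ×
      (∀ d → + Q₀ ≡ + c + + d → + A′ * (+ Q₀ * + m₀ + + d) ≋ y′ [ q ])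
    +2A : + (2 ℕ.* (Q₀ ℕ.* A′)) ≡ + 2 * (+ Q₀ * + A′)
    +2A = trans (ℤ.pos-* 2 (Q₀ ℕ.* A′)) (cong (λ z → + 2 * z) (ℤ.pos-* Q₀ A′))
    solve : Coprimeᶻ (+ A′) q → Coprimeᶻ (+ (2 ℕ.* (Q₀ ℕ.* A′))) q → Result
    solve (i , Ai) (k , 2Ak) = with-m (residue q (k * (y + y′ - + Q₀ * + A′)))
      where
      with-m : (Σ ℕ λ m → m ℕ.< q × + m ≋ k * (y + y′ - + Q₀ * + A′) [ q ]) → Result
      with-m (m , _ , m≋) = with-c (residue q (i * y - + Q₀ * + m - 1ℤ))
        where
        2Am : + 2 * (+ Q₀ * + A′) * + m ≋ y + y′ - + Q₀ * + A′ [ q ]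
        2Am = ≋-trans (≋-*ˡ (+ 2 * (+ Q₀ * + A′)) m≋) (≋-trans (≋-reflexive (trans (sym (ℤ.*-assoc (+ 2 * (+ Q₀ * + A′)) k (y + y′ - + Q₀ * + A′))) (cong (λ z → z * k * (y + y′ - + Q₀ * + A′)) (sym +2A))))
          (≋-trans (≋-*ʳ (y + y′ - + Q₀ * + A′) 2Ak) (≋-reflexive (ℤ.*-identityˡ (y + y′ - + Q₀ * + A′)))))
        with-c : (Σ ℕ λ ρ → ρ ℕ.< q × + ρ ≋ i * y - + Q₀ * + m - 1ℤ [ q ]) → Result
        -- The residue taken is that of c - 1, which places c between 1 and q.
        with-c (ρ , ρ<q , ρ≋) = m , suc ρ , s≤s z≤n , ρ<q , left , right
          where
          l₂ : ∀ A i y Q m → A * (1ℤ + (i * y - Q * m - 1ℤ) + Q * m) ≡ A * i * y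
          l₂ = solve-∀
          left : + A′ * (+ suc ρ + + Q₀ * + m) ≋ y [ q ]
          left = ≋-trans (≋-*ˡ (+ A′) (≋-+ʳ (+ Q₀ * + m) (≋-+ˡ 1ℤ ρ≋))) (≋-trans (≋-reflexive (l₂ (+ A′) i y (+ Q₀) (+ m))) (≋-trans (≋-*ʳ y Ai) (≋-reflexive (ℤ.*-identityˡ y))))
          l₃ : ∀ A Q m c d → A * (Q * m + d) ≡ + 2 * (Q * A) * m + (c + d) * A - A * (c + Q * m)
          l₃ = solve-∀
          l₄ : ∀ y y′ z → y + y′ - z + z - y ≡ y′
          l₄ = solve-∀
          right : ∀ d → + Q₀ ≡ + suc ρ + + d → + A′ * (+ Q₀ * + m + + d) ≋ y′ [ q ]
          right d Q≡ = ≋-trans (≋-reflexive (trans (l₃ (+ A′) (+ Q₀) (+ m) (+ suc ρ) (+ d)) (cong (λ z → + 2 * (+ Q₀ * + A′) * + m + z * + A′ - + A′ * (+ suc ρ + + Q₀ * + m)) (sym Q≡))))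
            (≋-trans (≋-- (≋-+ʳ (+ Q₀ * + A′) 2Am) left) (≋-reflexive (l₄ y y′ (+ Q₀ * + A′))))

  -- Adding the odd q changes the parity. An even representative of m keeps m² + 1 odd, as all
  -- primes in A must be.
  even-representative : ∀ q .{{_ : NonZero q}} → (Σ ℕ λ h → q ≡ suc (h ℕ.+ h)) → ∀ z → Σ ℕ λ k → + (k ℕ.+ k) ≋ z [ q ]
  even-representative q (h , q≡) z with residue q z
  ... | m , _ , m≋z with parity m
  ... | k , inj₁ refl = k , m≋z
  ... | k , inj₂ refl = k ℕ.+ suc h , ≋-trans (≋-reflexive (trans (cong +_ (trans (l k h) (cong (suc (k ℕ.+ k) ℕ.+_) (sym q≡)))) (ℤ.pos-+ (suc (k ℕ.+ k)) q)))
      (≋-trans (≋-+ˡ (+ suc (k ℕ.+ k)) modulus≋0) (≋-trans (≋-reflexive (ℤ.+-identityʳ (+ suc (k ℕ.+ k)))) m≋z))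
    where
    l : ∀ k h → (k ℕ.+ suc h) ℕ.+ (k ℕ.+ suc h) ≡ suc (k ℕ.+ k) ℕ.+ suc (h ℕ.+ h)
    l = ℕR.solve-∀

  module Assembly (q : ℕ) .{{nzq : NonZero q}} (half : Σ ℕ λ h → q ≡ suc (h ℕ.+ h)) (r : ℕ) (0<r : 0 ℕ.< r)
    {u v s′ t′ : ℤ} (loc : Local q u v s′ t′) (m : ℕ) (m≋ : + (m ℕ.+ m) ≋ Local.m loc [ q ]) where

    open Local loc using (x; k; k′; unit; left; right)

    2∤q : ¬ 2 ℕ.∣ q
    2∤q d = two∤ (proj₁ half) (subst (2 ℕ.∣_) (proj₂ half) d)

    -- The nonsquare datum of A: congruent to the local m² + 1, hence coprime to q, and -1 is a
    -- square modulo each of its primes.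
    N₁ = suc ((m ℕ.+ m) ℕ.* (m ℕ.+ m))

    N₁≋ : + N₁ ≋ Local.m loc * Local.m loc + 1ℤ [ q ]
    N₁≋ = ≋-trans (≋-reflexive (trans (cong +_ (ℕ.+-comm 1 ((m ℕ.+ m) ℕ.* (m ℕ.+ m)))) (trans (ℤ.pos-+ ((m ℕ.+ m) ℕ.* (m ℕ.+ m)) 1) (cong (λ z → z + 1ℤ) (ℤ.pos-* (m ℕ.+ m) (m ℕ.+ m))))))
      (≋-+ʳ 1ℤ (≋-* m≋ m≋))

    c-qN : Coprime q N₁
    c-qN = Coprimality.sym (inverse⇒coprime (unit-≋ N₁≋ unit))

    c-2N : Coprime 2 N₁
    c-2N = prime∤⇒coprime prime[2] (λ d → two∤ (m ℕ.* (m ℕ.+ m)) (subst (2 ℕ.∣_) (cong suc (l m)) d))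
      where
      l : ∀ m → (m ℕ.+ m) ℕ.* (m ℕ.+ m) ≡ m ℕ.* (m ℕ.+ m) ℕ.+ m ℕ.* (m ℕ.+ m)
      l = ℕR.solve-∀

    ι-N : -1-Square N₁
    ι-N = + (m ℕ.+ m) , ≋-trans (≋-reflexive (trans (cong (λ z → z + 1ℤ) (sym (ℤ.pos-* (m ℕ.+ m) (m ℕ.+ m)))) (trans (sym (ℤ.pos-+ ((m ℕ.+ m) ℕ.* (m ℕ.+ m)) 1)) (cong +_ (ℕ.+-comm ((m ℕ.+ m) ℕ.* (m ℕ.+ m)) 1))))) modulus≋0

    D = 2 ℕ.* q

    q≢0 : q ≢ 0
    q≢0 = ℕ.≢-nonZero⁻¹ q

    D≢0 : D ≢ 0
    D≢0 = ≢0-* {2} {q} (λ ()) q≢0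

    module _ (p₀ : ℕ) (pr : Prime p₀) (ι₀ : -1-Square p₀) (c-big : Coprime (D ℕ.* (N₁ ℕ.* q !)) p₀) where

      cD : Coprime D p₀
      cD = coprime-dvdˡ (ℕ.m∣m*n (N₁ ℕ.* q !)) c-big

      q<p₀ : q ℕ.< p₀
      -- A prime at most q would divide `q !`. With c ≤ q < p₀, c is coprime to p₀ and 2c < p₀².
      q<p₀ = ℕ.≰⇒> λ p₀≤q → coprime⇒prime∤ pr (Coprimality.sym (coprime-dvdˡ (ℕ.∣n⇒∣m*n D (ℕ.n∣m*n N₁)) c-big)) ℕ.∣-refl
        (ℕ.∣-trans (self p₀ (prime≢0 pr)) (ℕ.m≤n⇒m!∣n! p₀≤q))
        where
        self : ∀ n → n ≢ 0 → n ℕ.∣ n !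
        self zero n≢0 = contradiction refl n≢0
        self (suc n) _ = ℕ.m∣m*n (n !)

      D₁ = D ℕ.* p₀

      c-D₁N : Coprime D₁ N₁
      c-D₁N = coprime-*ˡ (coprime-*ˡ c-2N c-qN) (Coprimality.sym (coprime-dvdˡ (ℕ.∣n⇒∣m*n D (ℕ.m∣m*n (q !))) c-big))

      q∣D : q ℕ.∣ D
      q∣D = ℕ.n∣m*n 2

      Q₀ = p₀ ℕ.^ 2

      module _ (s : ℕ) (r≤s : r ℕ.≤ s) (ex : Expansion q (4 ℕ.* Q₀ ℕ.* (s ℕ.* q)) D₁ N₁ s) where
        open Expansion ex renaming (Π to A′)

        instance
          nzsq : NonZero (s ℕ.* q)
          nzsq = ℕ.m*n≢0 s q {{ℕ.>-nonZero (ℕ.<-≤-trans 0<r r≤s)}}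

        -- The lower bound 4 Q₀ s q demanded of the prime powers is made for this: R is at most s q
        -- A′ divided by it.
        small : 4 ℕ.* (Q₀ ℕ.* R) ℕ.≤ A′
        small = ℕ.*-cancelˡ-≤ (s ℕ.* q) (ℕ.≤-trans (ℕ.≤-reflexive (l (s ℕ.* q) Q₀ R)) (radius-small moduli allC allBig))
          where
          l : ∀ n Q R → n ℕ.* (4 ℕ.* (Q ℕ.* R)) ≡ 4 ℕ.* Q ℕ.* n ℕ.* R
          l = ℕR.solve-∀

        c-A′ : Coprime A′ q
        c-A′ = Coprimality.sym (coprime-dvdˡ (ℕ.∣-trans q∣D (ℕ.m∣m*n p₀)) (moduli-coprime moduli))

        c-2A : Coprime (2 ℕ.* (Q₀ ℕ.* A′)) q
        c-2A = coprime-*ˡ (prime∤⇒coprime prime[2] 2∤q) (coprime-*ˡ (coprime-^ˡ 2 (Coprimality.sym (coprime-dvdˡ q∣D cD))) c-A′)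

        ρ : ℤ
        ρ = + (p₀ ℕ.* root)

        A≡ : + (Q₀ ℕ.* A′) ≡ + N₁ * (ρ * ρ)
        A≡ = trans (cong +_ (trans (cong (Q₀ ℕ.*_) Π≡) (l p₀ N₁ root))) (trans (ℤ.pos-* N₁ _) (cong (λ z → + N₁ * z) (ℤ.pos-* (p₀ ℕ.* root) (p₀ ℕ.* root))))
          where
          l : ∀ p N r → (p ℕ.* (p ℕ.* 1)) ℕ.* (N ℕ.* (r ℕ.* r)) ≡ N ℕ.* ((p ℕ.* r) ℕ.* (p ℕ.* r))
          l = ℕR.solve-∀

        -- A is N₁ times the square of ρ, so multiplying the local x and k by ρ turns the local
        -- equation into the congruence that X and a cluster centre must satisfy.
        target : ∀ {C κ w a} → C ≋ ρ * κ [ q ] → x * x + κ * κ ≋ w * (Local.m loc * Local.m loc + 1ℤ) [ q ] → w ≋ + a [ q ] →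
          (ρ * x) * (ρ * x) + C * C ≋ + (Q₀ ℕ.* A′) * + a [ q ]
        target {C} {κ} {w} {a} hC hκ hw = begin
          (ρ * x) * (ρ * x) + C * C             ≈⟨ ≋-+ˡ ((ρ * x) * (ρ * x)) (≋-* hC hC) ⟩
          (ρ * x) * (ρ * x) + (ρ * κ) * (ρ * κ) ≡⟨ l₁ ρ x κ ⟩
          (ρ * ρ) * (x * x + κ * κ)             ≈⟨ ≋-*ˡ (ρ * ρ) (≋-trans hκ (≋-* hw (≋-sym N₁≋))) ⟩
          (ρ * ρ) * (+ a * + N₁)                ≡⟨ l₂ (ρ * ρ) (+ a) (+ N₁) ⟩
          + N₁ * (ρ * ρ) * + a                  ≡⟨ cong (_* + a) A≡ ⟨
          + (Q₀ ℕ.* A′) * + a ∎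
          where
          open ≋-Reasoning q
          l₁ : ∀ ρ x κ → (ρ * x) * (ρ * x) + (ρ * κ) * (ρ * κ) ≡ (ρ * ρ) * (x * x + κ * κ)
          l₁ = solve-∀
          l₂ : ∀ z a N → z * (a * N) ≡ N * z * a
          l₂ = solve-∀

        module _ {a b : ℕ} (ha : u * u + v * v ≋ + a [ q ]) (hb : s′ * s′ + t′ * t′ ≋ + b [ q ]) where

          Pattern : ℕ → ℕ → ℕ → Set
          Pattern b₀ j n = b₀ ℕ.≤ n × (∀ i → i ℕ.≤ j → E (n ℕ.+ i) % q ≡ a % q) × (∀ i → j ℕ.< i → i ℕ.≤ j ℕ.+ suc s → E (n ℕ.+ i) % q ≡ b % q)

          from-centres : (Σ ℕ λ m₀ → Σ ℕ λ c → 0 ℕ.< c × c ℕ.≤ q × (+ A′ * (+ c + + Q₀ * + m₀) ≋ ρ * k [ q ]) ×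
              (∀ d → + Q₀ ≡ + c + + d → + A′ * (+ Q₀ * + m₀ + + d) ≋ ρ * k′ [ q ])) →
            ∀ b₀ j → j ℕ.≤ s → Σ ℕ (Pattern b₀ j)
          from-centres (m₀ , c , 0<c , c≤q , hL , hR) =
            Search.find q D p₀ c d m₀ (ℕ.m∣m*n q) q∣D pr ι₀ cD cp moduli allC Q≡ 0<c c<d small {ρ * x} {a} {b}
              (target (subst (λ z → + A′ * (+ c + z * + m₀) ≋ ρ * k [ q ]) (cong +_ Q≡) hL) left ha)
              (target (subst (λ z → + A′ * (z * + m₀ + + d) ≋ ρ * k′ [ q ]) (cong +_ Q≡) (hR d (cong +_ Q≡))) right hb)
            where
            c<p₀ : c ℕ.< p₀
            c<p₀ = ℕ.≤-<-trans c≤q q<p₀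
            instance
              nzp₀ : NonZero p₀
              nzp₀ = prime⇒nonZero pr
            2c<Q₀ : c ℕ.+ c ℕ.< Q₀
            2c<Q₀ = ℕ.<-≤-trans (ℕ.+-mono-< c<p₀ c<p₀) (ℕ.≤-trans (ℕ.≤-reflexive (l p₀)) (ℕ.≤-trans (ℕ.*-monoʳ-≤ p₀ (ℕ.nonTrivial⇒n>1 p₀ {{prime⇒nonTrivial pr}})) (ℕ.≤-reflexive (cong (p₀ ℕ.*_) (sym (ℕ.*-identityʳ p₀))))))
              where
              l : ∀ p → p ℕ.+ p ≡ p ℕ.* 2
              l = ℕR.solve-∀
            -- From 2c < Q₀ follows c < d, which puts the right cluster beyond the left one.
            d = Q₀ ℕ.∸ c
            Q≡ : Q₀ ≡ c ℕ.+ d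
            Q≡ = sym (ℕ.m+[n∸m]≡n (ℕ.≤-trans (ℕ.m≤m+n c c) (ℕ.<⇒≤ 2c<Q₀)))
            c<d : c ℕ.< d
            c<d = ℕ.+-cancelˡ-< c c d (subst (c ℕ.+ c ℕ.<_) Q≡ 2c<Q₀)
            cp : Coprime p₀ c
            cp = prime⇒coprime pr {{ℕ.>-nonZero 0<c}} c<p₀

          patterns : ∀ b₀ j → j ℕ.≤ s → Σ ℕ (Pattern b₀ j)
          patterns = from-centres (centres q A′ Q₀ c-A′ c-2A (ρ * k) (ρ * k′))

  admissible⇒≋ : ∀ {q} .{{_ : NonZero q}} {a} → Admissible q a → Σ ℤ λ u → Σ ℤ λ v → u * u + v * v ≋ + a [ q ]
  admissible⇒≋ {q} {a} (x , y , e) = + x , + y , ≋-trans (≋-reflexive (sym (trans (ℤ.pos-+ (x ℕ.* x) (y ℕ.* y)) (cong₂ _+_ (ℤ.pos-* x x) (ℤ.pos-* y y))))) (%≡⇒≋ (x ℕ.* x ℕ.+ y ℕ.* y) a e)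

  -- The local m fixes N₁. A prime p₀ for the separating sign is then taken away from N₁ and above
  -- q, and the remaining primes are those of N₁ padded to at least r, so that each run has more
  -- than r members.
  patterns-recur : ∀ q .{{_ : NonZero q}} → (Σ ℕ λ h → q ≡ suc (h ℕ.+ h)) → ∀ {a b} → Admissible q a → Admissible q b →
    ∀ r → 0 ℕ.< r → ∀ b₀ j → j ℕ.≤ r → Σ ℕ λ n → b₀ ℕ.≤ n ×
      (∀ i → i ℕ.≤ j → E (n ℕ.+ i) % q ≡ a % q) × (∀ i → j ℕ.< i → i ℕ.≤ r → E (n ℕ.+ i) % q ≡ b % q)
  patterns-recur q half {a} {b} adm-a adm-b r 0<r b₀ j j≤r = go (admissible⇒≋ adm-a) (admissible⇒≋ adm-b)
    where
    Result = Σ ℕ λ n → b₀ ℕ.≤ n × (∀ i → i ℕ.≤ j → E (n ℕ.+ i) % q ≡ a % q) × (∀ i → j ℕ.< i → i ℕ.≤ r → E (n ℕ.+ i) % q ≡ b % q)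
    go : (Σ ℤ λ u → Σ ℤ λ v → u * u + v * v ≋ + a [ q ]) → (Σ ℤ λ s → Σ ℤ λ t → s * s + t * t ≋ + b [ q ]) → Result
    go (u , v , ha) (s′ , t′ , hb) = go₂ loc (even-representative q half (Local.m loc))
      where
      loc : Local q u v s′ t′
      loc = local q (ℕ.≢-nonZero⁻¹ q) (λ d → two∤ (proj₁ half) (subst (2 ℕ.∣_) (proj₂ half) d)) u v s′ t′
      go₂ : (loc : Local q u v s′ t′) → (Σ ℕ λ m → + (m ℕ.+ m) ≋ Local.m loc [ q ]) → Result
      go₂ loc (m , m≋) = go₃ (new-prime (As.D ℕ.* (As.N₁ ℕ.* q !)) (≢0-* As.D≢0 (≢0-* {As.N₁} (λ ()) (ℕ.≢-nonZero⁻¹ (q !) {{q ℕ.!≢0}}))))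
        where
        module As = Assembly q half r 0<r loc m m≋
        go₃ : (Σ ℕ λ p → Prime p × -1-Square p × Coprime (As.D ℕ.* (As.N₁ ℕ.* q !)) p) → Result
        go₃ (p₀ , pr , ι₀ , c-big) = go₄ (prime-list r As.N₁ (λ ()) (As.D₁ p₀ pr ι₀ c-big) (≢0-* As.D≢0 (prime≢0 pr)) (As.c-D₁N p₀ pr ι₀ c-big) As.ι-N)
          where
          go₄ : (Σ ℕ λ s → r ℕ.≤ s × PrimeList (As.D₁ p₀ pr ι₀ c-big) As.N₁ s) → Result
          go₄ (s , r≤s , pl) = trim (As.patterns p₀ pr ι₀ c-big s r≤s (expand (4 ℕ.* p₀ ℕ.^ 2 ℕ.* (s ℕ.* q)) (ℕ.∣-trans (As.q∣D p₀ pr ι₀ c-big) (ℕ.m∣m*n p₀)) pl) {a} {b} ha hb b₀ j (ℕ.≤-trans j≤r r≤s))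
            where
            trim : (Σ ℕ λ n → b₀ ℕ.≤ n × (∀ i → i ℕ.≤ j → E (n ℕ.+ i) % q ≡ a % q) × (∀ i → j ℕ.< i → i ℕ.≤ j ℕ.+ suc s → E (n ℕ.+ i) % q ≡ b % q)) → Result
            trim (n , b₀≤n , l , r′) = n , b₀≤n , l , λ i j<i i≤r → r′ i j<i (ℕ.≤-trans i≤r (ℕ.≤-trans r≤s (ℕ.≤-trans (ℕ.n≤1+n s) (ℕ.m≤n+m (suc s) j))))

-- From recurring patterns to the unboundedness of the count.

open import Defs
open import Data.Nat using (_≤_; _<_)
open Enumeration using (pattern-holds; N-unbounded)
open Nonresidues using (parity)
open Recurrence using (patterns-recur)

theorem1p1 : (q : ℕ) → .{{_ : NonZero q}} → 1 ≤ q → q % 2 ≡ 1 →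
    (a b : ℕ) → Admissible q a → Admissible q b →
    (r : ℕ) → 1 ≤ r → (𝐚 : Fin r → ℕ) →
    (j : ℕ) → 1 ≤ j → j ≤ r →
    ((i : Fin r) → suc (toℕ i) ≤ j → 𝐚 i % q ≡ a % q) →
    ((i : Fin r) → j < suc (toℕ i) → 𝐚 i % q ≡ b % q) →
    (M : ℕ) → Σ ℕ λ x → M ≤ N x q r 𝐚
theorem1p1 q _ q-odd a b adm-a adm-b r 1≤r 𝐚 (suc j) _ j<r left right M = N-unbounded q r 𝐚 often M
  where
  half : Σ ℕ λ h → q ≡ suc (h ℕ.+ h)
  half with parity q
  ... | h , inj₂ e = h , e
  ... | h , inj₁ refl = contradiction (trans (sym q-odd) (trans (cong (_% 2) (l h)) ([m+kn]%n≡m%n 0 h 2))) (λ ())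
    where
    l : ∀ h → h ℕ.+ h ≡ 0 ℕ.+ h ℕ.* 2
    l = ℕR.solve-∀
  often : ∀ b₀ → Σ ℕ λ n → b₀ ≤ n × patternAt? q r 𝐚 n ≡ true
  -- Entries of the tuple are counted from 1 and indices from 0: after matching the bound as
  -- `suc j`, the class of a fills the indices 0 to j.
  often b₀ = at (patterns-recur q half adm-a adm-b r 1≤r b₀ j (ℕ.<⇒≤ j<r))
    where
    at : (Σ ℕ λ n → b₀ ≤ n × (∀ i → i ≤ j → E (n ℕ.+ i) % q ≡ a % q) × (∀ i → j < i → i ≤ r → E (n ℕ.+ i) % q ≡ b % q)) →
      Σ ℕ λ n → b₀ ≤ n × patternAt? q r 𝐚 n ≡ true
    at (n , b₀≤n , first , second) = n , b₀≤n , pattern-holds q r 𝐚 n entry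
      where
      entry : ∀ i → E (n ℕ.+ toℕ i) % q ≡ 𝐚 i % q
      entry i with toℕ i ℕ.≤? j
      ... | yes i≤j = trans (first (toℕ i) i≤j) (sym (left i (s≤s i≤j)))
      ... | no i≰j = trans (second (toℕ i) (ℕ.≰⇒> i≰j) (ℕ.<⇒≤ (toℕ<n i))) (sym (right i (s≤s (ℕ.≰⇒> i≰j))))
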